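{- Let $q>2$ be a prime power. The set of forbidden induced minors for $\mathcal{M}_q$ is $\{U_{2,k}:2<k\le q\}\cup\{U_{3,q+2}\}$: a simple $GF(q)$-representable matroid belongs to $\mathcal{M}_q$ if and only if it has no induced minor isomorphic to a member of this set, and each member of this set is not in $\mathcal{M}_q$ while all of its proper induced minors are in $\mathcal{M}_q$.
   Context: All matroids are simple; every contraction is immediately followed by simplification. $P_r$ denotes $PG(r-1,q)$. If $M_1,M_2$ are matroids whose ground sets meet in a set $T$ that is a modular flat of $M_1$, with $M_1|T=M_2|T=N$, the generalized parallel connection $P_N(M_1,M_2)$ is the matroid on $E(M_1)\cup E(M_2)$ whose flats are the sets $X$ with $X\cap E(M_1)$ a flat of $M_1$ and $X\cap E(M_2)$ a flat of $M_2$. $\mathcal{M}_q$ is the class of matroids that can be built from projective geometries over $GF(q)$ by a sequence of generalized parallel connections across projective geometries over $GF(q)$. An induced minor of $M$ is a matroid obtainable from $M$ by a sequence of restrictions to flats and contractions (each followed by simplification). -}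

module Defs where

open import Level using (0ℓ)
open import Data.Nat using (ℕ; zero; suc; _+_; _^_; _≤_; _<_)
open import Data.Nat.Primality using (Prime)
open import Data.Bool using (Bool; true; false; _∧_; _∨_)
open import Data.Fin using (Fin; _≟_)
open import Data.Fin.Subset using (Subset; ⊥; ⊤; ⁅_⁆; _∈_; _∉_; _⊆_; _∩_; _∪_; ∣_∣)
open import Data.Vec using (tabulate; lookup)
open import Data.Product using (Σ; ∃; ∃-syntax; _×_; _,_)
open import Data.Sum using (_⊎_)
open import Relation.Nullary using (¬_; does)
open import Relation.Binary.PropositionalEquality using (_≡_)
open import Function.Bundles using (_⇔_)
open import Function.Definitions using (Injective; Surjective)
open import Algebra.Bundles using (CommutativeRing)

IsPrimePower : ℕ → Set
IsPrimePower q = ∃[ p ] ∃[ k ] (Prime p × 1 ≤ k × q ≡ p ^ k)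

record FiniteField (q : ℕ) : Set₁ where
  field
    commRing : CommutativeRing 0ℓ 0ℓ
  open CommutativeRing commRing public hiding (ring)
  field
    0≉1     : ¬ (0# ≈ 1#)
    inverse : ∀ x → ¬ (x ≈ 0#) → ∃[ y ] (x * y ≈ 1#)
    enum    : Fin q → Carrier
    enum-injective  : ∀ i j → enum i ≈ enum j → i ≡ j
    enum-surjective : ∀ x → ∃[ i ] (enum i ≈ x)

anyFin : ∀ {m} → (Fin m → Bool) → Bool
anyFin {zero}  p = false
anyFin {suc m} p = p Data.Fin.zero ∨ anyFin (λ i → p (Data.Fin.suc i))

image : ∀ {m n} → (Fin m → Fin n) → Subset m → Subset n
image g Y = tabulate (λ j → anyFin (λ i → lookup Y i ∧ does (g i ≟ j)))

preimage : ∀ {m n} → (Fin m → Fin n) → Subset n → Subset m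
preimage g X = tabulate (λ i → lookup X (g i))

record Matroid (n : ℕ) : Set₁ where
  field
    Indep     : Subset n → Set
    indep-∅   : Indep ⊥
    indep-⊆   : ∀ {X Y} → Y ⊆ X → Indep X → Indep Y
    indep-aug : ∀ {X Y} → Indep X → Indep Y → ∣ X ∣ < ∣ Y ∣ →
                ∃[ e ] (e ∈ Y × e ∉ X × Indep (X ∪ ⁅ e ⁆))
open Matroid public

module _ {n : ℕ} (M : Matroid n) where

  Simple : Set
  Simple = ∀ X → ∣ X ∣ ≤ 2 → Indep M X

  IsBasis : Subset n → Subset n → Set
  IsBasis B X = B ⊆ X × Indep M B × (∀ e → e ∈ X → e ∉ B → ¬ Indep M (B ∪ ⁅ e ⁆))

  Rank : Subset n → ℕ → Set
  Rank X k = ∃[ B ] (IsBasis B X × ∣ B ∣ ≡ k)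

  Flat : Subset n → Set
  Flat X = ∀ e → e ∉ X → ∀ k → Rank X k → ¬ Rank (X ∪ ⁅ e ⁆) k

  ModularFlat : Subset n → Set
  ModularFlat T = Flat T × (∀ F → Flat F → ∀ a b c d → Rank T a → Rank F b →
                    Rank (T ∩ F) c → Rank (T ∪ F) d → a + b ≡ c + d)

  -- independence in the contraction M / C (elements of C become loops)
  IndepContr : Subset n → Subset n → Set
  IndepContr C X = X ∩ C ≡ ⊥ × ∃[ B ] (IsBasis B C × Indep M (X ∪ B))

IsoVia : ∀ {m n} → Matroid m → Matroid n → (Fin m → Fin n) → Set
IsoVia N M g = Injective _≡_ _≡_ g × Surjective _≡_ _≡_ g ×
               (∀ Y → Indep N Y ⇔ Indep M (image g Y))

Iso : ∀ {m n} → Matroid m → Matroid n → Set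
Iso N M = ∃[ g ] IsoVia N M g

RestrictionVia : ∀ {m n} → Matroid m → Matroid n → Subset n → (Fin m → Fin n) → Set
RestrictionVia N M X g = Injective _≡_ _≡_ g × (∀ j → j ∈ X ⇔ (∃[ i ] (g i ≡ j))) ×
                         (∀ Y → Indep N Y ⇔ Indep M (image g Y))

-- N ≅ si(M / C) via g: g picks one element from each parallel class of
-- non-loops of M / C, and independence is that of M / C.
SiContrVia : ∀ {m n} → Matroid m → Matroid n → Subset n → (Fin m → Fin n) → Set
SiContrVia N M C g = Simple N × Injective _≡_ _≡_ g ×
                     (∀ Y → Indep N Y ⇔ IndepContr M C (image g Y)) ×
                     (∀ e → ¬ IndepContr M C ⁅ e ⁆ ⊎
                            ∃[ i ] (g i ≡ e ⊎ ¬ IndepContr M C (⁅ e ⁆ ∪ ⁅ g i ⁆)))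

data InducedMinor : ∀ {m n} → Matroid m → Matroid n → Set₁ where
  im-iso   : ∀ {m n} {N : Matroid m} {M : Matroid n} → Iso N M → InducedMinor N M
  im-restr : ∀ {m k n} {N : Matroid m} {M' : Matroid k} {M : Matroid n}
             (F : Subset n) (g : Fin k → Fin n) →
             Flat M F → RestrictionVia M' M F g → InducedMinor N M' → InducedMinor N M
  im-contr : ∀ {m k n} {N : Matroid m} {M' : Matroid k} {M : Matroid n}
             (C : Subset n) (g : Fin k → Fin n) →
             SiContrVia M' M C g → InducedMinor N M' → InducedMinor N M

module _ {q : ℕ} (𝔽 : FiniteField q) where
  open FiniteField 𝔽 using (Carrier; _≈_; 0#) renaming (_+_ to _+F_; _*_ to _*F_)

  sumFin : ∀ {n} → (Fin n → Carrier) → Carrier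
  sumFin {zero}  f = 0#
  sumFin {suc n} f = f Data.Fin.zero +F sumFin (λ i → f (Data.Fin.suc i))

  LinIndep : ∀ {n r} → (Fin n → Fin r → Carrier) → Subset n → Set
  LinIndep {n} v X = ∀ (c : Fin n → Carrier) → (∀ i → i ∉ X → c i ≈ 0#) →
                     (∀ j → sumFin (λ i → c i *F v i j) ≈ 0#) → ∀ i → c i ≈ 0#

  RepresentedBy : ∀ {n r} → Matroid n → (Fin n → Fin r → Carrier) → Set
  RepresentedBy M v = ∀ X → Indep M X ⇔ LinIndep v X

  Representable : ∀ {n} → Matroid n → Set
  Representable {n} M = ∃[ r ] Σ (Fin n → Fin r → Carrier) (RepresentedBy M)

  -- M ≅ PG(r-1, q): M is simple and is the vector matroid of a set of
  -- vectors in 𝔽^r containing a representative of every 1-dim subspace.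
  IsPG : ∀ {n} → ℕ → Matroid n → Set
  IsPG {n} r M = Simple M × Σ (Fin n → Fin r → Carrier) λ v → RepresentedBy M v ×
                 (∀ (w : Fin r → Carrier) → ¬ (∀ j → w j ≈ 0#) →
                    ∃[ i ] ∃[ λ' ] (∀ j → w j ≈ λ' *F v i j))

  data InMq : ∀ {n} → Matroid n → Set₁ where
    mq-pg  : ∀ {n} {M : Matroid n} (r : ℕ) → IsPG r M → InMq M
    mq-gpc : ∀ {n₁ n₂ n} {M₁ : Matroid n₁} {M₂ : Matroid n₂} (P : Matroid n)
             (f₁ : Fin n₁ → Fin n) (f₂ : Fin n₂ → Fin n) →
             InMq M₁ → InMq M₂ →
             Injective _≡_ _≡_ f₁ → Injective _≡_ _≡_ f₂ →
             (∀ x → ∃[ a ] (f₁ a ≡ x) ⊎ ∃[ b ] (f₂ b ≡ x)) →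
             -- T = E(M₁) ∩ E(M₂) is a modular flat of M₁
             ModularFlat M₁ (preimage f₁ (image f₂ ⊤)) →
             (∀ X → X ⊆ (image f₁ ⊤ ∩ image f₂ ⊤) →
                Indep M₁ (preimage f₁ X) ⇔ Indep M₂ (preimage f₂ X)) →
             (∃[ k ] Σ (Matroid k) λ N → ∃[ g ] ∃[ r ]
                (RestrictionVia N M₁ (preimage f₁ (image f₂ ⊤)) g × IsPG r N)) →
             (∀ X → Flat P X ⇔ (Flat M₁ (preimage f₁ X) × Flat M₂ (preimage f₂ X))) →
             InMq P

IsUniform : ∀ {k} → ℕ → Matroid k → Set
IsUniform r N = ∀ X → Indep N X ⇔ ∣ X ∣ ≤ r

Forbidden : ℕ → ∀ {m} → Matroid m → Set
Forbidden q {m} N = (2 < m × m ≤ q × IsUniform 2 N) ⊎ (m ≡ q + 2 × IsUniform 3 N)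

-- Members of the class satisfy: a line with three points in a contraction has at most q + 1 points,
-- and is the image of a line of M that has q + 1 points. This holds for projective geometries,
-- survives generalized parallel connections across them, and rules out the forbidden minors: for
-- U₂,ₖ it produces too many points, for U₃,q₊₂ contracted by a point three collinear ones.
--
-- Conversely, represent M by vectors and its contractions by vectors modulo subspaces W. Without
-- the minors U₂,ₖ every line with three points modulo W is full, and without U₃,q₊₂ every circuit of
-- four points modulo W has a chord. Call two points adjacent if their line is full; then no
-- contraction has a chordless 4-cycle. As in Dirac's theorem on chordal graphs, M is separated at
-- nonadjacent points by two subspaces A and B that cover its points, and refining them at
-- nonadjacent points of A ∩ B makes A ∩ B a projective geometry. So M is the generalized parallel
-- connection of its restrictions to A and B, which are smaller.
--
-- A proper induced minor of a forbidden one has at most two points or is U₂,q₊₁, so it contains no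
-- forbidden minor itself.
module Submission where

open import Defs
open import Algebra.Bundles using (CommutativeRing; RawRing)
import Algebra.Properties.Ring as RingProperties
import Algebra.Properties.Semiring.Mult as Mult
import Algebra.Solver.CommutativeMonoid as CMSolver
import Algebra.Solver.Ring as RingSolver
open import Algebra.Solver.Ring.AlmostCommutativeRing using (fromCommutativeRing; _-Raw-AlmostCommutative⟶_)
open import Data.Bool using (Bool; true; false; _∧_)
open import Data.Empty using () renaming (⊥ to Empty; ⊥-elim to absurd)
open import Data.Fin as Fin using (Fin; zero; suc)
import Data.Fin.Properties as Fin
open import Data.Fin.Subset using (Subset; ⊥; ⊤; ⁅_⁆; _∈_; _∉_; _⊆_; _∩_; _∪_; ∣_∣; Nonempty; inside; outside) renaming (_-_ to infixl 5 _⊖_)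
open import Data.Fin.Subset.Properties
open import Data.List as List using (List; []; _∷_; length; filter; allFin; _++_)
import Data.List.Membership.Propositional as L
open import Data.List.Membership.Propositional.Properties using (∈-filter⁺; ∈-filter⁻; ∈-allFin; ∈-++⁺ˡ; ∈-++⁺ʳ; ∈-++⁻; ∈-tabulate⁺; ∈-tabulate⁻)
open import Data.List.Properties using (++-assoc; filter-all)
open import Data.List.Relation.Unary.All as All using (All; []; _∷_)
import Data.List.Relation.Unary.All.Properties as All
open import Data.List.Relation.Unary.Any as Any using (here; there)
open import Data.Maybe using (Maybe; just; nothing)
open import Data.Nat as ℕ using (ℕ; zero; suc; _≤_; _<_; z≤n; s≤s)
import Data.Nat.Properties as ℕ
open import Data.Product using (Σ; ∃; ∃-syntax; _×_; _,_; proj₁; proj₂)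
open import Data.Sum using (_⊎_; inj₁; inj₂; [_,_]′)
open import Data.Unit using (tt) renaming (⊤ to Unit)
open import Data.Vec as Vec using (Vec; []; _∷_; tabulate; lookup; here; there)
open import Data.Vec.Properties using (lookup∘tabulate; []=⇒lookup; lookup⇒[]=)
open import Function using (_∘_; id)
open import Function.Bundles using (_⇔_; mk⇔; Equivalence)
open import Function.Definitions using (Injective)
open import Relation.Binary.PropositionalEquality as ≡ using (_≡_; _≢_; cong; cong₂; subst)
import Relation.Binary.Reasoning.Setoid as SetoidReasoning
open import Relation.Nullary using (¬_; Dec; yes; no; does)
open import Relation.Nullary.Decidable using (_×-dec_; ¬?; map′; decidable-stable; _⊎-dec_; dec-true; ¬¬-excluded-middle)
open Equivalence using (to; from)
open L using (find; lose)

-- The polynomial solver needs coefficients with decidable equality: the integers, as formal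
-- differences of naturals.
module Solver {a b} (R : CommutativeRing a b) where
  open CommutativeRing R
  open RingProperties ring using (-‿distribˡ-*; -‿distribʳ-*; -‿+-comm; -‿involutive; -0#≈0#)
  open Mult semiring using (×-homo-+; ×1-homo-*) renaming (_×_ to _×ᵣ_)
  open SetoidReasoning setoid

  private
    Coeff : RawRing _ _
    Coeff = record
      { Carrier = Σ ℕ (λ _ → ℕ)
      ; _≈_ = _≡_
      ; _+_ = λ (m , n) (k , l) → m ℕ.+ k , n ℕ.+ l
      ; _*_ = λ (m , n) (k , l) → m ℕ.* k ℕ.+ n ℕ.* l , m ℕ.* l ℕ.+ n ℕ.* k
      ; -_ = λ (m , n) → n , m
      ; 0# = 0 , 0
      ; 1# = 1 , 0
      }

    ⟦_⟧ᶜ : Σ ℕ (λ _ → ℕ) → Carrier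
    ⟦ 0 , 0 ⟧ᶜ = 0#
    ⟦ 1 , 0 ⟧ᶜ = 1#
    ⟦ m , n ⟧ᶜ = m ×ᵣ 1# + - (n ×ᵣ 1#)

    spec : ∀ m n → ⟦ m , n ⟧ᶜ ≈ m ×ᵣ 1# + - (n ×ᵣ 1#)
    spec 0 0 = sym (trans (+-identityˡ _) -0#≈0#)
    spec 1 0 = sym (trans (+-congˡ -0#≈0#) (trans (+-identityʳ _) (+-identityʳ _)))
    spec 0 (suc n) = refl
    spec 1 (suc n) = refl
    spec (suc (suc m)) n = refl

    interchange : ∀ w x y z → (w + x) + (y + z) ≈ (w + y) + (x + z)
    interchange = solve 4 (λ w x y z → (w ⊕ x) ⊕ (y ⊕ z) ⊜ (w ⊕ y) ⊕ (x ⊕ z)) refl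
      where open CMSolver +-commutativeMonoid

    +-homo : ∀ x y → ⟦ RawRing._+_ Coeff x y ⟧ᶜ ≈ ⟦ x ⟧ᶜ + ⟦ y ⟧ᶜ
    +-homo (m , n) (k , l) = begin
      ⟦ m ℕ.+ k , n ℕ.+ l ⟧ᶜ                          ≈⟨ spec (m ℕ.+ k) (n ℕ.+ l) ⟩
      (m ℕ.+ k) ×ᵣ 1# + - ((n ℕ.+ l) ×ᵣ 1#)             ≈⟨ +-cong (×-homo-+ 1# m k) (-‿cong (×-homo-+ 1# n l)) ⟩
      (m ×ᵣ 1# + k ×ᵣ 1#) + - (n ×ᵣ 1# + l ×ᵣ 1#)         ≈⟨ +-congˡ (-‿+-comm _ _) ⟨
      (m ×ᵣ 1# + k ×ᵣ 1#) + (- (n ×ᵣ 1#) + - (l ×ᵣ 1#))   ≈⟨ interchange _ _ _ _ ⟩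
      (m ×ᵣ 1# + - (n ×ᵣ 1#)) + (k ×ᵣ 1# + - (l ×ᵣ 1#))   ≈⟨ +-cong (spec m n) (spec k l) ⟨
      ⟦ m , n ⟧ᶜ + ⟦ k , l ⟧ᶜ                         ∎

    *-homo : ∀ x y → ⟦ RawRing._*_ Coeff x y ⟧ᶜ ≈ ⟦ x ⟧ᶜ * ⟦ y ⟧ᶜ
    *-homo (m , n) (k , l) = begin
      ⟦ m ℕ.* k ℕ.+ n ℕ.* l , m ℕ.* l ℕ.+ n ℕ.* k ⟧ᶜ  ≈⟨ spec (m ℕ.* k ℕ.+ n ℕ.* l) (m ℕ.* l ℕ.+ n ℕ.* k) ⟩
      (m ℕ.* k ℕ.+ n ℕ.* l) ×ᵣ 1# + - ((m ℕ.* l ℕ.+ n ℕ.* k) ×ᵣ 1#)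
        ≈⟨ +-cong (trans (×-homo-+ 1# (m ℕ.* k) _) (+-cong (×1-homo-* m k) (×1-homo-* n l)))
                  (-‿cong (trans (×-homo-+ 1# (m ℕ.* l) _) (+-cong (×1-homo-* m l) (×1-homo-* n k)))) ⟩
      (M * K + N * L) + - (M * L + N * K)             ≈⟨ +-congˡ (-‿+-comm _ _) ⟨
      (M * K + N * L) + (- (M * L) + - (N * K))       ≈⟨ +-congʳ (+-congˡ negneg) ⟩
      (M * K + - N * - L) + (- (M * L) + - (N * K))   ≈⟨ +-congˡ (+-cong (-‿distribʳ-* M L) (-‿distribˡ-* N K)) ⟩
      (M * K + - N * - L) + (M * - L + - N * K)       ≈⟨ shuffle _ _ _ _ ⟩
      (M * K + - N * K) + (M * - L + - N * - L)       ≈⟨ +-cong (distribʳ K M (- N)) (distribʳ (- L) M (- N)) ⟨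
      (M + - N) * K + (M + - N) * - L                 ≈⟨ distribˡ (M + - N) K (- L) ⟨
      (M + - N) * (K + - L)                           ≈⟨ *-cong (spec m n) (spec k l) ⟨
      ⟦ m , n ⟧ᶜ * ⟦ k , l ⟧ᶜ                         ∎
      where
      M = m ×ᵣ 1#
      N = n ×ᵣ 1#
      K = k ×ᵣ 1#
      L = l ×ᵣ 1#
      negneg : N * L ≈ - N * - L
      negneg = begin
        N * L         ≈⟨ -‿involutive _ ⟨
        - - (N * L)   ≈⟨ -‿cong (-‿distribʳ-* N L) ⟩
        - (N * - L)   ≈⟨ -‿distribˡ-* N (- L) ⟩
        - N * - L     ∎
      shuffle : ∀ w x y z → (w + x) + (y + z) ≈ (w + z) + (y + x)
      shuffle = solve 4 (λ w x y z → (w ⊕ x) ⊕ (y ⊕ z) ⊜ (w ⊕ z) ⊕ (y ⊕ x)) refl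
        where open CMSolver +-commutativeMonoid

    morphism : Coeff -Raw-AlmostCommutative⟶ fromCommutativeRing R
    morphism = record
      { ⟦_⟧ = ⟦_⟧ᶜ
      ; +-homo = +-homo
      ; *-homo = *-homo
      ; -‿homo = λ (m , n) → trans (spec n m) (trans (trans (+-comm _ _)
          (trans (+-congˡ (sym (-‿involutive _))) (-‿+-comm _ _))) (-‿cong (sym (spec m n))))
      ; 0-homo = refl
      ; 1-homo = refl
      }

    ⟦⟧-cong : ∀ x y → Maybe (⟦ x ⟧ᶜ ≈ ⟦ y ⟧ᶜ)
    ⟦⟧-cong (m , n) (k , l) with m ℕ.+ l ℕ.≟ k ℕ.+ n
    ... | no _ = nothing
    ... | yes eq = just (begin
      ⟦ m , n ⟧ᶜ                  ≈⟨ spec m n ⟩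
      M + - N                     ≈⟨ +-identityʳ _ ⟨
      (M + - N) + 0#              ≈⟨ +-congˡ (-‿inverseʳ L) ⟨
      (M + - N) + (L + - L)       ≈⟨ interchange _ _ _ _ ⟩
      (M + L) + (- N + - L)       ≈⟨ +-congʳ (trans (sym (×-homo-+ 1# m l)) (trans (reflexive (cong (_×ᵣ 1#) eq)) (×-homo-+ 1# k n))) ⟩
      (K + N) + (- N + - L)       ≈⟨ +-congˡ (+-comm _ _) ⟩
      (K + N) + (- L + - N)       ≈⟨ interchange _ _ _ _ ⟩
      (K + - L) + (N + - N)       ≈⟨ +-congˡ (-‿inverseʳ N) ⟩
      (K + - L) + 0#              ≈⟨ +-identityʳ _ ⟩
      K + - L                     ≈⟨ spec k l ⟨
      ⟦ k , l ⟧ᶜ                  ∎)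
      where
      M = m ×ᵣ 1#
      N = n ×ᵣ 1#
      K = k ×ᵣ 1#
      L = l ×ᵣ 1#

  open RingSolver Coeff (fromCommutativeRing R) morphism ⟦⟧-cong public

  :0 :1 : ∀ {n} → Polynomial n
  :0 = con (0 , 0)
  :1 = con (1 , 0)

em : (A : Set) → (Dec A → Empty) → Empty
em A = ¬¬-excluded-middle

¬¬-all : ∀ {n} {P : Fin n → Set} → (∀ i → ¬ ¬ P i) → ¬ ¬ (∀ i → P i)
¬¬-all {zero}  h k = k (λ ())
¬¬-all {suc n} h k = h zero λ p → ¬¬-all (h ∘ suc) λ ps →
  k λ { zero → p ; (suc i) → ps i }

¬¬-dec : ∀ {n} (P : Fin n → Set) → ¬ ¬ (∀ i → Dec (P i))
¬¬-dec P = ¬¬-all (λ i → ¬¬-excluded-middle)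

¬¬-allSubset : ∀ {n} {P : Subset n → Set} → (∀ X → ¬ ¬ P X) → ¬ ¬ (∀ X → P X)
¬¬-allSubset {zero}  h k = h [] λ p → k λ { [] → p }
¬¬-allSubset {suc n} h k =
  ¬¬-allSubset (λ X → h (inside ∷ X)) λ p →
  ¬¬-allSubset (λ X → h (outside ∷ X)) λ r →
  k λ { (true ∷ X) → p X ; (false ∷ X) → r X }

module _ {n} {P : Fin n → Set} where
  sub : (∀ i → Dec (P i)) → Subset n
  sub P? = tabulate (λ i → does (P? i))

  ∈sub⁺ : (P? : ∀ i → Dec (P i)) → ∀ {i} → P i → i ∈ sub P?
  ∈sub⁺ P? {i} p = lookup⇒[]= i _ (≡.trans (lookup∘tabulate _ i) (dec-true (P? i) p))

  ∈sub⁻ : (P? : ∀ i → Dec (P i)) → ∀ {i} → i ∈ sub P? → P i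
  ∈sub⁻ P? {i} i∈ with P? i | ≡.trans (≡.sym (lookup∘tabulate (λ i → does (P? i)) i)) ([]=⇒lookup i∈)
  ... | yes p | _ = p
  ... | no _  | ()

anyFin⁺ : ∀ {m} (p : Fin m → Bool) i → p i ≡ true → anyFin p ≡ true
anyFin⁺ p zero e rewrite e = ≡.refl
anyFin⁺ p (suc i) e with p zero
... | true = ≡.refl
... | false = anyFin⁺ (p ∘ suc) i e

anyFin⁻ : ∀ {m} (p : Fin m → Bool) → anyFin p ≡ true → ∃[ i ] (p i ≡ true)
anyFin⁻ {suc m} p e with p zero in eq
... | true = zero , eq
... | false with anyFin⁻ (p ∘ suc) e
...   | i , e' = suc i , e'

module _ {m n} (g : Fin m → Fin n) where
  ∈image⁺ : ∀ {Y i} → i ∈ Y → g i ∈ image g Y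
  ∈image⁺ {Y} {i} i∈ = lookup⇒[]= (g i) _ (≡.trans (lookup∘tabulate _ (g i)) (anyFin⁺ _ i h))
    where
    h : lookup Y i ∧ does (g i Fin.≟ g i) ≡ true
    h rewrite []=⇒lookup i∈ = dec-true (g i Fin.≟ g i) ≡.refl

  ∈image⁻ : ∀ {Y j} → j ∈ image g Y → ∃[ i ] (i ∈ Y × g i ≡ j)
  ∈image⁻ {Y} {j} j∈ with anyFin⁻ _ (≡.trans (≡.sym (lookup∘tabulate _ j)) ([]=⇒lookup j∈))
  ... | i , e with lookup Y i in eq | g i Fin.≟ j
  ...   | true | yes r = i , lookup⇒[]= i Y eq , r
  ...   | true | no _ with () ← e
  ...   | false | _ with () ← e

  ∈preimage⁺ : ∀ {X i} → g i ∈ X → i ∈ preimage g X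
  ∈preimage⁺ {X} {i} h = lookup⇒[]= i _ (≡.trans (lookup∘tabulate _ i) ([]=⇒lookup h))

  ∈preimage⁻ : ∀ {X i} → i ∈ preimage g X → g i ∈ X
  ∈preimage⁻ {X} {i} h = lookup⇒[]= (g i) X (≡.trans (≡.sym (lookup∘tabulate _ i)) ([]=⇒lookup h))

∪⁅⁆⁻ : ∀ {n} (X : Subset n) e {i} → i ∈ X ∪ ⁅ e ⁆ → i ∈ X ⊎ i ≡ e
∪⁅⁆⁻ X e h with x∈p∪q⁻ X ⁅ e ⁆ h
... | inj₁ a = inj₁ a
... | inj₂ b = inj₂ (x∈⁅y⁆⇒x≡y e b)

∪⁅⁆⁺ˡ : ∀ {n} (X : Subset n) e {i} → i ∈ X → i ∈ X ∪ ⁅ e ⁆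
∪⁅⁆⁺ˡ X e = p⊆p∪q ⁅ e ⁆

∪⁅⁆⁺ʳ : ∀ {n} (X : Subset n) e → e ∈ X ∪ ⁅ e ⁆
∪⁅⁆⁺ʳ X e = q⊆p∪q X ⁅ e ⁆ (x∈⁅x⁆ e)

∪⁅⁆-⊆ : ∀ {n} {X Y : Subset n} {e} → X ⊆ Y → e ∈ Y → X ∪ ⁅ e ⁆ ⊆ Y
∪⁅⁆-⊆ {X = X} {e = e} X⊆Y e∈Y h with ∪⁅⁆⁻ X e h
... | inj₁ a = X⊆Y a
... | inj₂ ≡.refl = e∈Y

⊆∧∌⇒∣∣< : ∀ {n} {X Y : Subset n} {e} → X ⊆ Y → e ∈ Y → e ∉ X → ∣ X ∣ < ∣ Y ∣
⊆∧∌⇒∣∣< X⊆Y e∈Y e∉X = p⊂q⇒∣p∣<∣q∣ (X⊆Y , _ , e∈Y , e∉X)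

∣∪⁅⁆∣ : ∀ {n} (X : Subset n) {e} → e ∉ X → ∣ X ∪ ⁅ e ⁆ ∣ ≡ suc ∣ X ∣
∣∪⁅⁆∣ (true ∷ X)  {zero} h = absurd (h here)
∣∪⁅⁆∣ (false ∷ X) {zero} h rewrite ∪-identityʳ X = ≡.refl
∣∪⁅⁆∣ (true ∷ X)  {suc e} h = cong suc (∣∪⁅⁆∣ X (h ∘ there))
∣∪⁅⁆∣ (false ∷ X) {suc e} h = ∣∪⁅⁆∣ X (h ∘ there)

∣∪∣+∣∩∣ : ∀ {n} (X Y : Subset n) → ∣ X ∪ Y ∣ ℕ.+ ∣ X ∩ Y ∣ ≡ ∣ X ∣ ℕ.+ ∣ Y ∣
∣∪∣+∣∩∣ [] [] = ≡.refl
∣∪∣+∣∩∣ (true ∷ X) (true ∷ Y) = cong suc (≡.trans (ℕ.+-suc _ _) (≡.trans (cong suc (∣∪∣+∣∩∣ X Y)) (≡.sym (ℕ.+-suc _ _))))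
∣∪∣+∣∩∣ (true ∷ X) (false ∷ Y) = cong suc (∣∪∣+∣∩∣ X Y)
∣∪∣+∣∩∣ (false ∷ X) (true ∷ Y) = ≡.trans (cong suc (∣∪∣+∣∩∣ X Y)) (≡.sym (ℕ.+-suc _ _))
∣∪∣+∣∩∣ (false ∷ X) (false ∷ Y) = ∣∪∣+∣∩∣ X Y

subset-ind : ∀ {n} (P : Subset n → Set) → P ⊥ →
  (∀ X e → e ∉ X → P X → P (X ∪ ⁅ e ⁆)) → ∀ X → P X
subset-ind P p⊥ step [] = p⊥
subset-ind {suc n} P p⊥ step (s ∷ X) = go s
  where
  ih : P (false ∷ X)
  ih = subset-ind (λ Y → P (false ∷ Y)) p⊥
    (λ Y e e∉ → step (false ∷ Y) (suc e) (λ { (there h) → e∉ h })) X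
  go : ∀ s → P (s ∷ X)
  go false = ih
  go true = subst (λ Z → P (true ∷ Z)) (∪-identityʳ X) (step (false ∷ X) zero (λ ()) ih)

image-⊥ : ∀ {m n} (g : Fin m → Fin n) → image g ⊥ ≡ ⊥
image-⊥ g = ⊆-antisym (λ h → absurd (∉⊥ (proj₁ (proj₂ (∈image⁻ g h))))) ⊥⊆

image-∪⁅⁆ : ∀ {m n} (g : Fin m → Fin n) X e → image g (X ∪ ⁅ e ⁆) ≡ image g X ∪ ⁅ g e ⁆
image-∪⁅⁆ g X e = ⊆-antisym forth (∪⁅⁆-⊆ back (∈image⁺ g (∪⁅⁆⁺ʳ X e)))
  where
  forth : image g (X ∪ ⁅ e ⁆) ⊆ image g X ∪ ⁅ g e ⁆
  forth h with ∈image⁻ g h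
  ... | i , i∈ , ≡.refl with ∪⁅⁆⁻ X e i∈
  ...   | inj₁ a = ∪⁅⁆⁺ˡ (image g X) (g e) (∈image⁺ g a)
  ...   | inj₂ ≡.refl = ∪⁅⁆⁺ʳ (image g X) (g e)
  back : image g X ⊆ image g (X ∪ ⁅ e ⁆)
  back h with ∈image⁻ g h
  ... | i , i∈ , ≡.refl = ∈image⁺ g (∪⁅⁆⁺ˡ X e i∈)

∣image∣ : ∀ {m n} (g : Fin m → Fin n) → Injective _≡_ _≡_ g → ∀ Y → ∣ image g Y ∣ ≡ ∣ Y ∣
∣image∣ {m} {n} g inj = subset-ind _ (≡.trans (cong ∣_∣ (image-⊥ g)) (≡.trans (∣⊥∣≡0 n) (≡.sym (∣⊥∣≡0 m))))
  λ X e e∉ ih → ≡.trans (cong ∣_∣ (image-∪⁅⁆ g X e)) (≡.trans (∣∪⁅⁆∣ (image g X) (f X e e∉)) (≡.trans (cong suc ih) (≡.sym (∣∪⁅⁆∣ X e∉))))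
  where
  f : ∀ X e → e ∉ X → g e ∉ image g X
  f X e e∉ h with ∈image⁻ g h
  ... | i , i∈ , eq = e∉ (subst (_∈ X) (inj eq) i∈)

∈-⁻ : ∀ {n} (X : Subset n) e {i} → i ∈ X ⊖ e → i ∈ X × i ≢ e
∈-⁻ X e h = p─q⊆p X ⁅ e ⁆ h , λ { ≡.refl → f h }
  where
  f : ∀ {n} {X : Subset n} {e} → e ∉ X ⊖ e
  f {X = _ ∷ X} {zero} ()
  f {X = _ ∷ X} {suc e} (there h) = f {X = X} h

DecIndep : ∀ {n} → Matroid n → Set
DecIndep M = ∀ X → Dec (Indep M X)

module Bases {n} (M : Matroid n) (indep? : DecIndep M) where

  extend-basis : ∀ {I X} → I ⊆ X → Indep M I → ∃[ B ] (I ⊆ B × IsBasis M B X)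
  extend-basis {I} {X} I⊆X indI = go n I I⊆X indI (ℕ.m≤n+m n _)
    where
    go : ∀ k I → I ⊆ X → Indep M I → n ≤ ∣ I ∣ ℕ.+ k → ∃[ B ] (I ⊆ B × IsBasis M B X)
    go k I I⊆X indI le with Fin.any? (λ e → (e ∈? X) ×-dec ((¬? (e ∈? I)) ×-dec (indep? (I ∪ ⁅ e ⁆))))
    ... | no none = I , id , I⊆X , indI , λ e e∈X e∉I ind → none (e , e∈X , e∉I , ind)
    ... | yes (e , e∈X , e∉I , ind) = step k le
      where
      step : ∀ k → n ≤ ∣ I ∣ ℕ.+ k → ∃[ B ] (I ⊆ B × IsBasis M B X)
      step zero le = absurd (ℕ.<-irrefl ≡.refl (ℕ.≤-trans (⊆∧∌⇒∣∣< ⊆⊤ ∈⊤ e∉I)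
        (ℕ.≤-trans (ℕ.≤-reflexive (∣⊤∣≡n n)) (subst (n ≤_) (ℕ.+-identityʳ _) le))))
      step (suc k) le =
        let B , ⊆B , bas = go k (I ∪ ⁅ e ⁆) (∪⁅⁆-⊆ I⊆X e∈X) ind
                             (subst (n ≤_) (≡.trans (ℕ.+-suc _ k) (cong (ℕ._+ k) (≡.sym (∣∪⁅⁆∣ I e∉I)))) le)
        in B , ⊆B ∘ ∪⁅⁆⁺ˡ I e , bas

  basis : ∀ X → ∃[ B ] IsBasis M B X
  basis X = let B , _ , b = extend-basis ⊥⊆ (indep-∅ M) in B , b

  basis-maximum : ∀ {B J X} → IsBasis M B X → J ⊆ X → Indep M J → ∣ J ∣ ≤ ∣ B ∣
  basis-maximum {B} {J} (_ , indB , maxB) J⊆X indJ with ∣ J ∣ ℕ.≤? ∣ B ∣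
  ... | yes le = le
  ... | no nle = let e , e∈J , e∉B , ind = indep-aug M indB indJ (ℕ.≰⇒> nle)
                 in absurd (maxB e (J⊆X e∈J) e∉B ind)

  basis-size : ∀ {B B′ X} → IsBasis M B X → IsBasis M B′ X → ∣ B ∣ ≡ ∣ B′ ∣
  basis-size b@(B⊆ , iB , _) b′@(B′⊆ , iB′ , _) =
    ℕ.≤-antisym (basis-maximum b′ B⊆ iB) (basis-maximum b B′⊆ iB′)

  span : Subset n → Fin n → Set
  span X e = e ∈ X ⊎ ∃[ I ] (I ⊆ X × Indep M I × ¬ Indep M (I ∪ ⁅ e ⁆))

  span-basis : ∀ {B X e} → IsBasis M B X → span X e → e ∉ B → ¬ Indep M (B ∪ ⁅ e ⁆)
  span-basis (_ , _ , maxB) (inj₁ e∈X) e∉B ind = maxB _ e∈X e∉B ind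
  span-basis {B} {X} {e} b@(B⊆X , _ , _) (inj₂ (I , I⊆X , indI , dep)) e∉B ind
    with extend-basis I⊆X indI
  ... | B′ , I⊆B′ , b′@(_ , indB′ , maxB′)
    with indep-aug M indB′ ind (subst (∣ B′ ∣ <_) (≡.sym (∣∪⁅⁆∣ B e∉B)) (s≤s (ℕ.≤-reflexive (basis-size b′ b))))
  ...   | f , f∈ , f∉B′ , ind′ with ∪⁅⁆⁻ B e f∈
  ...     | inj₁ f∈B = maxB′ f (B⊆X f∈B) f∉B′ ind′
  ...     | inj₂ ≡.refl = dep (indep-⊆ M (∪⁅⁆-⊆ (∪⁅⁆⁺ˡ B′ e ∘ I⊆B′) (∪⁅⁆⁺ʳ B′ e)) ind′)

  basis-span : ∀ {B X e} → IsBasis M B X → (e ∉ B → ¬ Indep M (B ∪ ⁅ e ⁆)) → span X e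
  basis-span {B} {X} {e} (B⊆X , indB , _) h with e ∈? B
  ... | yes e∈B = inj₁ (B⊆X e∈B)
  ... | no e∉B = inj₂ (B , B⊆X , indB , h e∉B)

  span? : ∀ X e → Dec (span X e)
  span? X e with basis X
  ... | B , b with e ∈? B
  ...   | yes e∈B = yes (basis-span b (λ e∉B → absurd (e∉B e∈B)))
  ...   | no e∉B = map′ (λ h → basis-span b (λ _ → h)) (λ s → span-basis b s e∉B) (¬? (indep? (B ∪ ⁅ e ⁆)))

  span-mono : ∀ {X Y e} → X ⊆ Y → span X e → span Y e
  span-mono X⊆Y (inj₁ h) = inj₁ (X⊆Y h)
  span-mono X⊆Y (inj₂ (I , I⊆ , h)) = inj₂ (I , X⊆Y ∘ I⊆ , h)

  span-cut : ∀ {X Y e} → (∀ {i} → i ∈ X → span Y i) → span X e → span Y e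
  span-cut {X} {Y} {e} h s with basis Y
  ... | B , b@(B⊆Y , indB , maxB) = basis-span b (span-basis b′ (span-mono (p⊆p∪q Y) s))
    where
    b′ : IsBasis M B (X ∪ Y)
    b′ = (λ i → q⊆p∪q X Y (B⊆Y i)) , indB , λ i i∈ i∉B →
      [ (λ i∈X → span-basis b (h i∈X) i∉B) , (λ i∈Y → maxB i i∈Y i∉B) ]′ (x∈p∪q⁻ X Y i∈)

  span-exchange : ∀ {X e f} → span (X ∪ ⁅ e ⁆) f → ¬ span X f → span (X ∪ ⁅ f ⁆) e
  span-exchange {X} {e} {f} s ns with f Fin.≟ e
  ... | yes ≡.refl = inj₁ (∪⁅⁆⁺ʳ X e)
  ... | no f≢e with basis X | span? X e
  ...   | B , b | yes se = absurd (ns (span-cut (λ i∈ → [ inj₁ , (λ { ≡.refl → se }) ]′ (∪⁅⁆⁻ X e i∈)) s))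
  ...   | B , b@(B⊆X , indB , maxB) | no nse =
    inj₂ (B ∪ ⁅ f ⁆ , ∪⁅⁆-⊆ (∪⁅⁆⁺ˡ X f ∘ B⊆X) (∪⁅⁆⁺ʳ X f) , grow ns , λ ind →
      span-basis b′ s f∉ (indep-⊆ M
        (∪⁅⁆-⊆ (∪⁅⁆-⊆ (∪⁅⁆⁺ˡ _ e ∘ ∪⁅⁆⁺ˡ B f) (∪⁅⁆⁺ʳ _ e)) (∪⁅⁆⁺ˡ _ e (∪⁅⁆⁺ʳ B f))) ind))
    where
    grow : ∀ {i} → ¬ span X i → Indep M (B ∪ ⁅ i ⁆)
    grow {i} ns = decidable-stable (indep? _) λ d → ns (basis-span b (λ _ → d))
    b′ : IsBasis M (B ∪ ⁅ e ⁆) (X ∪ ⁅ e ⁆)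
    b′ = ∪⁅⁆-⊆ (∪⁅⁆⁺ˡ X e ∘ B⊆X) (∪⁅⁆⁺ʳ X e) , grow nse , λ i i∈ i∉ ind →
      [ (λ i∈X → maxB i i∈X (i∉ ∘ ∪⁅⁆⁺ˡ B e) (indep-⊆ M (∪⁅⁆-⊆ (∪⁅⁆⁺ˡ _ i ∘ ∪⁅⁆⁺ˡ B e) (∪⁅⁆⁺ʳ _ i)) ind))
      , (λ { ≡.refl → i∉ (∪⁅⁆⁺ʳ B e) }) ]′ (∪⁅⁆⁻ X e i∈)
    f∉ : f ∉ B ∪ ⁅ e ⁆
    f∉ h = [ (λ f∈B → ns (inj₁ (B⊆X f∈B))) , f≢e ]′ (∪⁅⁆⁻ B e h)

  flat-closed : ∀ {X e} → Flat M X → span X e → e ∈ X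
  flat-closed {X} {e} fl s = decidable-stable (e ∈? X) λ e∉X →
    let B , b@(B⊆X , indB , maxB) = basis X
    in fl e e∉X ∣ B ∣ (B , b , ≡.refl)
         (B , (∪⁅⁆⁺ˡ X e ∘ B⊆X , indB , λ i i∈ i∉B →
            [ (λ i∈X → maxB i i∈X i∉B) , (λ { ≡.refl → span-basis b s i∉B }) ]′ (∪⁅⁆⁻ X e i∈)) , ≡.refl)

  closed-flat : ∀ {X} → (∀ {e} → span X e → e ∈ X) → Flat M X
  closed-flat {X} cl e e∉X k (B , b@(B⊆X , indB , _) , ≡.refl) (B′ , b′ , eq) =
    let e∉B = e∉X ∘ B⊆X
        ind = decidable-stable (indep? (B ∪ ⁅ e ⁆)) λ d → e∉X (cl (basis-span b (λ _ → d)))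
    in ℕ.<-irrefl (≡.sym eq) (ℕ.≤-trans (ℕ.≤-reflexive (≡.sym (∣∪⁅⁆∣ B e∉B)))
         (basis-maximum b′ (∪⁅⁆-⊆ (∪⁅⁆⁺ˡ X e ∘ B⊆X) (∪⁅⁆⁺ʳ X e)) ind))

  indep⇒ : ∀ {X e} → Indep M X → e ∈ X → ¬ span (X ⊖ e) e
  indep⇒ {X} {e} ind e∈X s = span-basis b s (λ h → proj₂ (∈-⁻ X e h) ≡.refl)
    (indep-⊆ M (∪⁅⁆-⊆ (λ h → proj₁ (∈-⁻ X e h)) e∈X) ind)
    where
    b : IsBasis M (X ⊖ e) (X ⊖ e)
    b = id , indep-⊆ M (λ h → proj₁ (∈-⁻ X e h)) ind , λ i i∈ i∉ → absurd (i∉ i∈)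

  indep⇐ : ∀ {X} → (∀ {e} → e ∈ X → ¬ span (X ⊖ e) e) → Indep M X
  indep⇐ {X} h =
    let B , b@(B⊆X , indB , maxB) = basis X
    in indep-⊆ M (λ {e} e∈X → decidable-stable (e ∈? B) λ e∉B →
         h e∈X (inj₂ (B , (λ i∈B → x∈p∧x≢y⇒x∈p-y (B⊆X i∈B) λ { ≡.refl → e∉B i∈B }) , indB , maxB e e∈X e∉B))) indB

  indep-∪ : ∀ {X e} → Indep M X → ¬ span X e → Indep M (X ∪ ⁅ e ⁆)
  indep-∪ ind ns = decidable-stable (indep? _) λ d → ns (inj₂ (_ , id , ind , d))

Pr : ℕ → Set₁
Pr n = Fin n → Set

∅ : ∀ {n} → Pr n
∅ _ = Empty

infixl 5 _▹_ _⊕_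
_▹_ : ∀ {n} → Pr n → Fin n → Pr n
(P ▹ e) i = P i ⊎ i ≡ e

_⊕_ : ∀ {n} → Pr n → Pr n → Pr n
(P ⊕ Q) i = P i ⊎ Q i

push : ∀ {m n} → (Fin m → Fin n) → Pr n → Pr m → Pr n
push g C P x = C x ⊎ ∃[ a ] (P a × g a ≡ x)

-- Closure is only required to be ¬¬-stable, so that proofs about it may argue classically.
record Pregeometry (n : ℕ) : Set₁ where
  field
    cl     : Pr n → Pr n
    stable : ∀ {P e} → ¬ ¬ cl P e → cl P e
    ext    : ∀ {P e} → P e → cl P e
    cut    : ∀ {P Q e} → (∀ {i} → P i → cl Q i) → cl P e → cl Q e
    exch   : ∀ {P e f} → cl (P ▹ e) f → ¬ cl P f → cl (P ▹ f) e

  mono : ∀ {P Q e} → (∀ {i} → P i → Q i) → cl P e → cl Q e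
  mono f = cut (ext ∘ f)

  last : ∀ {P e} → cl (P ▹ e) e
  last = ext (inj₂ ≡.refl)

  weaken : ∀ {P e i} → cl P i → cl (P ▹ e) i
  weaken = mono inj₁

  cut▹ : ∀ {P Q e i} → (∀ {i} → P i → cl Q i) → cl Q e → cl (P ▹ e) i → cl Q i
  cut▹ f c = cut λ { (inj₁ p) → f p ; (inj₂ ≡.refl) → c }

  drop-loop : ∀ {P e i} → cl P e → cl (P ▹ e) i → cl P i
  drop-loop c = cut▹ ext c

  parallel-trans : ∀ {P x y z} → ¬ cl P z → cl (P ▹ x) y → cl (P ▹ x) z → cl (P ▹ z) y
  parallel-trans nz cy cz = cut▹ (weaken ∘ ext) (exch cz nz) cy

  line-exchange : ∀ {P a b s t} → ¬ cl P b → ¬ cl (P ▹ b) a → cl (P ▹ s ▹ t) a → cl (P ▹ s ▹ t) b →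
    cl (P ▹ a ▹ b) s × cl (P ▹ a ▹ b) t
  line-exchange {P} {a} {b} {s} {t} nb na ca cb =
      stable (λ k → main (k ∘ proj₁)) , stable (λ k → main (k ∘ proj₂))
    where
    comm : ∀ {i} → cl (P ▹ b ▹ a) i → cl (P ▹ a ▹ b) i
    comm = mono λ { (inj₁ (inj₁ p)) → inj₁ (inj₁ p) ; (inj₁ (inj₂ p)) → inj₂ p ; (inj₂ p) → inj₁ (inj₂ p) }
    main : ¬ ¬ (cl (P ▹ a ▹ b) s × cl (P ▹ a ▹ b) t)
    main k = em (cl (P ▹ s) b) λ where
      (yes c) → let s∈ = exch c nb
                    a∈ = cut▹ (λ { (inj₁ p) → ext (inj₁ (inj₁ p)) ; (inj₂ ≡.refl) → weaken s∈ }) last ca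
                in k (comm (weaken s∈) , comm (exch a∈ na))
      (no nc) → let t∈ = exch cb nc
                    a∈ = cut▹ (λ { (inj₁ p) → ext (inj₁ (inj₁ p)) ; (inj₂ ≡.refl) → last })
                           (mono (λ { (inj₁ (inj₁ p)) → inj₁ (inj₁ p) ; (inj₁ (inj₂ p)) → inj₂ p ; (inj₂ p) → inj₁ (inj₂ p) }) t∈) ca
                    s∈ = exch a∈ na
                in k (comm s∈ , comm (cut▹ (λ { (inj₁ p) → ext (inj₁ (inj₁ p)) ; (inj₂ ≡.refl) → s∈ }) (ext (inj₁ (inj₂ ≡.refl))) t∈))

  -- The elements h a are pairwise non-parallel points of the line e f of the contraction by P.
  Pencil : Pr n → Fin n → Fin n → ∀ {k} → (Fin k → Fin n) → Set
  Pencil P e f h = (∀ a → cl (P ▹ e ▹ f) (h a)) × (∀ {a b} → a ≢ b → ¬ cl (P ▹ h b) (h a))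

  pencil-loopless : ∀ {P e f k} {h : Fin k → Fin n} → Pencil P e f h → ∀ {a b} → a ≢ b → ¬ cl P (h a)
  pencil-loopless (_ , np) a≢b c = np a≢b (weaken c)

  pencil-spans : ∀ {P e f k} {h : Fin k → Fin n} → Pencil P e f h → ∀ {a b} → a ≢ b →
    cl (P ▹ h a ▹ h b) e × cl (P ▹ h a ▹ h b) f
  pencil-spans pen@(on , np) a≢b =
    line-exchange (pencil-loopless pen (a≢b ∘ ≡.sym)) (np a≢b) (on _) (on _)

module _ {n} (G : Pregeometry n) where
  open Pregeometry G

  FullLine : Fin n → Fin n → ∀ {k} → (Fin k → Fin n) → Set
  FullLine s t h = Pencil ∅ s t h

  BoundedLines : ℕ → Set₁
  BoundedLines q = ∀ P e f (h : Fin (2 ℕ.+ q) → Fin n) → ¬ Pencil P e f h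

  LiftableLines : ℕ → Set₁
  LiftableLines q = ∀ P e f (h : Fin 3 → Fin n) → Pencil P e f h →
    ¬ ¬ (∃[ l ] (Pencil P e f {suc q} l × (∀ a {b c} → b ≢ c → cl (∅ ▹ l b ▹ l c) (l a))))

  ProjectivelyFull : ℕ → Pr n → Set
  ProjectivelyFull q T = ∀ {s t} → T s → T t → s ≢ t →
    ¬ ¬ (∃[ h ] (FullLine s t {suc q} h × (∀ a → T (h a))))

module Modular {n q} (1≤q : 1 ≤ q) (G : Pregeometry n) (bounded : BoundedLines G q)
               (T : Pr n) (full : ProjectivelyFull G q T) where
  open Pregeometry G

  other : ∀ (a : Fin (suc q)) → ∃[ b ] (b ≢ a)
  other a = go 1≤q a
    where
    go : ∀ {q} → 1 ≤ q → (a : Fin (suc q)) → ∃[ b ] (b ≢ a)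
    go (s≤s _) zero = suc zero , λ ()
    go (s≤s _) (suc a) = zero , λ ()

  spread : ∀ {Q s t} {h : Fin (suc q) → Fin n} → FullLine G s t h → ¬ cl Q t → ¬ cl (Q ▹ t) s → Pencil Q s t h
  spread {Q} {s} {t} {h} fl@(on , _) nt ns =
    (λ a → mono (λ { (inj₁ (inj₂ p)) → inj₁ (inj₂ p) ; (inj₂ p) → inj₂ p }) (on a)) , λ {a} {b} a≢b c →
      let sp = pencil-spans fl a≢b
          push : ∀ {i} → cl (∅ ▹ h a ▹ h b) i → cl (Q ▹ h b) i
          push = cut λ { (inj₁ (inj₂ ≡.refl)) → c ; (inj₂ ≡.refl) → last }
      in ns (parallel-trans nt (push (proj₁ sp)) (push (proj₂ sp)))

  -- Otherwise g would be point number q + 2 of the line of h.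
  hit-line : ∀ {Q s t g} {h : Fin (suc q) → Fin n} → Pencil Q s t h → cl (Q ▹ s ▹ t) g → ¬ cl Q g →
    (∀ a → cl (Q ▹ h a) g → Empty) → Empty
  hit-line {Q} {s} {t} {g} {h} pen@(on , np) cg ng k = bounded Q s t h′ (on′ , np′)
    where
    h′ : Fin (2 ℕ.+ q) → Fin n
    h′ zero = g
    h′ (suc a) = h a
    on′ : ∀ a → cl (Q ▹ s ▹ t) (h′ a)
    on′ zero = cg
    on′ (suc a) = on a
    np′ : ∀ {a b} → a ≢ b → ¬ cl (Q ▹ h′ b) (h′ a)
    np′ {zero} {zero} a≢b c = a≢b ≡.refl
    np′ {zero} {suc b} a≢b c = k b c
    np′ {suc a} {zero} a≢b c = k a (exch c (pencil-loopless pen (proj₂ (other a) ∘ ≡.sym)))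
    np′ {suc a} {suc b} a≢b c = np (a≢b ∘ cong suc) c

  private
    meetsL : ∀ k P zs g → length zs ≤ k → All T zs → cl (P ⊕ (L._∈ zs)) g → ¬ cl P g →
      (∀ t → T t → cl (L._∈ zs) t → ¬ cl P t → cl (P ▹ g) t → Empty) → Empty
    meetsL k P [] g le tz cg ng K = ng (mono (λ { (inj₁ p) → p ; (inj₂ ()) }) cg)
    meetsL k P (z ∷ []) g le (tz ∷ _) cg ng K =
      K z tz (ext (here ≡.refl)) (λ cz → ng (drop-loop cz cg′)) (exch cg′ ng)
      where cg′ = mono {Q = P ▹ z} (λ { (inj₁ p) → inj₁ p ; (inj₂ (here e)) → inj₂ e }) cg
    meetsL (suc k) P (x ∷ y ∷ zs) g (s≤s le) (tx ∷ ty ∷ tz) cg ng K =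
      em (cl Q g) λ where
        (yes c) → recur zs (ℕ.<⇒≤ le) tz (λ i → ext (there (there i))) c
        (no nqg) → em (cl Q y) λ where
          (yes cy) → drop x tx (ext (here ≡.refl)) (drop-loop (weaken cy) cg′)
          (no ny) → em (cl (Q ▹ y) x) λ where
            (yes cx) → drop y ty (ext (there (here ≡.refl))) (cut (λ { (inj₁ (inj₁ p)) → weaken (ext p) ; (inj₁ (inj₂ ≡.refl)) → cx ; (inj₂ ≡.refl) → last }) cg′)
            (no nx) → full tx ty (λ { ≡.refl → nx last }) λ where
              (h , fl , Th) → hit-line (spread fl ny nx) cg′ nqg λ a c →
                drop (h a) (Th a) (cut (λ { (inj₁ (inj₂ ≡.refl)) → ext (here ≡.refl) ; (inj₂ ≡.refl) → ext (there (here ≡.refl)) }) (proj₁ fl a)) c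
      where
      Q : Pr n
      Q = P ⊕ (L._∈ zs)
      cg′ : cl (Q ▹ x ▹ y) g
      cg′ = mono (λ { (inj₁ p) → inj₁ (inj₁ (inj₁ p)) ; (inj₂ (here e)) → inj₁ (inj₂ e)
                    ; (inj₂ (there (here e))) → inj₂ e ; (inj₂ (there (there i))) → inj₁ (inj₁ (inj₂ i)) }) cg
      recur : ∀ ws → length ws ≤ k → All T ws → (∀ {i} → i L.∈ ws → cl (L._∈ (x ∷ y ∷ zs)) i) →
        cl (P ⊕ (L._∈ ws)) g → Empty
      recur ws le tw ws⊆ cw = meetsL k P ws g le tw cw ng λ t Tt ct nt gt → K t Tt (cut ws⊆ ct) nt gt
      drop : ∀ w → T w → cl (L._∈ (x ∷ y ∷ zs)) w → cl (Q ▹ w) g → Empty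
      drop w Tw cw c = recur (w ∷ zs) le (Tw ∷ tz) (λ { (here ≡.refl) → cw ; (there i) → ext (there (there i)) })
        (mono (λ { (inj₁ (inj₁ p)) → inj₁ p ; (inj₁ (inj₂ i)) → inj₂ (there i) ; (inj₂ e) → inj₂ (here e) }) c)

  meets : ∀ {P Z g} → (∀ {i} → Z i → T i) → cl (P ⊕ Z) g → ¬ cl P g →
    (∀ t → T t → cl Z t → ¬ cl P t → cl (P ▹ g) t → Empty) → Empty
  meets {P} {Z} {g} Z⊆T cg ng K = ¬¬-dec Z λ Z? →
    let zs = filter Z? (allFin n)
        ∈zs⁻ : ∀ {i} → i L.∈ zs → Z i
        ∈zs⁻ h = proj₂ (∈-filter⁻ Z? {xs = allFin n} h)
    in meetsL (length zs) P zs g ℕ.≤-refl (All.tabulate (Z⊆T ∘ ∈zs⁻))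
         (mono (λ { (inj₁ p) → inj₁ p ; (inj₂ z) → inj₂ (∈-filter⁺ Z? (∈-allFin _) z) }) cg) ng
         λ t Tt ct → K t Tt (mono ∈zs⁻ ct)

  private
    common : ∀ cs {t t′} → T t → T t′ → t ≢ t′ → ¬ cl (L._∈ cs) t → cl ((L._∈ cs) ▹ t′) t →
      (∀ s → T s → cl (L._∈ cs) s → cl (∅ ▹ t′ ▹ t) s → ¬ cl ∅ s → Empty) → Empty
    common [] {t} {t′} Tt Tt′ t≢t′ nt ct K = full Tt Tt′ t≢t′ λ where
      (h , fl@(on , np) , _) →
        let b , b≢0 = other zero
            below : ∀ a → cl (∅ ▹ t′) (h a)
            below a = cut (λ { (inj₁ (inj₂ ≡.refl)) → mono (λ { (inj₁ ()) ; (inj₂ e) → inj₂ e }) ct ; (inj₂ ≡.refl) → last }) (on a)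
        in np b≢0 (parallel-trans (pencil-loopless fl (b≢0 ∘ ≡.sym)) (below b) (below zero))
    common (c ∷ cs) {t} {t′} Tt Tt′ t≢t′ nt ct K = em (cl (Q ▹ t′) t) λ where
        (yes ct′) → common cs Tt Tt′ t≢t′ (nt ∘ mono there) ct′ λ s Ts cs → K s Ts (mono there cs)
        (no nt′) → full Tt′ Tt (t≢t′ ∘ ≡.sym) λ where
          (h , fl@(on , np) , Th) →
            let cc : cl (Q ▹ t′ ▹ t) c
                cc = exch (mono (λ { (inj₁ (here e)) → inj₂ e ; (inj₁ (there i)) → inj₁ (inj₁ i) ; (inj₂ e) → inj₁ (inj₂ e) }) ct) nt′
                nc : ¬ cl Q c
                nc c∈ = nt′ (cut▹ (λ { (here ≡.refl) → weaken c∈ ; (there i) → weaken (ext i) }) last ct)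
                nt″ : ¬ cl Q t′
                nt″ c∈ = nt (drop-loop (mono there c∈) ct)
                pen = spread {Q} fl (nt ∘ mono there) (λ c∈ → nt′ (exch c∈ nt″))
            in hit-line pen cc nc λ a ca → K (h a) (Th a)
                 (mono (λ { (inj₁ i) → there i ; (inj₂ e) → here e })
                   (exch ca nc)) (on a) (pencil-loopless fl (proj₂ (other a) ∘ ≡.sym))
      where
      Q : Pr n
      Q = L._∈ cs

  trace : ∀ {P Z t} → (∀ {i} → Z i → T i) → T t → (∀ {s} → T s → cl P s → cl Z s) → cl (P ⊕ Z) t → cl Z t
  trace {P} {Z} {t} Z⊆T Tt P∩T⊆Z ct = stable λ K → em (cl P t) λ where
    (yes c) → K (P∩T⊆Z Tt c)
    (no nt) → meets Z⊆T ct nt λ z Tz cz nz z∈ → em (z ≡ t) λ where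
      (yes ≡.refl) → K cz
      (no z≢t) → ¬¬-dec P λ P? →
        let ps = filter P? (allFin n)
            ∈ps⁻ : ∀ {i} → i L.∈ ps → P i
            ∈ps⁻ h = proj₂ (∈-filter⁻ P? {xs = allFin n} h)
        in common ps Tz Tt z≢t (nz ∘ mono ∈ps⁻)
             (mono (λ { (inj₁ p) → inj₁ (∈-filter⁺ P? (∈-allFin _) p) ; (inj₂ e) → inj₂ e }) z∈)
             λ s Ts cs sl ns →
               let cs′ = mono ∈ps⁻ cs
                   s∉z : ¬ cl (∅ ▹ z) s
                   s∉z c = nz (cut▹ (λ ()) cs′ (exch c ns))
               in K (cut (λ { (inj₁ (inj₂ ≡.refl)) → cz ; (inj₂ ≡.refl) → P∩T⊆Z Ts cs′ })
                      (exch (mono (λ { (inj₁ (inj₂ e)) → inj₂ e ; (inj₂ e) → inj₁ (inj₂ e) }) sl) s∉z))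

-- The contraction by C, pulled back along g.
over : ∀ {m n} → Pregeometry n → Pr n → (Fin m → Fin n) → Pregeometry m
over G C g = record
  { cl = λ P i → cl (push g C P) (g i)
  ; stable = stable
  ; ext = λ p → ext (inj₂ (_ , p , ≡.refl))
  ; cut = λ f → cut λ { (inj₁ c) → ext (inj₁ c) ; (inj₂ (a , p , ≡.refl)) → f p }
  ; exch = λ c n → mono (λ { (inj₁ (inj₁ c)) → inj₁ c ; (inj₁ (inj₂ (a , p , e))) → inj₂ (a , inj₁ p , e)
                           ; (inj₂ ≡.refl) → inj₂ (_ , inj₂ ≡.refl , ≡.refl) })
             (exch (mono (λ { (inj₁ c) → inj₁ (inj₁ c) ; (inj₂ (a , inj₁ p , e)) → inj₁ (inj₂ (a , p , e))
                            ; (inj₂ (a , inj₂ ≡.refl , e)) → inj₂ (≡.sym e) }) c) n)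
  }
  where open Pregeometry G

-- One side of a generalized parallel connection: f₁ and f₂ embed two pregeometries into G,
-- overlapping in a projective geometry, with flats of G glued from flats of the two parts.
module Side {n₁ n₂ n q} (1≤q : 1 ≤ q)
  (G₁ : Pregeometry n₁) (G₂ : Pregeometry n₂) (G : Pregeometry n)
  (f₁ : Fin n₁ → Fin n) (f₂ : Fin n₂ → Fin n)
  (inj-f₁ : Injective _≡_ _≡_ f₁) (inj-f₂ : Injective _≡_ _≡_ f₂)
  (cover : ∀ x → (∃[ a ] f₁ a ≡ x) ⊎ (∃[ b ] f₂ b ≡ x))
  (bounded : BoundedLines G₂ q)
  (full : ProjectivelyFull G₂ q (λ b → ∃[ a ] f₁ a ≡ f₂ b))
  where
  private
    module G₁ = Pregeometry G₁
    module G₂ = Pregeometry G₂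
  open Pregeometry G
  open Modular 1≤q G₂ bounded _ full using (meets; trace)

  module Glue
    (up₁ : ∀ {P Q a} → (∀ {i} → P i → cl Q (f₁ i)) → G₁.cl P a → cl Q (f₁ a))
    (up₂ : ∀ {P Q b} → (∀ {i} → P i → cl Q (f₂ i)) → G₂.cl P b → cl Q (f₂ b))
    (closed : ∀ (X : Pr n) → (∀ {a} → G₁.cl (X ∘ f₁) a → X (f₁ a)) → (∀ {b} → G₂.cl (X ∘ f₂) b → X (f₂ b)) →
              ∀ {e} → cl X e → ¬ ¬ X e)
    (agree : ∀ (Z : Pr n) → (∀ {x} → Z x → ∃[ a ] ∃[ b ] (f₁ a ≡ x × f₂ b ≡ x)) →
             ∀ {a b} → f₁ a ≡ f₂ b → G₂.cl (Z ∘ f₂) b → G₁.cl (Z ∘ f₁) a)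
    where

    private
      module Flat (R : Pr n) (P : Pr n₁) where
        X₁ : Pr n₁
        X₁ = G₁.cl (P ⊕ (cl R ∘ f₁))
        Z : Pr n
        Z x = ∃[ a ] (f₁ a ≡ x × (∃[ b ] f₂ b ≡ x) × X₁ a)
        X₂ : Pr n₂
        X₂ = G₂.cl ((cl R ∘ f₂) ⊕ (Z ∘ f₂))
        X : Pr n
        X x = (∃[ a ] (f₁ a ≡ x × X₁ a)) ⊎ (∃[ b ] (f₂ b ≡ x × X₂ b))

        Z⊆T : ∀ {i} → Z (f₂ i) → ∃[ a ] f₁ a ≡ f₂ i
        Z⊆T (a , e , _) = a , e

        X₂∩T : ∀ {a b} → f₁ a ≡ f₂ b → X₂ b → X₁ a
        X₂∩T {a} {b} e xb = G₁.cut below (agree Z (λ { (a , ea , (b , eb) , _) → a , b , ea , eb }) e tr)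
          where
          tr : G₂.cl (Z ∘ f₂) b
          tr = trace Z⊆T (a , e) (λ { {s} (a′ , e′) c → G₂.ext (a′ , e′ , (s , ≡.refl) ,
                 G₁.ext (inj₂ (subst (cl R) (≡.sym e′) (up₂ id c)))) }) xb
          below : ∀ {i} → Z (f₁ i) → X₁ i
          below (a′ , e′ , _ , x) = subst X₁ (inj-f₁ e′) x

        X₁∩T : ∀ {a b} → f₁ a ≡ f₂ b → X₁ a → X₂ b
        X₁∩T {a} {b} e x = G₂.ext (inj₂ (a , e , (b , ≡.refl) , x))

        X-f₁ : ∀ {a} → X (f₁ a) → X₁ a
        X-f₁ (inj₁ (a′ , e , x)) = subst X₁ (inj-f₁ e) x
        X-f₁ (inj₂ (b , e , x)) = X₂∩T (≡.sym e) x

        X-closed : ∀ {e} → cl (push f₁ R P) e → ¬ ¬ X e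
        X-closed c = closed X (λ c → inj₁ (_ , ≡.refl , G₁.cut X-f₁ c))
          (λ c → inj₂ (_ , ≡.refl , G₂.cut (λ { (inj₁ (a , e , x)) → X₁∩T e x
                                            ; (inj₂ (b , e , x)) → subst X₂ (inj-f₂ e) x }) c))
          (mono (λ { {x} (inj₁ r) → R⊆ r (cover x)
                   ; (inj₂ (a , p , e)) → inj₁ (a , e , G₁.ext (inj₁ p)) }) c)
          where
          R⊆ : ∀ {x} → R x → (∃[ a ] f₁ a ≡ x) ⊎ (∃[ b ] f₂ b ≡ x) → X x
          R⊆ r (inj₁ (a , ≡.refl)) = inj₁ (a , ≡.refl , G₁.ext (inj₂ (ext r)))
          R⊆ r (inj₂ (b , ≡.refl)) = inj₂ (b , ≡.refl , G₂.ext (inj₁ (ext r)))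

    restrict : ∀ {R P a} → cl (push f₁ R P) (f₁ a) → G₁.cl (P ⊕ (cl R ∘ f₁)) a
    restrict {R} {P} c = G₁.stable λ K → X-closed c (K ∘ X-f₁)
      where open Flat R P

    move : ∀ {R P g} → cl (push f₁ R P) (f₂ g) → ¬ cl R (f₂ g) →
      ¬ ¬ (∃[ t ] (cl (R ▹ f₂ g) (f₁ t) × ¬ cl R (f₁ t)))
    move {R} {P} {g} c ng K = X-closed c λ x → go (toX₂ x)
      where
      open Flat R P
      toX₂ : X (f₂ g) → X₂ g
      toX₂ (inj₁ (a , e , x)) = X₁∩T e x
      toX₂ (inj₂ (b , e , x)) = subst X₂ (inj-f₂ e) x
      go : X₂ g → Empty
      go x = meets Z⊆T x (ng ∘ up₂ id) λ t (a , e) _ nt ct →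
        K (a , subst (cl _) (≡.sym e) (up₂ (λ { (inj₁ r) → weaken r ; (inj₂ ≡.refl) → last }) ct)
             , λ r → nt (G₂.ext (subst (cl R) e r)))

    Transfer : ∀ {k} → Pr n → Fin n → Fin n → (Fin k → Fin n) → Set
    Transfer {k} R e f h = ∃[ x ] ∃[ y ] ∃[ h′ ]
      (G₁.Pencil (cl R ∘ f₁) x y {k} h′ ×
       (∀ {j} (l : Fin j → Fin n₁) → G₁.Pencil (cl R ∘ f₁) x y l → Pencil R e f (f₁ ∘ l)))

    transfer : ∀ {k R e f} {h : Fin k → Fin n} → Pencil R e f h → ∀ {a b x y} → a ≢ b → f₁ x ≡ h a → f₁ y ≡ h b →
      ¬ ¬ Transfer R e f h
    transfer {k} {R} {e} {f} {h} pen@(on , np) {a} {b} {x} {y} a≢b ex ey K =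
      ¬¬-all moved λ mv → K (x , y , proj₁ ∘ mv , (to-on mv , to-np mv) , back)
      where
      Moved : Fin k → Fin n₁ → Set
      Moved c t = cl (R ▹ h c) (f₁ t) × ¬ cl R (f₁ t)

      spans : ∀ {i} → (R ▹ e ▹ f) i → cl (R ▹ f₁ x ▹ f₁ y) i
      spans (inj₁ (inj₁ r)) = ext (inj₁ (inj₁ r))
      spans (inj₁ (inj₂ ≡.refl)) rewrite ex | ey = proj₁ (pencil-spans pen a≢b)
      spans (inj₂ ≡.refl) rewrite ex | ey = proj₂ (pencil-spans pen a≢b)

      pushed : ∀ {i} → (R ▹ f₁ x ▹ f₁ y) i → push f₁ R (∅ ▹ x ▹ y) i
      pushed (inj₁ (inj₁ r)) = inj₁ r
      pushed (inj₁ (inj₂ ≡.refl)) = inj₂ (x , inj₁ (inj₂ ≡.refl) , ≡.refl)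
      pushed (inj₂ ≡.refl) = inj₂ (y , inj₂ ≡.refl , ≡.refl)

      on-line : ∀ {i} → cl (R ▹ e ▹ f) i → cl (push f₁ R (∅ ▹ x ▹ y)) i
      on-line c = mono pushed (cut spans c)

      loopless : ∀ c → ¬ cl R (h c)
      loopless c with c Fin.≟ a
      ... | yes ≡.refl = pencil-loopless pen a≢b
      ... | no c≢a = pencil-loopless pen c≢a

      moved : ∀ c → ¬ ¬ (∃[ t ] Moved c t)
      moved c K′ with cover (h c)
      ... | inj₁ (t , e) = K′ (t , subst (cl (R ▹ h c)) (≡.sym e) last , subst (¬_ ∘ cl R) (≡.sym e) (loopless c))
      ... | inj₂ (g , e) with move (subst (cl _) (≡.sym e) (on-line (on c))) (subst (¬_ ∘ cl R) (≡.sym e) (loopless c))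
      ...   | nn = nn λ (t , ct , nt) → K′ (t , subst (λ z → cl (R ▹ z) (f₁ t)) e ct , nt)

      reorder : ∀ {i} → ((∅ ▹ x ▹ y) ⊕ (cl R ∘ f₁)) i → ((cl R ∘ f₁) ▹ x ▹ y) i
      reorder (inj₁ (inj₁ (inj₂ e))) = inj₁ (inj₂ e)
      reorder (inj₁ (inj₂ e)) = inj₂ e
      reorder (inj₂ c) = inj₁ (inj₁ c)

      to-on : (mv : ∀ c → ∃[ t ] Moved c t) → ∀ c → G₁.cl ((cl R ∘ f₁) ▹ x ▹ y) (proj₁ (mv c))
      to-on mv c = G₁.mono reorder (restrict (on-line (cut▹ (weaken ∘ weaken ∘ ext) (on c) (proj₁ (proj₂ (mv c))))))

      to-np : (mv : ∀ c → ∃[ t ] Moved c t) → ∀ {c d} → c ≢ d →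
        ¬ G₁.cl ((cl R ∘ f₁) ▹ proj₁ (mv d)) (proj₁ (mv c))
      to-np mv {c} {d} c≢d cc with mv c | mv d
      ... | t , ct , nt | s , cs , ns = np c≢d (cut▹ (weaken ∘ ext) (t∈ s cs cc) (exch ct nt))
        where
        t∈ : ∀ s → cl (R ▹ h d) (f₁ s) → G₁.cl ((cl R ∘ f₁) ▹ s) t → cl (R ▹ h d) (f₁ t)
        t∈ s cs = up₁ λ { (inj₁ r) → weaken r ; (inj₂ ≡.refl) → cs }

      back : ∀ {j} (l : Fin j → Fin n₁) → G₁.Pencil (cl R ∘ f₁) x y l → Pencil R e f (f₁ ∘ l)
      back l (onl , npl) =
        (λ i → up₁ (λ { (inj₁ (inj₁ r)) → weaken (weaken r)
                      ; (inj₁ (inj₂ ≡.refl)) → subst (cl _) (≡.sym ex) (on a)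
                      ; (inj₂ ≡.refl) → subst (cl _) (≡.sym ey) (on b) }) (onl i)) ,
        λ {i} {j} i≢j c → npl i≢j (G₁.mono (λ { (inj₁ (inj₂ e)) → inj₂ e ; (inj₂ r) → inj₁ r })
          (restrict (mono {Q = push f₁ R (∅ ▹ l j)} (λ { (inj₁ r) → inj₁ r ; (inj₂ e) → inj₂ (l j , inj₂ ≡.refl , ≡.sym e) }) c)))

module Connection {n₁ n₂ n q} (1≤q : 1 ≤ q)
  (G₁ : Pregeometry n₁) (G₂ : Pregeometry n₂) (G : Pregeometry n)
  (f₁ : Fin n₁ → Fin n) (f₂ : Fin n₂ → Fin n)
  (inj-f₁ : Injective _≡_ _≡_ f₁) (inj-f₂ : Injective _≡_ _≡_ f₂)
  (cover : ∀ x → (∃[ a ] f₁ a ≡ x) ⊎ (∃[ b ] f₂ b ≡ x))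
  (bounded₁ : BoundedLines G₁ q) (bounded₂ : BoundedLines G₂ q)
  (full₁ : ProjectivelyFull G₁ q (λ a → ∃[ b ] f₂ b ≡ f₁ a))
  (full₂ : ProjectivelyFull G₂ q (λ b → ∃[ a ] f₁ a ≡ f₂ b))
  (up₁ : ∀ {P Q a} → (∀ {i} → P i → Pregeometry.cl G Q (f₁ i)) → Pregeometry.cl G₁ P a → Pregeometry.cl G Q (f₁ a))
  (up₂ : ∀ {P Q b} → (∀ {i} → P i → Pregeometry.cl G Q (f₂ i)) → Pregeometry.cl G₂ P b → Pregeometry.cl G Q (f₂ b))
  (closed : ∀ (X : Pr n) → (∀ {a} → Pregeometry.cl G₁ (X ∘ f₁) a → X (f₁ a)) → (∀ {b} → Pregeometry.cl G₂ (X ∘ f₂) b → X (f₂ b)) →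
            ∀ {e} → Pregeometry.cl G X e → ¬ ¬ X e)
  (agree₁ : ∀ (Z : Pr n) → (∀ {x} → Z x → ∃[ a ] ∃[ b ] (f₁ a ≡ x × f₂ b ≡ x)) →
            ∀ {a b} → f₁ a ≡ f₂ b → Pregeometry.cl G₂ (Z ∘ f₂) b → Pregeometry.cl G₁ (Z ∘ f₁) a)
  (agree₂ : ∀ (Z : Pr n) → (∀ {x} → Z x → ∃[ b ] ∃[ a ] (f₂ b ≡ x × f₁ a ≡ x)) →
            ∀ {b a} → f₂ b ≡ f₁ a → Pregeometry.cl G₁ (Z ∘ f₁) a → Pregeometry.cl G₂ (Z ∘ f₂) b)
  where
  open Pregeometry G

  private
    module S₁ = Side.Glue 1≤q G₁ G₂ G f₁ f₂ inj-f₁ inj-f₂ cover bounded₂ full₂ up₁ up₂ closed agree₁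
    module S₂ = Side.Glue 1≤q G₂ G₁ G f₂ f₁ inj-f₂ inj-f₁ ([ inj₂ , inj₁ ]′ ∘ cover) bounded₁ full₁ up₂ up₁
                  (λ X c₂ c₁ → closed X c₁ c₂) agree₂

    one-side : ∀ {k P e f} {h : Fin (3 ℕ.+ k) → Fin n} → Pencil P e f h →
      ¬ ¬ (S₁.Transfer P e f h ⊎ S₂.Transfer P e f h)
    one-side {h = h} pen K with cover (h zero) | cover (h (suc zero)) | cover (h (suc (suc zero)))
    ... | inj₁ (_ , p) | inj₁ (_ , r) | _ = S₁.transfer pen (λ ()) p r (K ∘ inj₁)
    ... | inj₁ (_ , p) | inj₂ _ | inj₁ (_ , r) = S₁.transfer pen (λ ()) p r (K ∘ inj₁)
    ... | inj₂ _ | inj₁ (_ , p) | inj₁ (_ , r) = S₁.transfer pen (λ ()) p r (K ∘ inj₁)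
    ... | inj₂ (_ , p) | inj₂ (_ , r) | _ = S₂.transfer pen (λ ()) p r (K ∘ inj₂)
    ... | inj₂ (_ , p) | inj₁ _ | inj₂ (_ , r) = S₂.transfer pen (λ ()) p r (K ∘ inj₂)
    ... | inj₁ _ | inj₂ (_ , p) | inj₂ (_ , r) = S₂.transfer pen (λ ()) p r (K ∘ inj₂)

  connection-bounded : 2 ≤ suc q → BoundedLines G q
  connection-bounded (s≤s 1≤q) P e f h pen = go 1≤q h pen
    where
    go : 1 ≤ q → (h : Fin (2 ℕ.+ q) → Fin n) → Pencil P e f h → Empty
    go (s≤s _) h pen = one-side pen λ where
      (inj₁ (x , y , h′ , pen′ , _)) → bounded₁ _ x y h′ pen′
      (inj₂ (x , y , h′ , pen′ , _)) → bounded₂ _ x y h′ pen′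

  connection-liftable : LiftableLines G₁ q → LiftableLines G₂ q → LiftableLines G q
  connection-liftable lift₁ lift₂ P e f h pen K = one-side pen λ where
    (inj₁ (x , y , h′ , pen′ , back)) → lift₁ _ x y h′ pen′ λ (l , penl , lines) →
      K (f₁ ∘ l , back l penl , λ a b≢c → up₁ (λ { (inj₁ (inj₂ ≡.refl)) → ext (inj₁ (inj₂ ≡.refl)) ; (inj₂ ≡.refl) → last }) (lines a b≢c))
    (inj₂ (x , y , h′ , pen′ , back)) → lift₂ _ x y h′ pen′ λ (l , penl , lines) →
      K (f₂ ∘ l , back l penl , λ a b≢c → up₂ (λ { (inj₁ (inj₂ ≡.refl)) → ext (inj₁ (inj₂ ≡.refl)) ; (inj₂ ≡.refl) → last }) (lines a b≢c))

closure : ∀ {n} → Matroid n → Pr n → Pr n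
closure M P e = ∀ X → Flat M X → (∀ {i} → P i → i ∈ X) → e ∈ X

infixl 5 _∖_
_∖_ : ∀ {n} → Subset n → Fin n → Pr n
(X ∖ e) i = i ∈ X × i ≢ e

Independent : ∀ {n} → (Pr n → Pr n) → Subset n → Set
Independent cl X = ∀ {e} → e ∈ X → ¬ cl (X ∖ e) e

module Closure {n} (M : Matroid n) (indep? : DecIndep M) where
  open Bases M indep?

  span⇒closure : ∀ {P X e} → (∀ {i} → i ∈ X → P i) → span X e → closure M P e
  span⇒closure X⊆P s Y fl P⊆Y = flat-closed fl (span-mono (P⊆Y ∘ X⊆P) s)

  closure⇒span : ∀ {P e} (P? : ∀ i → Dec (P i)) → closure M P e → span (sub P?) e
  closure⇒span {P} {e} P? c = ∈sub⁻ S? (c (sub S?) (closed-flat (∈sub⁺ S? ∘ span-cut (∈sub⁻ S?))) (∈sub⁺ S? ∘ inj₁ ∘ ∈sub⁺ P?))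
    where
    S? : ∀ i → Dec (span (sub P?) i)
    S? = span? (sub P?)

  closed⇒Flat : ∀ {X} → (∀ {e} → closure M (_∈ X) e → e ∈ X) → Flat M X
  closed⇒Flat h = closed-flat (h ∘ span⇒closure id)

  pregeometry : Pregeometry n
  pregeometry = record
    { cl = closure M
    ; stable = λ {P} {e} k X fl P⊆X → decidable-stable (e ∈? X) λ n → k λ c → n (c X fl P⊆X)
    ; ext = λ p X fl P⊆X → P⊆X p
    ; cut = λ f c X fl Q⊆X → c X fl λ p → f p X fl Q⊆X
    ; exch = exch
    }
    where
    exch : ∀ {P e f} → closure M (P ▹ e) f → ¬ closure M P f → closure M (P ▹ f) e
    exch {P} {e} {f} c nc X fl P⊆X = decidable-stable (e ∈? X) λ e∉X → ¬¬-dec P λ P? →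
      let Pe? = λ i → P? i ⊎-dec (i Fin.≟ e)
          s = span-mono (λ i∈ → [ (λ p → ∪⁅⁆⁺ˡ (sub P?) e (∈sub⁺ P? p)) , (λ { ≡.refl → ∪⁅⁆⁺ʳ (sub P?) e }) ]′ (∈sub⁻ Pe? i∈))
                (closure⇒span Pe? c)
      in e∉X (span⇒closure {P = P ▹ f} {X = sub P? ∪ ⁅ f ⁆}
           (λ i∈ → [ inj₁ ∘ ∈sub⁻ P? , inj₂ ]′ (∪⁅⁆⁻ (sub P?) f i∈))
           (span-exchange s (nc ∘ span⇒closure (∈sub⁻ P?))) X fl P⊆X)

  open Pregeometry pregeometry using (mono; cut; ext; stable)

  independent⇒ : ∀ {X} → Indep M X → Independent (closure M) X
  independent⇒ {X} ind {e} e∈X c = indep⇒ ind e∈X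
    (span-mono (λ i∈ → let a , b = ∈sub⁻ D? i∈ in x∈p∧x≢y⇒x∈p-y a b) (closure⇒span D? c))
    where
    D? : ∀ i → Dec ((X ∖ e) i)
    D? i = (i ∈? X) ×-dec ¬? (i Fin.≟ e)

  independent⇐ : ∀ {X} → Independent (closure M) X → Indep M X
  independent⇐ {X} h = indep⇐ λ {e} e∈X s → h e∈X (span⇒closure (∈-⁻ X e) s)

  independent-∪ : ∀ {X e} → Indep M X → ¬ closure M (_∈ X) e → Indep M (X ∪ ⁅ e ⁆)
  independent-∪ ind nc = indep-∪ ind (nc ∘ span⇒closure id)

  dependent⇒closure : ∀ {I e} → Indep M I → ¬ Indep M (I ∪ ⁅ e ⁆) → closure M (_∈ I) e
  dependent⇒closure ind dep = span⇒closure id (inj₂ (_ , id , ind , dep))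

  basis-closure : ∀ {B X e} → IsBasis M B X → e ∈ X → closure M (_∈ B) e
  basis-closure {B} {e = e} (_ , indB , maxB) e∈X with e ∈? B
  ... | yes e∈B = λ Y _ ⊆Y → ⊆Y e∈B
  ... | no e∉B = dependent⇒closure indB (maxB e e∈X e∉B)

  contr⇒ : ∀ {C X} → IndepContr M C X → ∀ {e} → e ∈ X → ¬ closure M ((_∈ C) ⊕ (X ∖ e)) e
  contr⇒ {C} {X} (disj , B , bas@(B⊆C , _) , ind) {e} e∈X c =
    independent⇒ ind (p⊆p∪q B e∈X) (cut (λ where
      (inj₁ i∈C) → mono (λ i∈B → q⊆p∪q X B i∈B , λ { ≡.refl → ∉⊥ (subst (e ∈_) disj (x∈p∩q⁺ (e∈X , B⊆C i∈B))) }) (basis-closure bas i∈C)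
      (inj₂ (i∈X , i≢e)) → ext (p⊆p∪q B i∈X , i≢e)) c)

  contr⇐ : ∀ {C X} → (∀ {e} → e ∈ X → ¬ closure M ((_∈ C) ⊕ (X ∖ e)) e) → IndepContr M C X
  contr⇐ {C} {X} h = disj , B , bas , subset-ind (λ Y → Y ⊆ X → Indep M (Y ∪ B))
      (λ _ → subst (Indep M) (≡.sym (∪-identityˡ B)) indB) step X id
    where
    B = proj₁ (basis C)
    bas = proj₂ (basis C)
    indB = proj₁ (proj₂ bas)
    disj : X ∩ C ≡ ⊥
    disj = ⊆-antisym (λ i∈ → let a , b = x∈p∩q⁻ X C i∈ in absurd (h a (ext (inj₁ b)))) ⊥⊆
    step : ∀ Y e → e ∉ Y → (Y ⊆ X → Indep M (Y ∪ B)) → Y ∪ ⁅ e ⁆ ⊆ X → Indep M ((Y ∪ ⁅ e ⁆) ∪ B)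
    step Y e e∉Y ih ⊆X = indep-⊆ M
      (λ i∈ → [ (λ j∈ → [ (λ y → ∪⁅⁆⁺ˡ (Y ∪ B) e (p⊆p∪q B y)) , (λ { ≡.refl → ∪⁅⁆⁺ʳ (Y ∪ B) e }) ]′ (∪⁅⁆⁻ Y e j∈))
              , (λ b → ∪⁅⁆⁺ˡ (Y ∪ B) e (q⊆p∪q Y B b)) ]′ (x∈p∪q⁻ (Y ∪ ⁅ e ⁆) B i∈))
      (independent-∪ (ih (⊆X ∘ ∪⁅⁆⁺ˡ Y e)) λ c → h (⊆X (∪⁅⁆⁺ʳ Y e))
        (mono (λ i∈ → [ (λ y → inj₂ (⊆X (∪⁅⁆⁺ˡ Y e y) , λ { ≡.refl → e∉Y y })) , inj₁ ∘ proj₁ bas ]′ (x∈p∪q⁻ Y B i∈)) c))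

  module Unique (G : Pregeometry n) (crit : ∀ X → Indep M X ⇔ Independent (Pregeometry.cl G) X) where
    private module G = Pregeometry G

    grow : ∀ {I e} → Indep M I → ¬ G.cl (_∈ I) e → Indep M (I ∪ ⁅ e ⁆)
    grow {I} {e} ind ne = from (crit _) λ {i} i∈ c → [ old i c , (λ { ≡.refl → new c }) ]′ (∪⁅⁆⁻ I e i∈)
      where
      new : G.cl ((I ∪ ⁅ e ⁆) ∖ e) e → Empty
      new c = ne (G.mono (λ (i∈ , i≢e) → [ id , (λ { ≡.refl → absurd (i≢e ≡.refl) }) ]′ (∪⁅⁆⁻ I e i∈)) c)
      old : ∀ i → G.cl ((I ∪ ⁅ e ⁆) ∖ i) i → i ∈ I → Empty
      old i c i∈I = ne (G.mono (λ { (inj₁ (j∈ , _)) → j∈ ; (inj₂ ≡.refl) → i∈I })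
        (G.exch {P = I ∖ i} (G.mono (λ (j∈ , j≢i) → [ (λ j∈I → inj₁ (j∈I , j≢i)) , inj₂ ]′ (∪⁅⁆⁻ I e j∈)) c)
          (to (crit I) ind i∈I)))

    closure⇒ : ∀ {P e} → closure M P e → G.cl P e
    closure⇒ {P} {e} c = G.stable λ k → ¬¬-dec P λ P? → k (go P? (closure⇒span P? c))
      where
      go : (P? : ∀ i → Dec (P i)) → span (sub P?) e → G.cl P e
      go P? (inj₁ e∈) = G.ext (∈sub⁻ P? e∈)
      go P? (inj₂ (I , I⊆ , ind , dep)) = G.mono (∈sub⁻ P? ∘ I⊆) (G.stable (dep ∘ grow ind))

    closure⇐ : ∀ {P e} → G.cl P e → closure M P e
    closure⇐ {P} {e} c = stable λ k → ¬¬-dec P λ P? →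
      let B , bas@(B⊆ , indB , maxB) = basis (sub P?)
          P⊆ : ∀ {i} → P i → G.cl (_∈ B) i
          P⊆ {i} p = G.stable λ ni → maxB i (∈sub⁺ P? p) (ni ∘ G.ext) (grow indB ni)
          c′ = G.cut P⊆ c
      in k (cut (λ i∈ → ext (∈sub⁻ P? (B⊆ i∈))) (basis-closure′ indB c′))
      where
      basis-closure′ : ∀ {B e} → Indep M B → G.cl (_∈ B) e → closure M (_∈ B) e
      basis-closure′ {B} {e} indB c with e ∈? B
      ... | yes e∈B = ext e∈B
      ... | no e∉B = dependent⇒closure indB λ ind → to (crit _) ind (∪⁅⁆⁺ʳ B e)
              (G.mono (λ i∈ → ∪⁅⁆⁺ˡ B e i∈ , λ { ≡.refl → e∉B i∈ }) c)

∣∪⁅⁆∣≤ : ∀ {n} (X : Subset n) e → ∣ X ∪ ⁅ e ⁆ ∣ ≤ suc ∣ X ∣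
∣∪⁅⁆∣≤ X e with e ∈? X
... | yes e∈X = ℕ.m≤n⇒m≤1+n (p⊆q⇒∣p∣≤∣q∣ (∪⁅⁆-⊆ id e∈X))
... | no e∉X = ℕ.≤-reflexive (∣∪⁅⁆∣ X e∉X)

¬¬-indep? : ∀ {n} (M : Matroid n) → ¬ ¬ DecIndep M
¬¬-indep? M = ¬¬-allSubset λ X → em (Indep M X)

-- N is the simplification of a minor M / C restricted to a flat containing C, with g choosing
-- representatives; both conditions are expressed by closures.
record Embeds {m n} (N : Matroid m) (M : Matroid n) : Set₁ where
  field
    C     : Pr n
    g     : Fin m → Fin n
    in⇒  : ∀ {P e} → closure N P e → closure M (push g C P) (g e)
    in⇐  : ∀ {P e} → closure M (push g C P) (g e) → closure N P e
    onto  : ∀ {e} → closure M (push g C (λ _ → Unit)) e → ¬ closure M C e →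
            ¬ ¬ (∃[ i ] closure M (C ▹ g i) e)

independent-image : ∀ {m n} (G : Pregeometry n) (g : Fin m → Fin n) → Injective _≡_ _≡_ g → ∀ X →
  Independent (Pregeometry.cl G) (image g X) ⇔ Independent (Pregeometry.cl (over G ∅ g)) X
independent-image G g inj X = mk⇔
    (λ ind {e} e∈X c → ind (∈image⁺ g e∈X) (mono (λ { (inj₂ (a , (a∈ , a≢e) , ≡.refl)) → ∈image⁺ g a∈ , a≢e ∘ inj }) c))
    (λ ind {e} e∈ c → contra ind e e∈ c)
  where
  open Pregeometry G
  contra : Independent (Pregeometry.cl (over G ∅ g)) X → ∀ e → e ∈ image g X → ¬ cl (image g X ∖ e) e
  contra ind e e∈ c with ∈image⁻ g e∈
  ... | i , i∈ , ≡.refl = ind i∈ (mono (λ (j∈ , j≢) → let a , a∈ , e = ∈image⁻ g j∈ in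
                          inj₂ (a , (a∈ , λ a≡i → j≢ (≡.trans (≡.sym e) (cong g a≡i))) , e)) c)

module _ {m n} {N : Matroid m} {M : Matroid n} (dN : DecIndep N) (dM : DecIndep M) where
  private
    module N = Closure N dN
    module M = Closure M dM
    open Pregeometry M.pregeometry

  embedding : (C : Pr n) (g : Fin m → Fin n) →
    (∀ X → Indep N X ⇔ Independent (λ P i → closure M (push g C P) (g i)) X) →
    (∀ {e} → closure M (push g C (λ _ → Unit)) e → ¬ closure M C e → ¬ ¬ (∃[ i ] closure M (C ▹ g i) e)) →
    Embeds N M
  embedding C g crit onto = record { C = C ; g = g ; in⇒ = U.closure⇒ ; in⇐ = U.closure⇐ ; onto = onto }
    where module U = N.Unique (over M.pregeometry C g) crit

  restriction-criterion : (g : Fin m → Fin n) → Injective _≡_ _≡_ g → (∀ Y → Indep N Y ⇔ Indep M (image g Y)) →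
    ∀ X → Indep N X ⇔ Independent (λ P i → closure M (push g ∅ P) (g i)) X
  restriction-criterion g inj h X = let ii = independent-image M.pregeometry g inj X in
    mk⇔ (to ii ∘ M.independent⇒ ∘ to (h X)) (λ ind → from (h X) (M.independent⇐ (from ii ind)))

  iso-embeds : Iso N M → Embeds N M
  iso-embeds (g , inj , surj , h) = embedding ∅ g (restriction-criterion g inj h)
    λ {e} _ _ K → let i , eq = surj e in K (i , subst (closure M _) (eq ≡.refl) last)

  restriction-embeds : ∀ {F g} → Flat M F → RestrictionVia N M F g → Embeds N M
  restriction-embeds {F} {g} fl (inj , im , h) = embedding ∅ g (restriction-criterion g inj h)
    λ {e} c _ K → let i , eq = to (im e) (c F fl (λ { (inj₂ (a , _ , e)) → from (im _) (a , e) }))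
                  in K (i , subst (closure M _) eq last)

  contraction-embeds : ∀ {C g} → SiContrVia N M C g → Embeds N M
  contraction-embeds {C} {g} (simple , inj , h , simp) = embedding (_∈ C) g crit onto
    where
    crit : ∀ X → Indep N X ⇔ Independent (λ P i → closure M (push g (_∈ C) P) (g i)) X
    crit X = mk⇔
      (λ ind {e} e∈X c → M.contr⇒ (to (h X) ind) (∈image⁺ g e∈X)
        (mono (λ { (inj₁ i) → inj₁ i ; (inj₂ (a , (a∈ , a≢e) , ≡.refl)) → inj₂ (∈image⁺ g a∈ , a≢e ∘ inj) }) c))
      (λ ind → from (h X) (M.contr⇐ λ {e} e∈ c → contra ind e e∈ c))
      where
      contra : Independent (λ P i → closure M (push g (_∈ C) P) (g i)) X → ∀ e → e ∈ image g X →
        ¬ closure M ((_∈ C) ⊕ (image g X ∖ e)) e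
      contra ind e e∈ c with ∈image⁻ g e∈
      ... | i , i∈ , ≡.refl = ind i∈ (mono (λ { (inj₁ i) → inj₁ i
              ; (inj₂ (j∈ , j≢)) → let a , a∈ , e = ∈image⁻ g j∈ in inj₂ (a , (a∈ , λ a≡i → j≢ (≡.trans (≡.sym e) (cong g a≡i))) , e) }) c)
    onto : ∀ {e} → closure M (push g (_∈ C) (λ _ → Unit)) e → ¬ closure M (_∈ C) e →
      ¬ ¬ (∃[ i ] closure M ((_∈ C) ▹ g i) e)
    onto {e} _ ne K with simp e
    ... | inj₁ dep = dep (M.contr⇐ λ {j} j∈ c → ne (subst (closure M (_∈ C)) (x∈⁅y⁆⇒x≡y e j∈)
              (mono (λ { (inj₁ i) → i ; (inj₂ (i∈ , i≢j)) → absurd (i≢j (≡.trans (x∈⁅y⁆⇒x≡y e i∈) (≡.sym (x∈⁅y⁆⇒x≡y e j∈)))) }) c)))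
    ... | inj₂ (i , inj₁ ≡.refl) = K (i , last)
    ... | inj₂ (i , inj₂ dep) = dep (M.contr⇐ λ {j} j∈ c → case j j∈ c)
      where
      ∈pair : ∀ {j} → j ∈ ⁅ e ⁆ ∪ ⁅ g i ⁆ → j ≡ e ⊎ j ≡ g i
      ∈pair j∈ with ∪⁅⁆⁻ ⁅ e ⁆ (g i) j∈
      ... | inj₁ a = inj₁ (x∈⁅y⁆⇒x≡y e a)
      ... | inj₂ b = inj₂ b
      case : ∀ j → j ∈ ⁅ e ⁆ ∪ ⁅ g i ⁆ → ¬ closure M ((_∈ C) ⊕ ((⁅ e ⁆ ∪ ⁅ g i ⁆) ∖ j)) j
      case j j∈ c with ∈pair j∈
      ... | inj₁ ≡.refl = K (i , mono (λ { (inj₁ x) → inj₁ x ; (inj₂ (x∈ , x≢)) → inj₂ ([ (λ y → absurd (x≢ y)) , id ]′ (∈pair x∈)) }) c)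
      ... | inj₂ ≡.refl = K (i , exch (mono (λ { (inj₁ x) → inj₁ x ; (inj₂ (x∈ , x≢)) → inj₂ ([ id , (λ y → absurd (x≢ y)) ]′ (∈pair x∈)) }) c) loopless)
        where
        loopless : ¬ closure M (_∈ C) (g i)
        loopless c = to (crit ⁅ i ⁆) (simple ⁅ i ⁆ (ℕ.≤-trans (ℕ.≤-reflexive (∣⁅x⁆∣≡1 i)) (s≤s z≤n))) (x∈⁅x⁆ i) (mono inj₁ c)

embeds-trans : ∀ {k m n} {N : Matroid k} {M′ : Matroid m} {M : Matroid n} → DecIndep M′ → DecIndep M →
  Embeds N M′ → Embeds M′ M → Embeds N M
embeds-trans {N = N} {M′} {M} dM′ dM E F = record
  { C = C′
  ; g = F.g ∘ E.g
  ; in⇒ = λ c → mono assoc⇒ (F.in⇒ (E.in⇒ c))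
  ; in⇐ = λ c → E.in⇐ (F.in⇐ (mono assoc⇐ c))
  ; onto = onto
  }
  where
  module E = Embeds E
  module F = Embeds F
  open Pregeometry (Closure.pregeometry M dM)
  C′ : Pr _
  C′ = push F.g F.C E.C
  assoc⇒ : ∀ {P i} → push F.g F.C (push E.g E.C P) i → push (F.g ∘ E.g) C′ P i
  assoc⇒ (inj₁ c) = inj₁ (inj₁ c)
  assoc⇒ (inj₂ (a , inj₁ c , e)) = inj₁ (inj₂ (a , c , e))
  assoc⇒ (inj₂ (a , inj₂ (b , p , ≡.refl) , e)) = inj₂ (b , p , e)
  assoc⇐ : ∀ {P i} → push (F.g ∘ E.g) C′ P i → push F.g F.C (push E.g E.C P) i
  assoc⇐ (inj₁ (inj₁ c)) = inj₁ c
  assoc⇐ (inj₁ (inj₂ (a , c , e))) = inj₂ (a , inj₁ c , e)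
  assoc⇐ (inj₂ (b , p , e)) = inj₂ (E.g b , inj₂ (b , p , ≡.refl) , e)
  onto : ∀ {e} → closure M (push (F.g ∘ E.g) C′ (λ _ → Unit)) e → ¬ closure M C′ e →
    ¬ ¬ (∃[ i ] closure M (C′ ▹ F.g (E.g i)) e)
  onto {e} c nc K = F.onto (mono (λ { (inj₁ (inj₁ c)) → inj₁ c ; (inj₁ (inj₂ (a , _ , e))) → inj₂ (a , tt , e)
                                    ; (inj₂ (b , _ , e)) → inj₂ (E.g b , tt , e) }) c) (nc ∘ mono inj₁)
    λ (i , ci) →
      let gi : closure M (F.C ▹ e) (F.g i)
          gi = exch ci (nc ∘ mono inj₁)
      in E.onto (F.in⇐ (cut▹ (λ c → ext (inj₁ c)) (mono assoc⇐ c) gi))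
           (λ ci′ → nc (cut▹ (ext ∘ inj₁) (F.in⇒ ci′) ci))
           λ (j , cj) → K (j , cut▹ (ext ∘ inj₁ ∘ inj₁)
             (mono (λ { (inj₁ c) → inj₁ (inj₁ c) ; (inj₂ (a , inj₁ c , e)) → inj₁ (inj₂ (a , c , e)) ; (inj₂ (a , inj₂ ≡.refl , e)) → inj₂ (≡.sym e) }) (F.in⇒ cj)) ci)

minor-embeds : ∀ {m n} {N : Matroid m} {M : Matroid n} → InducedMinor N M → ¬ ¬ Embeds N M
minor-embeds {N = N} {M} (im-iso iso) K = ¬¬-indep? N λ dN → ¬¬-indep? M λ dM → K (iso-embeds dN dM iso)
minor-embeds {N = N} {M} (im-restr {M' = M′} F g fl r im) K =
  ¬¬-indep? M′ λ dM′ → ¬¬-indep? M λ dM → minor-embeds im λ E → K (embeds-trans dM′ dM E (restriction-embeds dM′ dM fl r))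
minor-embeds {N = N} {M} (im-contr {M' = M′} C g s im) K =
  ¬¬-indep? M′ λ dM′ → ¬¬-indep? M λ dM → minor-embeds im λ E → K (embeds-trans dM′ dM E (contraction-embeds dM′ dM s))

∉⁅⁆ : ∀ {n} {i j : Fin n} → i ≢ j → i ∉ ⁅ j ⁆
∉⁅⁆ i≢j h = i≢j (x∈⁅y⁆⇒x≡y _ h)

∉∪⁅⁆ : ∀ {n} {X : Subset n} {i j} → i ∉ X → i ≢ j → i ∉ X ∪ ⁅ j ⁆
∉∪⁅⁆ {X = X} {j = j} i∉X i≢j h = [ i∉X , i≢j ]′ (∪⁅⁆⁻ X j h)

∣pair∣ : ∀ {n} {i j : Fin n} → i ≢ j → ∣ ⁅ i ⁆ ∪ ⁅ j ⁆ ∣ ≡ 2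
∣pair∣ {i = i} i≢j = ≡.trans (∣∪⁅⁆∣ ⁅ i ⁆ (∉⁅⁆ (i≢j ∘ ≡.sym))) (cong suc (∣⁅x⁆∣≡1 i))

∣triple∣ : ∀ {n} {i j k : Fin n} → i ≢ j → k ≢ i → k ≢ j → ∣ (⁅ i ⁆ ∪ ⁅ j ⁆) ∪ ⁅ k ⁆ ∣ ≡ 3
∣triple∣ {i = i} {j} i≢j k≢i k≢j = ≡.trans (∣∪⁅⁆∣ (⁅ i ⁆ ∪ ⁅ j ⁆) (∉∪⁅⁆ {X = ⁅ i ⁆} (∉⁅⁆ k≢i) k≢j)) (cong suc (∣pair∣ i≢j))

uniform-indep? : ∀ {n r} {N : Matroid n} → IsUniform r N → DecIndep N
uniform-indep? {r = r} U X = map′ (from (U X)) (to (U X)) (∣ X ∣ ℕ.≤? r)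

module Uniform {n r} {N : Matroid n} (U : IsUniform r N) where
  open Closure N (uniform-indep? {N = N} U)
  open Pregeometry pregeometry using (mono)

  ∉closure : ∀ {P e} X → (∀ {i} → P i → i ∈ X) → e ∉ X → ∣ X ∣ < r → ¬ closure N P e
  ∉closure {e = e} X P⊆X e∉X lt c = independent⇒ (from (U (X ∪ ⁅ e ⁆)) (subst (_≤ r) (≡.sym (∣∪⁅⁆∣ X e∉X)) lt)) (∪⁅⁆⁺ʳ X e)
    (mono (λ p → ∪⁅⁆⁺ˡ X e (P⊆X p) , λ { ≡.refl → e∉X (P⊆X p) }) c)

  ∈closure : ∀ {P e} X → (∀ {i} → i ∈ X → P i) → e ∉ X → ∣ X ∣ ≡ r → closure N P e
  ∈closure {e = e} X X⊆P e∉X eq = mono X⊆P (dependent⇒closure (from (U X) (ℕ.≤-reflexive eq))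
    λ ind → ℕ.<⇒≱ (ℕ.≤-refl {suc r}) (subst (_≤ r) (≡.trans (∣∪⁅⁆∣ X e∉X) (cong suc eq)) (to (U _) ind)))

  ∉closure₁ : 1 < r → ∀ {i j} → i ≢ j → ¬ closure N (∅ ▹ j) i
  ∉closure₁ lt {i} {j} i≢j = ∉closure ⁅ j ⁆ (λ { (inj₂ ≡.refl) → x∈⁅x⁆ _ }) (∉⁅⁆ i≢j) (subst (_< r) (≡.sym (∣⁅x⁆∣≡1 j)) lt)

  ∉closure₂ : 2 < r → ∀ {i j k} → i ≢ j → k ≢ i → k ≢ j → ¬ closure N (∅ ▹ i ▹ j) k
  ∉closure₂ lt {i} {j} i≢j k≢i k≢j = ∉closure (⁅ i ⁆ ∪ ⁅ j ⁆)
    (λ { (inj₁ (inj₂ ≡.refl)) → ∪⁅⁆⁺ˡ ⁅ i ⁆ j (x∈⁅x⁆ i) ; (inj₂ ≡.refl) → ∪⁅⁆⁺ʳ ⁅ i ⁆ j })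
    (∉∪⁅⁆ {X = ⁅ i ⁆} (∉⁅⁆ k≢i) k≢j) (subst (_< r) (≡.sym (∣pair∣ i≢j)) lt)

  ∈closure₂ : r ≡ 2 → ∀ {i j k} → i ≢ j → k ≢ i → k ≢ j → closure N (∅ ▹ i ▹ j) k
  ∈closure₂ eq {i} {j} i≢j k≢i k≢j = ∈closure (⁅ i ⁆ ∪ ⁅ j ⁆)
    (λ h → [ (λ h → inj₁ (inj₂ (x∈⁅y⁆⇒x≡y i h))) , inj₂ ]′ (∪⁅⁆⁻ ⁅ i ⁆ j h))
    (∉∪⁅⁆ {X = ⁅ i ⁆} (∉⁅⁆ k≢i) k≢j) (≡.trans (∣pair∣ i≢j) (≡.sym eq))

  ∈closure₃ : r ≡ 3 → ∀ {i j k l} → i ≢ j → k ≢ i → k ≢ j → l ≢ i → l ≢ j → l ≢ k → closure N (∅ ▹ i ▹ j ▹ k) l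
  ∈closure₃ eq {i} {j} {k} i≢j k≢i k≢j l≢i l≢j l≢k = ∈closure ((⁅ i ⁆ ∪ ⁅ j ⁆) ∪ ⁅ k ⁆)
    (λ h → [ (λ h → inj₁ ([ (λ h → inj₁ (inj₂ (x∈⁅y⁆⇒x≡y i h))) , inj₂ ]′ (∪⁅⁆⁻ ⁅ i ⁆ j h))) , inj₂ ]′ (∪⁅⁆⁻ (⁅ i ⁆ ∪ ⁅ j ⁆) k h))
    (∉∪⁅⁆ {X = ⁅ i ⁆ ∪ ⁅ j ⁆} (∉∪⁅⁆ {X = ⁅ i ⁆} (∉⁅⁆ l≢i) l≢j) l≢k) (≡.trans (∣triple∣ i≢j k≢i k≢j) (≡.sym eq))

module NoForbidden {q n} (2≤q : 2 ≤ q) {M : Matroid n} (dM : DecIndep M)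
  (liftable : LiftableLines (Closure.pregeometry M dM) q) where
  open Pregeometry (Closure.pregeometry M dM)

  module _ {m} {N : Matroid m} (E : Embeds N M) where
    open Embeds E

    represented : ∀ {e f k} (l : Fin k → Fin n) D → (∀ {i} → C i → D i) → Pencil D e f l →
      (∀ a → closure M (push g C (λ _ → Unit)) (l a)) → (∀ a → ∃[ b ] b ≢ a) →
      ¬ ¬ (Σ (Fin k → Fin m) λ r → (∀ a → closure M (C ▹ g (r a)) (l a)) × Injective _≡_ _≡_ r)
    represented {k = k} l D C⊆D pen@(_ , np) on oth K = ¬¬-all (λ a → onto (on a) (loopless a)) λ h →
      K (proj₁ ∘ h , proj₂ ∘ h , λ {a} {b} eq → decidable-stable (a Fin.≟ b) λ a≢b →
        np a≢b (mono (λ { (inj₁ c) → inj₁ (C⊆D c) ; (inj₂ e) → inj₂ e })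
          (parallel-trans (loopless b) (proj₂ (h a)) (subst (λ z → closure M (C ▹ g z) (l b)) (≡.sym eq) (proj₂ (h b))))))
      where
      loopless : ∀ a → ¬ closure M C (l a)
      loopless a c = pencil-loopless pen (proj₂ (oth a) ∘ ≡.sym) (mono C⊆D c)

    no-U₂ : 2 < m → m ≤ q → IsUniform 2 N → Empty
    no-U₂ (s≤s (s≤s (s≤s {n = k} _))) m≤q U = liftable C (g i₀) (g i₁) (g ∘ ι) (on , np) λ (l , (onl , npl) , _) →
      represented l C id (onl , npl)
        (λ a → mono (λ { (inj₁ (inj₁ c)) → inj₁ c ; (inj₁ (inj₂ e)) → inj₂ (i₀ , tt , ≡.sym e) ; (inj₂ e) → inj₂ (i₁ , tt , ≡.sym e) }) (onl a))
        (other 2≤q) λ (r , _ , inj) → ℕ.<-irrefl ≡.refl (ℕ.≤-trans (s≤s m≤q) (Fin.injective⇒≤ inj))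
      where
      open Uniform {N = N} U
      i₀ i₁ : Fin m
      i₀ = zero
      i₁ = suc zero
      ι : Fin 3 → Fin m
      ι a = Fin.inject≤ a (s≤s (s≤s (s≤s z≤n)))
      other : ∀ {q} → 2 ≤ q → ∀ (a : Fin (suc q)) → ∃[ b ] b ≢ a
      other (s≤s _) zero = suc zero , λ ()
      other (s≤s _) (suc a) = zero , λ ()
      on : ∀ a → closure M (C ▹ g i₀ ▹ g i₁) (g (ι a))
      on zero = ext (inj₁ (inj₂ ≡.refl))
      on (suc zero) = last
      on (suc (suc zero)) = mono (λ { (inj₁ c) → inj₁ (inj₁ c) ; (inj₂ (a , inj₁ (inj₂ ≡.refl) , e)) → inj₁ (inj₂ (≡.sym e))
                                    ; (inj₂ (a , inj₂ ≡.refl , e)) → inj₂ (≡.sym e) })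
                              (in⇒ (∈closure₂ ≡.refl {i₀} {i₁} {suc (suc zero)} (λ ()) (λ ()) (λ ())))
      ι-inj : ∀ {a b} → a ≢ b → ι a ≢ ι b
      ι-inj a≢b = a≢b ∘ Fin.inject≤-injective _ _ _ _
      np : ∀ {a b} → a ≢ b → ¬ closure M (C ▹ g (ι b)) (g (ι a))
      np {a} {b} a≢b c = ∉closure₁ (s≤s (s≤s z≤n)) (ι-inj a≢b)
        (in⇐ (mono (λ { (inj₁ c) → inj₁ c ; (inj₂ e) → inj₂ (ι b , inj₂ ≡.refl , ≡.sym e) }) c))

    no-U₃ : 3 < m → IsUniform 3 N → Empty
    no-U₃ (s≤s (s≤s (s≤s (s≤s {n = k} _)))) U = liftable D (g i₁) (g i₂) (g ∘ ι) (on , np) λ (l , (onl , npl) , lines) →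
      let t = λ a → Fin.inject≤ {3} {suc q} a (s≤s 2≤q) in
      represented (l ∘ t) D inj₁ (onl ∘ t , λ a≢b → npl (a≢b ∘ three-inj))
        (λ a → mono (λ { (inj₁ (inj₁ (inj₁ c))) → inj₁ c ; (inj₁ (inj₁ (inj₂ e))) → inj₂ (i₀ , tt , ≡.sym e)
                       ; (inj₁ (inj₂ e)) → inj₂ (i₁ , tt , ≡.sym e) ; (inj₂ e) → inj₂ (i₂ , tt , ≡.sym e) }) (onl (t a)))
        other λ (r , on-r , inj) →
          let loopless : ¬ closure M C (l (t (suc (suc zero))))
              loopless c = npl {t (suc (suc zero))} {t zero} ((λ ()) ∘ three-inj) (mono (inj₁ ∘ inj₁) c)
          in ∉closure₂ (s≤s (s≤s (s≤s z≤n))) {r zero} {r (suc zero)} {r (suc (suc zero))}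
               ((λ ()) ∘ inj) ((λ ()) ∘ inj) ((λ ()) ∘ inj)
               (in⇐ (cut▹ (ext ∘ inj₁) (cut (λ
                  { (inj₁ (inj₂ ≡.refl)) → mono (λ { (inj₁ c) → inj₁ c ; (inj₂ e) → inj₂ (r zero , inj₁ (inj₂ ≡.refl) , ≡.sym e) }) (on-r zero)
                  ; (inj₂ ≡.refl) → mono (λ { (inj₁ c) → inj₁ c ; (inj₂ e) → inj₂ (r (suc zero) , inj₂ ≡.refl , ≡.sym e) }) (on-r (suc zero)) })
                  (lines (t (suc (suc zero))) {t zero} {t (suc zero)} ((λ ()) ∘ three-inj)))
                  (exch (on-r (suc (suc zero))) loopless)))
      where
      open Uniform {N = N} U
      three-inj : ∀ {a b} → Fin.inject≤ {3} {suc q} a (s≤s 2≤q) ≡ Fin.inject≤ b (s≤s 2≤q) → a ≡ b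
      three-inj = Fin.inject≤-injective _ _ _ _
      other : ∀ (a : Fin 3) → ∃[ b ] b ≢ a
      other zero = suc zero , λ ()
      other (suc a) = zero , λ ()
      i₀ i₁ i₂ : Fin m
      i₀ = zero
      i₁ = suc zero
      i₂ = suc (suc zero)
      ι : Fin 3 → Fin m
      ι a = suc (Fin.inject≤ a (s≤s (s≤s (s≤s z≤n))))
      D : Pr n
      D = C ▹ g i₀
      on : ∀ a → closure M (D ▹ g i₁ ▹ g i₂) (g (ι a))
      on zero = ext (inj₁ (inj₂ ≡.refl))
      on (suc zero) = last
      on (suc (suc zero)) = mono (λ { (inj₁ c) → inj₁ (inj₁ (inj₁ c)) ; (inj₂ (a , inj₁ (inj₁ (inj₂ ≡.refl)) , e)) → inj₁ (inj₁ (inj₂ (≡.sym e)))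
                                    ; (inj₂ (a , inj₁ (inj₂ ≡.refl) , e)) → inj₁ (inj₂ (≡.sym e)) ; (inj₂ (a , inj₂ ≡.refl , e)) → inj₂ (≡.sym e) })
                              (in⇒ (∈closure₃ ≡.refl {i₀} {i₁} {i₂} {suc (suc (suc zero))} (λ ()) (λ ()) (λ ()) (λ ()) (λ ()) (λ ())))
      ι-inj : ∀ {a b} → a ≢ b → ι a ≢ ι b
      ι-inj a≢b = a≢b ∘ Fin.inject≤-injective _ _ _ _ ∘ Fin.suc-injective
      np : ∀ {a b} → a ≢ b → ¬ closure M (D ▹ g (ι b)) (g (ι a))
      np {a} {b} a≢b c = ∉closure₂ (s≤s (s≤s (s≤s z≤n))) {i₀} {ι b} {ι a} (λ ()) (λ ()) (ι-inj a≢b)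
        (in⇐ (mono (λ { (inj₁ (inj₁ c)) → inj₁ c ; (inj₁ (inj₂ e)) → inj₂ (i₀ , inj₁ (inj₂ ≡.refl) , ≡.sym e)
                      ; (inj₂ e) → inj₂ (ι b , inj₂ ≡.refl , ≡.sym e) }) c))

  not-forbidden : ∀ {m} {N : Matroid m} → Forbidden q N → ¬ InducedMinor N M
  not-forbidden (inj₁ (2<m , m≤q , U)) im = minor-embeds im λ E → no-U₂ E 2<m m≤q U
  not-forbidden (inj₂ (≡.refl , U)) im = minor-embeds im λ E →
    no-U₃ E (ℕ.≤-trans (s≤s (s≤s 2≤q)) (ℕ.≤-reflexive (ℕ.+-comm 2 q))) U

∣-∣ : ∀ {n} (X : Subset n) {e} → e ∈ X → ∣ X ∣ ≡ suc ∣ X ⊖ e ∣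
∣-∣ X {e} e∈ = ≡.trans (cong ∣_∣ (⊆-antisym split (∪⁅⁆-⊆ (proj₁ ∘ ∈-⁻ X e) e∈))) (∣∪⁅⁆∣ (X ⊖ e) λ h → proj₂ (∈-⁻ X e h) ≡.refl)
  where
  split : X ⊆ (X ⊖ e) ∪ ⁅ e ⁆
  split {i} i∈ with i Fin.≟ e
  ... | yes ≡.refl = ∪⁅⁆⁺ʳ (X ⊖ e) e
  ... | no i≢e = ∪⁅⁆⁺ˡ (X ⊖ e) e (x∈p∧x≢y⇒x∈p-y i∈ i≢e)

nonempty⁺ : ∀ {n} (X : Subset n) → 1 ≤ ∣ X ∣ → ∃[ i ] i ∈ X
nonempty⁺ {n} X le with nonempty? X
... | yes ne = ne
... | no e with Empty-unique e
...   | ≡.refl = absurd (ℕ.<-irrefl ≡.refl (ℕ.≤-trans le (ℕ.≤-reflexive (∣⊥∣≡0 n))))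

pick : ∀ {n} k (X : Subset n) → k ≤ ∣ X ∣ → Σ (Fin k → Fin n) λ f → Injective _≡_ _≡_ f × (∀ i → f i ∈ X)
pick zero X _ = (λ ()) , (λ {}) , λ ()
pick {n} (suc k) X le with nonempty⁺ X (ℕ.≤-trans (s≤s z≤n) le)
... | e , e∈ with pick k (X ⊖ e) (ℕ.≤-pred (ℕ.≤-trans le (ℕ.≤-reflexive (∣-∣ X e∈))))
...   | f , inj , f∈ = f′ , (λ {i} {j} → inj′ {i} {j}) , λ { zero → e∈ ; (suc i) → proj₁ (∈-⁻ X e (f∈ i)) }
  where
  f′ : Fin (suc k) → Fin n
  f′ zero = e
  f′ (suc i) = f i
  inj′ : Injective _≡_ _≡_ f′
  inj′ {zero} {zero} _ = ≡.refl
  inj′ {zero} {suc j} eq = absurd (proj₂ (∈-⁻ X e (f∈ j)) (≡.sym eq))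
  inj′ {suc i} {zero} eq = absurd (proj₂ (∈-⁻ X e (f∈ i)) eq)
  inj′ {suc i} {suc j} eq = cong suc (inj eq)

module _ {m : ℕ} where
  uniform : ℕ → Matroid m
  uniform r = record
    { Indep = λ X → ∣ X ∣ ≤ r
    ; indep-∅ = ≡.subst (_≤ r) (≡.sym (∣⊥∣≡0 m)) z≤n
    ; indep-⊆ = λ Y⊆X → ℕ.≤-trans (p⊆q⇒∣p∣≤∣q∣ Y⊆X)
    ; indep-aug = λ {X} {Y} _ iY lt → let e , e∈ , e∉ = new X Y lt in
        e , e∈ , e∉ , ≡.subst (_≤ r) (≡.sym (∣∪⁅⁆∣ X e∉)) (ℕ.≤-trans lt iY)
    }
    where
    new : ∀ X Y → ∣ X ∣ < ∣ Y ∣ → ∃[ e ] (e ∈ Y × e ∉ X)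
    new X Y lt with Fin.any? (λ e → (e ∈? Y) ×-dec ¬? (e ∈? X))
    ... | yes h = h
    ... | no none = absurd (ℕ.<⇒≱ lt (p⊆q⇒∣p∣≤∣q∣ λ {e} e∈ → decidable-stable (e ∈? X) λ e∉ → none (e , e∈ , e∉)))

  uniform-IsUniform : ∀ r → IsUniform r (uniform r)
  uniform-IsUniform r X = mk⇔ id id

module UniformCriterion {m} (H : Pregeometry m) where
  open Pregeometry H

  private
    minus-⊆ : ∀ (Y : Subset m) e {i} → (Y ∖ e) i → i ∈ Y ⊖ e
    minus-⊆ Y e (i∈ , i≢e) = x∈p∧x≢y⇒x∈p-y i∈ i≢e

    empty⁻ : ∀ (X : Subset m) → ∣ X ∣ ≤ 0 → ∀ {i} → i ∉ X
    empty⁻ X le i∈ = ℕ.<⇒≱ (ℕ.≤-trans (s≤s z≤n) (ℕ.≤-reflexive (≡.sym (∣-∣ X i∈)))) le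

    shrink : ∀ (X : Subset m) {e k} → e ∈ X → ∣ X ∣ ≤ suc k → ∣ X ⊖ e ∣ ≤ k
    shrink X e∈ le = ℕ.≤-pred (ℕ.≤-trans (ℕ.≤-reflexive (≡.sym (∣-∣ X e∈))) le)

  uniform₂ : (∀ {a} → ¬ cl ∅ a) → (∀ {a b} → a ≢ b → ¬ cl (∅ ▹ b) a) →
    (∀ {a b c} → b ≢ c → a ≢ b → a ≢ c → cl (∅ ▹ b ▹ c) a) → ∀ Y → ∣ Y ∣ ≤ 2 ⇔ Independent cl Y
  uniform₂ loopless pair triple Y = mk⇔ small large
    where
    small : ∣ Y ∣ ≤ 2 → Independent cl Y
    small le {e} e∈ c with nonempty? (Y ⊖ e)
    ... | no em = loopless (mono (λ h → absurd (em (_ , minus-⊆ Y e h))) c)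
    ... | yes (b , b∈) = pair (λ e≡b → proj₂ (∈-⁻ Y e b∈) (≡.sym e≡b)) (mono (λ {i} h → inj₂ (decidable-stable (i Fin.≟ b) λ i≢b →
            empty⁻ _ (shrink _ b∈ (shrink Y e∈ le)) (x∈p∧x≢y⇒x∈p-y (minus-⊆ Y e h) i≢b))) c)
    large : Independent cl Y → ∣ Y ∣ ≤ 2
    large ind = decidable-stable (∣ Y ∣ ℕ.≤? 2) λ nle → let f , inj , f∈ = pick 3 Y (ℕ.≰⇒> nle) in contra f inj f∈
      where
      contra : (f : Fin 3 → Fin m) → Injective _≡_ _≡_ f → (∀ i → f i ∈ Y) → Empty
      contra f inj f∈ = ind (f∈ zero) (mono in-Y (triple (apart {suc zero} {suc (suc zero)} λ ()) (apart {zero} {suc zero} λ ()) (apart {zero} {suc (suc zero)} λ ())))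
        where
        apart : ∀ {i j} → i ≢ j → f i ≢ f j
        apart i≢j e = i≢j (inj e)
        in-Y : ∀ {i} → (∅ ▹ f (suc zero) ▹ f (suc (suc zero))) i → (Y ∖ f zero) i
        in-Y (inj₁ (inj₂ ≡.refl)) = f∈ (suc zero) , apart λ ()
        in-Y (inj₂ ≡.refl) = f∈ (suc (suc zero)) , apart λ ()

  uniform₃ : (∀ a b → ∃[ c ] (c ≢ a × c ≢ b)) → (∀ {a b c} → b ≢ c → a ≢ b → a ≢ c → ¬ cl (∅ ▹ b ▹ c) a) →
    (∀ {a b c d} → b ≢ c → b ≢ d → c ≢ d → a ≢ b → a ≢ c → a ≢ d → cl (∅ ▹ b ▹ c ▹ d) a) → ∀ Y → ∣ Y ∣ ≤ 3 ⇔ Independent cl Y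
  uniform₃ fresh triple quadruple Y = mk⇔ small large
    where
    small : ∣ Y ∣ ≤ 3 → Independent cl Y
    small le {e} e∈ c with nonempty? (Y ⊖ e)
    ... | no em = let b , b≢e , _ = fresh e e ; d , d≢e , d≢b = fresh e b in
      triple {e} {b} {d} (d≢b ∘ ≡.sym) (b≢e ∘ ≡.sym) (d≢e ∘ ≡.sym) (mono (λ h → absurd (em (_ , minus-⊆ Y e h))) c)
    ... | yes (b , b∈) with nonempty? ((Y ⊖ e) ⊖ b)
    ...   | no em = let b≢e = proj₂ (∈-⁻ Y e b∈) ; d , d≢e , d≢b = fresh e b in
      triple {e} {b} {d} (d≢b ∘ ≡.sym) (b≢e ∘ ≡.sym) (d≢e ∘ ≡.sym)
        (mono (λ {i} h → inj₁ (inj₂ (decidable-stable (i Fin.≟ b) λ i≢b → em (_ , x∈p∧x≢y⇒x∈p-y (minus-⊆ Y e h) i≢b)))) c)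
    ...   | yes (d , d∈) = let b≢e = proj₂ (∈-⁻ Y e b∈) ; d∈′ , d≢b = ∈-⁻ (Y ⊖ e) b d∈ ; d≢e = proj₂ (∈-⁻ Y e d∈′) in
      triple {e} {b} {d} (d≢b ∘ ≡.sym) (b≢e ∘ ≡.sym) (d≢e ∘ ≡.sym) (mono (λ {i} h → locate i h) c)
      where
      locate : ∀ i → (Y ∖ e) i → (∅ ▹ b ▹ d) i
      locate i h with i Fin.≟ b | i Fin.≟ d
      ... | yes p | _ = inj₁ (inj₂ p)
      ... | no _ | yes p = inj₂ p
      ... | no n | no n′ = absurd (empty⁻ _ (shrink _ d∈ (shrink _ b∈ (shrink Y e∈ le)))
              (x∈p∧x≢y⇒x∈p-y (x∈p∧x≢y⇒x∈p-y (minus-⊆ Y e h) n) n′))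
    large : Independent cl Y → ∣ Y ∣ ≤ 3
    large ind = decidable-stable (∣ Y ∣ ℕ.≤? 3) λ nle → let f , inj , f∈ = pick 4 Y (ℕ.≰⇒> nle) in contra f inj f∈
      where
      contra : (f : Fin 4 → Fin m) → Injective _≡_ _≡_ f → (∀ i → f i ∈ Y) → Empty
      contra f inj f∈ = ind (f∈ zero) (mono in-Y (quadruple (apart {one′} {two} λ ()) (apart {one′} {three} λ ()) (apart {two} {three} λ ())
          (apart {zero} {one′} λ ()) (apart {zero} {two} λ ()) (apart {zero} {three} λ ())))
        where
        one′ two three : Fin 4
        one′ = suc zero
        two = suc (suc zero)
        three = suc (suc (suc zero))
        apart : ∀ {i j} → i ≢ j → f i ≢ f j
        apart i≢j e = i≢j (inj e)
        in-Y : ∀ {i} → (∅ ▹ f one′ ▹ f two ▹ f three) i → (Y ∖ f zero) i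
        in-Y (inj₁ (inj₁ (inj₂ ≡.refl))) = f∈ one′ , apart λ ()
        in-Y (inj₁ (inj₂ ≡.refl)) = f∈ two , apart λ ()
        in-Y (inj₂ ≡.refl) = f∈ three , apart λ ()

module Parts {n₁ n₂ n} (M₁ : Matroid n₁) (M₂ : Matroid n₂) (P : Matroid n)
  (d₁ : DecIndep M₁) (d₂ : DecIndep M₂) (f₁ : Fin n₁ → Fin n) (f₂ : Fin n₂ → Fin n)
  (inj₁′ : Injective _≡_ _≡_ f₁) (inj₂′ : Injective _≡_ _≡_ f₂)
  (agree : ∀ X → X ⊆ (image f₁ ⊤ ∩ image f₂ ⊤) → Indep M₁ (preimage f₁ X) ⇔ Indep M₂ (preimage f₂ X))
  where

  module C₁ = Closure M₁ d₁
  module C₂ = Closure M₂ d₂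

  agree-closure : ∀ (Z : Pr n) → (∀ {x} → Z x → ∃[ a ] ∃[ b ] (f₁ a ≡ x × f₂ b ≡ x)) →
    ∀ {a b} → f₁ a ≡ f₂ b → closure M₂ (Z ∘ f₂) b → closure M₁ (Z ∘ f₁) a
  agree-closure Z Z⊆T {a} {b} e c = stable λ k → ¬¬-dec (Z ∘ f₂) λ Z? → k (go Z? (C₂.closure⇒span Z? c))
    where
    open Pregeometry C₁.pregeometry
    go : (Z? : ∀ i → Dec (Z (f₂ i))) → Bases.span M₂ d₂ (sub Z?) b → closure M₁ (Z ∘ f₁) a
    go Z? (inj₁ b∈) = ext (subst Z (≡.sym e) (∈sub⁻ Z? b∈))
    go Z? (inj₂ (I , I⊆ , ind , dep)) = mono I₁⊆ (C₁.dependent⇒closure ind₁ dep₁)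
      where
      X = image f₂ I
      X⊆ : X ⊆ image f₁ ⊤ ∩ image f₂ ⊤
      X⊆ x∈ with ∈image⁻ f₂ x∈
      ... | i , i∈ , ≡.refl with Z⊆T (∈sub⁻ Z? (I⊆ i∈))
      ...   | a , _ , ea , _ = x∈p∩q⁺ (subst (_∈ image f₁ ⊤) ea (∈image⁺ f₁ ∈⊤) , ∈image⁺ f₂ ∈⊤)
      I₁ = preimage f₁ X
      I₁⊆ : ∀ {i} → i ∈ I₁ → Z (f₁ i)
      I₁⊆ i∈ with ∈image⁻ f₂ (∈preimage⁻ f₁ {X} i∈)
      ... | j , j∈ , ej = subst Z ej (∈sub⁻ Z? (I⊆ j∈))
      pre-X : ∀ {i} → i ∈ preimage f₂ X → i ∈ I
      pre-X i∈ with ∈image⁻ f₂ (∈preimage⁻ f₂ {X} i∈)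
      ... | j , j∈ , ej = subst (_∈ I) (inj₂′ ej) j∈
      ind₁ : Indep M₁ I₁
      ind₁ = from (agree X X⊆) (indep-⊆ M₂ pre-X ind)
      Y = X ∪ ⁅ f₂ b ⁆
      Y⊆ : Y ⊆ image f₁ ⊤ ∩ image f₂ ⊤
      Y⊆ = ∪⁅⁆-⊆ X⊆ (x∈p∩q⁺ (subst (_∈ image f₁ ⊤) e (∈image⁺ f₁ ∈⊤) , ∈image⁺ f₂ ∈⊤))
      dep₁ : ¬ Indep M₁ (I₁ ∪ ⁅ a ⁆)
      dep₁ ind′ = dep (indep-⊆ M₂ (∪⁅⁆-⊆ (λ i∈ → ∈preimage⁺ f₂ (∪⁅⁆⁺ˡ X _ (∈image⁺ f₂ i∈))) (∈preimage⁺ f₂ (∪⁅⁆⁺ʳ X _)))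
        (to (agree Y Y⊆) (indep-⊆ M₁ sub₁ ind′)))
        where
        sub₁ : preimage f₁ Y ⊆ I₁ ∪ ⁅ a ⁆
        sub₁ i∈ with ∪⁅⁆⁻ X (f₂ b) (∈preimage⁻ f₁ {Y} i∈)
        ... | inj₁ x = ∪⁅⁆⁺ˡ I₁ a (∈preimage⁺ f₁ x)
        ... | inj₂ eq = subst (_∈ I₁ ∪ ⁅ a ⁆) (≡.sym (inj₁′ (≡.trans eq (≡.sym e)))) (∪⁅⁆⁺ʳ I₁ a)

record Tame (q : ℕ) {n} (M : Matroid n) : Set₁ where
  field
    indep?   : DecIndep M
    bounded  : BoundedLines (Closure.pregeometry M indep?) q
    liftable : LiftableLines (Closure.pregeometry M indep?) q

connection-tame : ∀ {q n₁ n₂ n} {M₁ : Matroid n₁} {M₂ : Matroid n₂} (P : Matroid n)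
  (f₁ : Fin n₁ → Fin n) (f₂ : Fin n₂ → Fin n) → 2 ≤ q →
  Injective _≡_ _≡_ f₁ → Injective _≡_ _≡_ f₂ →
  (∀ x → (∃[ a ] f₁ a ≡ x) ⊎ (∃[ b ] f₂ b ≡ x)) →
  (∀ X → X ⊆ (image f₁ ⊤ ∩ image f₂ ⊤) → Indep M₁ (preimage f₁ X) ⇔ Indep M₂ (preimage f₂ X)) →
  (∀ X → Flat P X ⇔ (Flat M₁ (preimage f₁ X) × Flat M₂ (preimage f₂ X))) →
  ∀ {k} {N : Matroid k} {g : Fin k → Fin n₁} (dN : DecIndep N) →
  RestrictionVia N M₁ (preimage f₁ (image f₂ ⊤)) g →
  ProjectivelyFull (Closure.pregeometry N dN) q (λ _ → Unit) →
  Tame q M₁ → Tame q M₂ → DecIndep P → Tame q P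
connection-tame {q} {n₁} {n₂} {n} {M₁} {M₂} P f₁ f₂ 2≤q i₁ i₂ cover agree flats {N = N} {g} dN (inj-g , im , restr) fullN T₁ T₂ dP = record
  { indep? = dP
  ; bounded = connection-bounded (ℕ.m≤n⇒m≤1+n 2≤q)
  ; liftable = connection-liftable T₁.liftable T₂.liftable
  }
  where
  module T₁ = Tame T₁
  module T₂ = Tame T₂
  d₁ = T₁.indep?
  d₂ = T₂.indep?
  G₁ = Closure.pregeometry M₁ d₁
  G₂ = Closure.pregeometry M₂ d₂
  module G₁ = Pregeometry G₁
  module G₂ = Pregeometry G₂

  agree₁ = Parts.agree-closure M₁ M₂ P d₁ d₂ f₁ f₂ i₁ i₂ agree
  agree₂ = Parts.agree-closure M₂ M₁ P d₂ d₁ f₂ f₁ i₂ i₁ λ X X⊆ →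
    let eq = agree X (λ x∈ → let a , b = x∈p∩q⁻ (image f₂ ⊤) (image f₁ ⊤) (X⊆ x∈) in x∈p∩q⁺ (b , a)) in mk⇔ (from eq) (to eq)

  up₁ : ∀ {Q R a} → (∀ {i} → Q i → closure P R (f₁ i)) → closure M₁ Q a → closure P R (f₁ a)
  up₁ h c X fl R⊆ = ∈preimage⁻ f₁ {X} (c (preimage f₁ X) (proj₁ (to (flats X) fl)) λ p → ∈preimage⁺ f₁ (h p X fl R⊆))

  up₂ : ∀ {Q R a} → (∀ {i} → Q i → closure P R (f₂ i)) → closure M₂ Q a → closure P R (f₂ a)
  up₂ h c X fl R⊆ = ∈preimage⁻ f₂ {X} (c (preimage f₂ X) (proj₂ (to (flats X) fl)) λ p → ∈preimage⁺ f₂ (h p X fl R⊆))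

  closed : ∀ (X : Pr n) → (∀ {a} → closure M₁ (X ∘ f₁) a → X (f₁ a)) → (∀ {b} → closure M₂ (X ∘ f₂) b → X (f₂ b)) →
    ∀ {e} → closure P X e → ¬ ¬ X e
  closed X c₁ c₂ c K = ¬¬-dec X λ X? → K (∈sub⁻ X? (c (sub X?) (from (flats (sub X?))
    ( Closure.closed⇒Flat M₁ d₁ (λ h → ∈preimage⁺ f₁ (∈sub⁺ X? (c₁ (G₁.mono (∈sub⁻ X? ∘ ∈preimage⁻ f₁ {sub X?}) h))))
    , Closure.closed⇒Flat M₂ d₂ (λ h → ∈preimage⁺ f₂ (∈sub⁺ X? (c₂ (G₂.mono (∈sub⁻ X? ∘ ∈preimage⁻ f₂ {sub X?}) h)))))) (∈sub⁺ X?)))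

  module E where
    crit = restriction-criterion {N = N} {M₁} dN d₁ g inj-g restr
    module U = Closure.Unique N dN (over G₁ ∅ g) crit

  T⊆g : ∀ {a} → (∃[ b ] f₂ b ≡ f₁ a) → ∃[ i ] g i ≡ a
  T⊆g {a} (b , e) = to (im a) (∈preimage⁺ f₁ {image f₂ ⊤} (subst (_∈ image f₂ ⊤) e (∈image⁺ f₂ {⊤} ∈⊤)))

  g⊆T : ∀ i → ∃[ b ] f₂ b ≡ f₁ (g i)
  g⊆T i = let b , _ , e = ∈image⁻ f₂ {⊤} (∈preimage⁻ f₁ {image f₂ ⊤} (from (im (g i)) (i , ≡.refl))) in b , e

  full₁ : ProjectivelyFull G₁ q (λ a → ∃[ b ] f₂ b ≡ f₁ a)
  full₁ Ts Tt s≢t K with T⊆g Ts | T⊆g Tt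
  ... | s , ≡.refl | t , ≡.refl = fullN {s} {t} tt tt (s≢t ∘ cong g) λ (h , (on , np) , _) →
    K (g ∘ h , ((λ a → G₁.mono (λ { (inj₂ (i , inj₁ (inj₂ ≡.refl) , e)) → inj₁ (inj₂ (≡.sym e))
                                  ; (inj₂ (i , inj₂ ≡.refl , e)) → inj₂ (≡.sym e) }) (E.U.closure⇒ (on a)))
               , λ {a} {b} a≢b c → np a≢b (E.U.closure⇐ (G₁.mono (λ { (inj₂ e) → inj₂ (h b , inj₂ ≡.refl , ≡.sym e) }) c)))
               , λ a → g⊆T (h a))

  full₂ : ProjectivelyFull G₂ q (λ b → ∃[ a ] f₁ a ≡ f₂ b)
  full₂ {s₂} {t₂} (s , es) (t , et) s≢t K =
    full₁ (s₂ , ≡.sym es) (t₂ , ≡.sym et) (λ { ≡.refl → s≢t (i₂ (≡.trans (≡.sym es) et)) }) λ (h , (on , np) , Th) →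
      let T = λ {x} (z : x ≡ f₁ s ⊎ x ≡ f₁ t) → [ (λ { ≡.refl → s₂ , s , ≡.sym es , ≡.refl }) , (λ { ≡.refl → t₂ , t , ≡.sym et , ≡.refl }) ]′ z
      in K (proj₁ ∘ Th
         , ((λ a → G₂.mono (λ { (inj₁ e) → inj₁ (inj₂ (i₂ (≡.trans e es))) ; (inj₂ e) → inj₂ (i₂ (≡.trans e et)) })
               (agree₂ (λ x → x ≡ f₁ s ⊎ x ≡ f₁ t) T (proj₂ (Th a))
                 (G₁.mono (λ { (inj₁ (inj₂ ≡.refl)) → inj₁ ≡.refl ; (inj₂ ≡.refl) → inj₂ ≡.refl }) (on a))))
           , λ {a} {b} a≢b c → np a≢b (G₁.mono (λ e → inj₂ (i₁ e))
               (agree₁ (λ x → x ≡ f₁ (h b)) (λ { ≡.refl → h b , proj₁ (Th b) , ≡.refl , proj₂ (Th b) }) (≡.sym (proj₂ (Th a)))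
                 (G₂.mono (λ { (inj₂ ≡.refl) → proj₂ (Th b) }) c))))
         , λ a → h a , ≡.sym (proj₂ (Th a)))

  open Connection (ℕ.≤-trans (s≤s z≤n) 2≤q) G₁ G₂ (Closure.pregeometry P dP) f₁ f₂ i₁ i₂ cover T₁.bounded T₂.bounded full₁ full₂
    up₁ up₂ closed agree₁ agree₂

module Field {q} (𝔽 : FiniteField q) where
  open FiniteField 𝔽 public using (Carrier; _≈_; _+_; _*_; -_; _-_; 0#; 1#; +-cong; *-cong; -‿cong; +-congˡ; +-congʳ; *-congˡ; *-congʳ;
      *-comm; *-assoc; *-identityˡ; *-identityʳ; +-identityˡ; +-identityʳ; zeroˡ; zeroʳ; distribˡ; 0≉1; inverse; +-comm; -‿inverseʳ; enum; enum-injective; enum-surjective)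
    renaming (refl to ≈-refl; sym to ≈-sym; trans to ≈-trans; reflexive to ≈-reflexive)
  open Solver (FiniteField.commRing 𝔽) public using (solve; _:=_; _:+_; _:*_; _:-_; :-_; :0; :1)

  infix 4 _≟ᶠ_
  _≟ᶠ_ : ∀ x y → Dec (x ≈ y)
  x ≟ᶠ y with enum-surjective x | enum-surjective y
  ... | i , ei | j , ej with i Fin.≟ j
  ...   | yes ≡.refl = yes (≈-trans (≈-sym ei) ej)
  ...   | no i≢j = no λ e → i≢j (enum-injective i j (≈-trans ei (≈-trans e (≈-sym ej))))

  search : {P : Carrier → Set} → (∀ {x y} → x ≈ y → P x → P y) → (∀ x → Dec (P x)) → Dec (∃ P)
  search resp P? = map′ (λ (i , p) → enum i , p) (λ (x , p) → let i , e = enum-surjective x in i , resp (≈-sym e) p)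
    (Fin.any? (P? ∘ enum))

  *-cancel-0 : ∀ {a b} → ¬ (a ≈ 0#) → a * b ≈ 0# → b ≈ 0#
  *-cancel-0 {a} {b} na e = let c , ac = inverse a na in
    ≈-trans (≈-sym (*-identityˡ b)) (≈-trans (*-congʳ (≈-trans (≈-sym ac) (*-comm a c)))
      (≈-trans (*-assoc c a b) (≈-trans (*-congˡ e) (zeroʳ c))))

  -‿zero : ∀ {a} → a ≈ 0# → - a ≈ 0#
  -‿zero a≈0 = ≈-trans (-‿cong a≈0) (≈-trans (≈-sym (+-identityˡ _)) (-‿inverseʳ 0#))

  module Vectors {r : ℕ} where
    V : Set
    V = Fin r → Carrier

    infix 4 _≋_
    infixl 6 _⊹_
    infixr 7 _·_
    _≋_ : V → V → Set
    u ≋ w = ∀ j → u j ≈ w j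
    _⊹_ : V → V → V
    (u ⊹ w) j = u j + w j
    _·_ : Carrier → V → V
    (a · w) j = a * w j
    𝟘 : V
    𝟘 _ = 0#

    record Subspace (U : V → Set) : Set where
      field
        resp  : ∀ {u w} → u ≋ w → U u → U w
        zero∈ : U 𝟘
        add   : ∀ {u w} → U u → U w → U (u ⊹ w)
        scale : ∀ {w} a → U w → U (a · w)

      comb : ∀ {u w} a b → U u → U w → U (a · u ⊹ b · w)
      comb a b u w = add (scale a u) (scale b w)

      divide : ∀ {a w} → ¬ (a ≈ 0#) → U (a · w) → U w
      divide {a} {w} na h = let c , ac = inverse a na in
        resp (λ j → ≈-trans (≈-sym (*-assoc c a (w j))) (≈-trans (*-congʳ (≈-trans (*-comm c a) ac)) (*-identityˡ _))) (scale c h)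

    infixr 5 _◂_
    data Span : List V → V → Set where
      null : ∀ {w} → w ≋ 𝟘 → Span [] w
      _◂_  : ∀ {e es w} a → Span es (w ⊹ - a · e) → Span (e ∷ es) w

    Span-subspace : ∀ es → Subspace (Span es)
    Span-subspace [] = record
      { resp = λ { e (null z) → null λ j → ≈-trans (≈-sym (e j)) (z j) }
      ; zero∈ = null λ _ → ≈-refl
      ; add = λ { (null z) (null z′) → null λ j → ≈-trans (+-cong (z j) (z′ j)) (+-identityˡ 0#) }
      ; scale = λ { a (null z) → null λ j → ≈-trans (*-congˡ (z j)) (zeroʳ a) }
      }
    Span-subspace (e ∷ es) = record
      { resp = λ { eq (a ◂ s) → a ◂ S.resp (λ j → +-congʳ (eq j)) s }
      ; zero∈ = 0# ◂ S.resp (λ j → solve 1 (λ x → :0 := :0 :+ :- :0 :* x) ≈-refl (e j)) S.zero∈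
      ; add = λ { {u} {w} (a ◂ s) (b ◂ t) → (a + b) ◂ S.resp
          (λ j → solve 5 (λ a b e u w → (u :+ :- a :* e) :+ (w :+ :- b :* e) := (u :+ w) :+ :- (a :+ b) :* e) ≈-refl a b (e j) (u j) (w j)) (S.add s t) }
      ; scale = λ { {w} c (a ◂ s) → (c * a) ◂ S.resp
          (λ j → solve 4 (λ c a e w → c :* (w :+ :- a :* e) := c :* w :+ :- (c :* a) :* e) ≈-refl c a (e j) (w j)) (S.scale c s) }
      }
      where module S = Subspace (Span-subspace es)

    module Sp (es : List V) = Subspace (Span-subspace es)

    Span-there : ∀ {e es w} → Span es w → Span (e ∷ es) w
    Span-there {e} {es} {w} s = 0# ◂ Sp.resp es (λ j → solve 2 (λ e w → w := w :+ :- :0 :* e) ≈-refl (e j) (w j)) s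

    Span-here : ∀ {e} es → Span (e ∷ es) e
    Span-here {e} es = 1# ◂ Sp.resp es (λ j → solve 1 (λ e → :0 := e :+ :- :1 :* e) ≈-refl (e j)) (Sp.zero∈ es)

    Span-∈ : ∀ {e es} → e L.∈ es → Span es e
    Span-∈ (here ≡.refl) = Span-here _
    Span-∈ (there h) = Span-there (Span-∈ h)

    Span-least : ∀ {U} → Subspace U → ∀ {es} → All U es → ∀ {w} → Span es w → U w
    Span-least SU [] (null z) = Subspace.resp SU (λ j → ≈-sym (z j)) (Subspace.zero∈ SU)
    Span-least SU {e ∷ es} (u ∷ us) {w} (a ◂ s) = Subspace.resp SU
      (λ j → solve 3 (λ a e w → (w :+ :- a :* e) :+ a :* e := w) ≈-refl a (e j) (w j))
      (Subspace.add SU (Span-least SU us s) (Subspace.scale SU a u))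

    ≋? : ∀ u w → Dec (u ≋ w)
    ≋? u w = Fin.all? λ j → u j ≟ᶠ w j

    Span? : ∀ es w → Dec (Span es w)
    Span? [] w = map′ null (λ { (null z) → z }) (≋? w 𝟘)
    Span? (e ∷ es) w = map′ (λ (a , s) → a ◂ s) (λ { (a ◂ s) → a , s }) (search (λ {a} {b} eq → Sp.resp es (λ j → +-congˡ (*-congʳ (-‿cong eq)))) (λ a → Span? es (w ⊹ - a · e)))

    Span-exchange : ∀ {e es w} → Span (e ∷ es) w → ¬ Span es w → Span (w ∷ es) e
    Span-exchange {e} {es} {w} (a ◂ s) ns with a ≟ᶠ 0#
    ... | yes a≈0 = absurd (ns (Sp.resp es (λ j → ≈-trans (+-congˡ (*-congʳ (-‿cong a≈0)))
                      (solve 2 (λ e w → w :+ :- :0 :* e := w) ≈-refl (e j) (w j))) s))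
    ... | no na = let b , ab = inverse a na in b ◂ Sp.resp es
            (λ j → ≈-trans (solve 4 (λ a b e w → :- b :* (w :+ :- a :* e) := (a :* b) :* e :+ :- b :* w) ≈-refl a b (e j) (w j))
                           (+-congʳ (≈-trans (*-congʳ ab) (*-identityˡ _))))
            (Sp.scale es (- b) s)

  sum : ∀ {n} → (Fin n → Carrier) → Carrier
  sum = sumFin 𝔽

  sum-cong : ∀ {n} {f g : Fin n → Carrier} → (∀ i → f i ≈ g i) → sum f ≈ sum g
  sum-cong {zero} h = ≈-refl
  sum-cong {suc n} h = +-cong (h zero) (sum-cong (h ∘ suc))

  sum-+ : ∀ {n} (f g : Fin n → Carrier) → sum (λ i → f i + g i) ≈ sum f + sum g
  sum-+ {zero} f g = ≈-sym (+-identityˡ 0#)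
  sum-+ {suc n} f g = ≈-trans (+-congˡ (sum-+ (f ∘ suc) (g ∘ suc)))
    (solve 4 (λ a b c d → (a :+ b) :+ (c :+ d) := (a :+ c) :+ (b :+ d)) ≈-refl _ _ _ _)

  sum-* : ∀ {n} a (f : Fin n → Carrier) → sum (λ i → a * f i) ≈ a * sum f
  sum-* {zero} a f = ≈-sym (zeroʳ a)
  sum-* {suc n} a f = ≈-trans (+-congˡ (sum-* a (f ∘ suc))) (≈-sym (distribˡ a _ _))

  sum-0 : ∀ {n} {f : Fin n → Carrier} → (∀ i → f i ≈ 0#) → sum f ≈ 0#
  sum-0 {zero} h = ≈-refl
  sum-0 {suc n} h = ≈-trans (+-cong (h zero) (sum-0 (h ∘ suc))) (+-identityˡ 0#)

  δ : ∀ {n} → Fin n → Fin n → Carrier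
  δ e i with i Fin.≟ e
  ... | yes _ = 1#
  ... | no _ = 0#

  δ-≡ : ∀ {n} (e : Fin n) → δ e e ≈ 1#
  δ-≡ e with e Fin.≟ e
  ... | yes _ = ≈-refl
  ... | no ne = absurd (ne ≡.refl)

  δ-≢ : ∀ {n} {e i : Fin n} → i ≢ e → δ e i ≈ 0#
  δ-≢ {e = e} {i} ne with i Fin.≟ e
  ... | yes eq = absurd (ne eq)
  ... | no _ = ≈-refl

  sum-δ : ∀ {n} (e : Fin n) (f : Fin n → Carrier) → sum (λ i → δ e i * f i) ≈ f e
  sum-δ {suc n} zero f = ≈-trans (+-cong (≈-trans (*-congʳ (δ-≡ {suc n} zero)) (*-identityˡ _))
      (sum-0 (λ i → ≈-trans (*-congʳ (δ-≢ {suc n} {zero} {suc i} (λ ()))) (zeroˡ _)))) (+-identityʳ _)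
  sum-δ {suc n} (suc e) f = ≈-trans (+-cong (≈-trans (*-congʳ (δ-≢ {suc n} {suc e} {zero} (λ ()))) (zeroˡ _))
      (≈-trans (sum-cong (λ i → *-congʳ (shift i))) (sum-δ e (f ∘ suc)))) (+-identityˡ _)
    where
    shift : ∀ i → δ (suc e) (suc i) ≈ δ e i
    shift i with i Fin.≟ e
    ... | yes _ = ≈-refl
    ... | no _ = ≈-refl

  sum-eliminate : ∀ {n} (c : Fin n → Carrier) a (e : Fin n) (f : Fin n → Carrier) →
    sum (λ i → (c i + - a * δ e i) * f i) ≈ sum (λ i → c i * f i) + - a * f e
  sum-eliminate c a e f = ≈-trans
    (sum-cong {g = λ i → c i * f i + - a * (δ e i * f i)}
      (λ i → solve 4 (λ c x d y → (c :+ :- x :* d) :* y := c :* y :+ :- x :* (d :* y)) ≈-refl (c i) a (δ e i) (f i)))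
    (≈-trans (sum-+ (λ i → c i * f i) (λ i → - a * (δ e i * f i)))
      (+-congˡ (≈-trans (sum-* (- a) (λ i → δ e i * f i)) (*-congˡ (sum-δ e f)))))

  module Comb {n r} (v : Fin n → Fin r → Carrier) where
    open Vectors {r}

    Comb : Pr n → V → Set
    Comb P w = Σ (Fin n → Carrier) λ c → ((∀ i → ¬ P i → c i ≈ 0#) × (∀ j → sum (λ i → c i * v i j) ≈ w j))

    Comb-subspace : ∀ P → Subspace (Comb P)
    Comb-subspace P = record
      { resp = λ e (c , s , h) → c , s , λ j → ≈-trans (h j) (e j)
      ; zero∈ = (λ _ → 0#) , (λ _ _ → ≈-refl) , λ j → sum-0 {n} (λ i → zeroˡ (v i j))
      ; add = λ (c , s , h) (d , t , k) → (λ i → c i + d i) , (λ i ni → ≈-trans (+-cong (s i ni) (t i ni)) (+-identityˡ 0#)) ,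
          λ j → ≈-trans (sum-cong (λ i → solve 3 (λ c d x → (c :+ d) :* x := c :* x :+ d :* x) ≈-refl (c i) (d i) (v i j)))
                  (≈-trans (sum-+ (λ i → c i * v i j) (λ i → d i * v i j)) (+-cong (h j) (k j)))
      ; scale = λ a (c , s , h) → (λ i → a * c i) , (λ i ni → ≈-trans (*-congˡ (s i ni)) (zeroʳ a)) ,
          λ j → ≈-trans (sum-cong (λ i → *-assoc a (c i) (v i j))) (≈-trans (sum-* a (λ i → c i * v i j)) (*-congˡ (h j)))
      }

    module Cm (P : Pr n) = Subspace (Comb-subspace P)

    Comb-gen : ∀ {P i} → P i → Comb P (v i)
    Comb-gen {P} {i} p = δ i , (λ k nk → δ-≢ {e = i} {k} (λ { ≡.refl → nk p })) , λ j → sum-δ i (λ k → v k j)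

    Comb-split : ∀ {P e w} → Comb (P ▹ e) w → ∃[ a ] Comb P (w ⊹ - a · v e)
    Comb-split {P} {e} {w} (c , s , h) = c e , (λ i → c i + - c e * δ e i) , sup , λ j →
        ≈-trans (sum-eliminate c (c e) e (λ i → v i j)) (+-congʳ (h j))
      where
      sup : ∀ i → ¬ P i → c i + - c e * δ e i ≈ 0#
      sup i ni with i Fin.≟ e
      ... | yes ≡.refl = solve 1 (λ x → x :+ :- x :* :1 := :0) ≈-refl (c i)
      ... | no i≢e = ≈-trans (+-congʳ (s i [ ni , i≢e ]′)) (solve 1 (λ x → :0 :+ :- x :* :0 := :0) ≈-refl (c e))

    Comb-mono : ∀ {P Q w} → (∀ {i} → P i → Q i) → Comb P w → Comb Q w
    Comb-mono P⊆Q (c , s , h) = c , (λ i ni → s i (ni ∘ P⊆Q)) , h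

    Comb-exchange : ∀ {P e w} → ¬ Comb P w → Comb (P ▹ e) w → ∃[ a ] ∃[ w′ ] (Comb P w′ × v e ≋ a · w ⊹ w′)
    Comb-exchange {P} {e} {w} nw c = go (Comb-split c)
      where
      isolate : ∀ a b e w → (a * b) * e ≈ b * w + - b * (w + - a * e)
      isolate = solve 4 (λ a b e w → (a :* b) :* e := b :* w :+ :- b :* (w :+ :- a :* e)) ≈-refl
      go : ∃[ a ] Comb P (w ⊹ - a · v e) → ∃[ a ] ∃[ w′ ] (Comb P w′ × v e ≋ a · w ⊹ w′)
      go (a , c′) = b , - b · (w ⊹ - a · v e) , Cm.scale P (- b) c′ ,
          λ j → ≈-trans (≈-sym (≈-trans (*-congʳ ab) (*-identityˡ _))) (isolate a b (v e j) (w j))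
        where
        drop-0 : ∀ {a} e w → a ≈ 0# → w + - a * e ≈ w
        drop-0 e w a≈0 = ≈-trans (+-congˡ (*-congʳ (-‿cong a≈0))) (solve 2 (λ e w → w :+ :- :0 :* e := w) ≈-refl e w)
        a⁻¹ = inverse a λ a≈0 → nw (Cm.resp P (λ j → drop-0 (v e j) (w j) a≈0) c′)
        b = proj₁ a⁻¹
        ab = proj₂ a⁻¹

    Comb-least¬¬ : ∀ {U P} → Subspace U → (∀ {i} → P i → ¬ ¬ U (v i)) → ∀ {w} → Comb P w → ¬ ¬ U w
    Comb-least¬¬ {U} {P} SU gen {w} (c , s , h) K = ¬¬-all term λ t → K (SU.resp h (all v c t))
      where
      module SU = Subspace SU
      term : ∀ i → ¬ ¬ U (c i · v i)
      term i k with c i ≟ᶠ 0#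
      ... | yes c≈0 = k (SU.resp (λ j → ≈-sym (≈-trans (*-congʳ c≈0) (zeroˡ _))) SU.zero∈)
      ... | no nc = nc (s i λ p → gen p λ u → k (SU.scale (c i) u))
      all : ∀ {m} (v : Fin m → V) (c : Fin m → Carrier) → (∀ i → U (c i · v i)) → U (λ j → sum (λ i → c i * v i j))
      all {zero} v c t = SU.zero∈
      all {suc m} v c t = SU.add (t zero) (all (v ∘ suc) (c ∘ suc) (t ∘ suc))

    linear : Pregeometry n
    linear = record
      { cl = λ P e → ¬ ¬ Comb P (v e)
      ; stable = λ k n → k λ c → c n
      ; ext = λ p k → k (Comb-gen p)
      ; cut = λ {P} {Q} f c k → c λ c → Comb-least¬¬ (Comb-subspace Q) f c k
      ; exch = λ {P} {e} {f} c nc k → c λ c → let a , w′ , c′ , eq = Comb-exchange (λ x → nc λ n → n x) c in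
          k (Cm.resp (P ▹ f) (λ j → ≈-sym (eq j)) (Cm.add (P ▹ f) (Cm.scale (P ▹ f) a (Comb-gen (inj₂ ≡.refl))) (Comb-mono inj₁ c′)))
      }

    LinIndep⇔ : ∀ X → LinIndep 𝔽 v X ⇔ Independent (Pregeometry.cl linear) X
    LinIndep⇔ X = mk⇔ (λ li {e} e∈X c → c λ (c , s , h) →
        let z = li (λ i → c i + - 1# * δ e i)
              (λ i i∉X → ≈-trans (+-cong (s i (i∉X ∘ proj₁)) (*-congˡ (δ-≢ {e = e} {i} λ { ≡.refl → i∉X e∈X })))
                           (solve 0 (:0 :+ :- :1 :* :0 := :0) ≈-refl))
              (λ j → ≈-trans (sum-eliminate c 1# e (λ i → v i j)) (≈-trans (+-congʳ (h j))
                  (solve 1 (λ x → x :+ :- :1 :* x := :0) ≈-refl (v e j)))) e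
        in 0≉1 (≈-sym (≈-trans (solve 0 (:1 := :- (:0 :+ :- :1 :* :1)) ≈-refl)
             (≈-trans (-‿cong (≈-trans (+-cong (≈-sym (s e (λ p → proj₂ p ≡.refl))) (*-congˡ (≈-sym (δ-≡ e)))) z))
               (solve 0 (:- :0 := :0) ≈-refl)))))
      λ ind c s h i → decidable-stable (c i ≟ᶠ 0#) λ nc → nc (s i λ i∈X → ind i∈X (refute ind c s h i nc))
      where
      refute : Independent (Pregeometry.cl linear) X → ∀ c → (∀ i → i ∉ X → c i ≈ 0#) → (∀ j → sum (λ i → c i * v i j) ≈ 0#) →
        ∀ i → ¬ (c i ≈ 0#) → ¬ ¬ Comb (X ∖ i) (v i)
      refute _ c s h i nc k = k (Cm.divide (X ∖ i) {c i} nc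
          (Cm.resp (X ∖ i) (λ j → solve 2 (λ c x → :- :1 :* (:0 :+ :- c :* x) := c :* x) ≈-refl (c i) (v i j))
            (Cm.scale (X ∖ i) (- 1#) rest)))
        where
        rest : Comb (X ∖ i) (𝟘 ⊹ - c i · v i)
        rest = (λ k → c k + - c i * δ i k) , sup , λ j →
          ≈-trans (sum-eliminate c (c i) i (λ k → v k j)) (+-congʳ (h j))
          where
          sup : ∀ k → ¬ (X ∖ i) k → c k + - c i * δ i k ≈ 0#
          sup k nk with k Fin.≟ i
          ... | yes ≡.refl = solve 1 (λ x → x :+ :- x :* :1 := :0) ≈-refl (c k)
          ... | no k≢i = ≈-trans (+-congʳ (s k (λ k∈ → nk (k∈ , k≢i)))) (solve 1 (λ x → :0 :+ :- x :* :0 := :0) ≈-refl (c i))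

module Represented {q} (𝔽 : FiniteField q) {n r} (M : Matroid n) (dM : DecIndep M)
  (v : Fin n → Fin r → FiniteField.Carrier 𝔽) (rep : RepresentedBy 𝔽 M v) where
  open Field 𝔽
  open Vectors {r}
  open Comb v

  private
    criterion : ∀ X → Indep M X ⇔ Independent (Pregeometry.cl linear) X
    criterion X = mk⇔ (to (LinIndep⇔ X) ∘ to (rep X)) (from (rep X) ∘ from (LinIndep⇔ X))

    module U = Closure.Unique M dM linear criterion

  closure⇒Comb : ∀ {P e} → closure M P e → ¬ ¬ Comb P (v e)
  closure⇒Comb = U.closure⇒

  Comb⇒closure : ∀ {P e} → Comb P (v e) → closure M P e
  Comb⇒closure c = U.closure⇐ λ k → k c

module Ratio {q} (𝔽 : FiniteField q) where
  open Field 𝔽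

  ratio : Carrier → Carrier → Fin (suc q)
  ratio α β with β ≟ᶠ 0#
  ... | yes _ = zero
  ... | no nβ = suc (proj₁ (enum-surjective (α * proj₁ (inverse β nβ))))

  ratio-≡ : ∀ α β α′ β′ → ratio α β ≡ ratio α′ β′ → ¬ (α′ ≈ 0# × β′ ≈ 0#) → ∃[ κ ] (α ≈ κ * α′ × β ≈ κ * β′)
  ratio-≡ α β α′ β′ eq nz with β ≟ᶠ 0# | β′ ≟ᶠ 0#
  ... | yes z | yes z′ = let b , ab = inverse α′ (λ zα → nz (zα , z′)) in
    α * b , ≈-sym (≈-trans (solve 3 (λ a b c → a :* b :* c := a :* (c :* b)) ≈-refl α b α′) (≈-trans (*-congˡ ab) (≈-trans (*-comm _ _) (*-identityˡ _))))
          , ≈-trans z (≈-sym (≈-trans (*-congˡ z′) (zeroʳ _)))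
  ... | no nβ | no nβ′ with inverse β nβ | inverse β′ nβ′
  ...   | b , βb | b′ , βb′ with enum-surjective (α * b) | enum-surjective (α′ * b′)
  ...     | i , ei | j , ej =
    β * b′ , ≈-trans (unfold α βb) (≈-trans (*-congʳ (≈-trans (≈-sym ei) (≈-trans (≈-reflexive (cong enum (Fin.suc-injective eq))) ej)))
               (solve 4 (λ a b c d → a :* b :* d := d :* b :* a) ≈-refl α′ b′ b β))
           , unfold β βb′
    where
    unfold : ∀ {β b} α → β * b ≈ 1# → α ≈ α * b * β
    unfold {β} {b} α e = ≈-sym (≈-trans (solve 3 (λ a b c → a :* b :* c := c :* b :* a) ≈-refl α b β) (≈-trans (*-congʳ e) (*-identityˡ α)))

module Geometry {q} (𝔽 : FiniteField q) {n r} (M : Matroid n) (dM : DecIndep M) (simple : Simple M)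
  (v : Fin n → Fin r → FiniteField.Carrier 𝔽) (rep : RepresentedBy 𝔽 M v)
  (points : ∀ (w : Fin r → FiniteField.Carrier 𝔽) → ¬ (∀ j → FiniteField._≈_ 𝔽 (w j) (FiniteField.0# 𝔽)) →
     Σ (Fin n) λ i → Σ (FiniteField.Carrier 𝔽) λ a → (∀ j → FiniteField._≈_ 𝔽 (w j) (FiniteField._*_ 𝔽 a (v i j)))) where
  open Field 𝔽
  open Vectors {r}
  open Comb v
  open Represented 𝔽 M dM v rep
  open Pregeometry (Closure.pregeometry M dM)
  open Ratio 𝔽

  module Line {s t} (nt : ¬ closure M ∅ t) (ns : ¬ closure M (∅ ▹ t) s) where
    direction : Fin (suc q) → V
    direction zero = v t
    direction (suc a) = v s ⊹ enum a · v t

    direction≉0 : ∀ a → ¬ (direction a ≋ 𝟘)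
    direction≉0 zero z = nt (Comb⇒closure (Cm.resp ∅ (λ j → ≈-sym (z j)) (Cm.zero∈ ∅)))
    direction≉0 (suc a) z = ns (Comb⇒closure (Cm.resp (∅ ▹ t)
      (λ j → ≈-trans (solve 3 (λ a s t → :- a :* t := s :+ :- (s :+ a :* t)) ≈-refl (enum a) (v s j) (v t j))
               (≈-trans (+-congˡ (-‿cong (z j))) (solve 1 (λ s → s :+ :- :0 := s) ≈-refl (v s j))))
      (Cm.scale (∅ ▹ t) (- enum a) (Comb-gen (inj₂ ≡.refl)))))

    l : Fin (suc q) → Fin n
    l a = proj₁ (points (direction a) (direction≉0 a))

    l-on : ∀ {P} a → (∀ {i} → (∅ ▹ l a) i → P i) → Comb P (direction a)
    l-on {P} a la = Cm.resp P (λ j → ≈-sym (proj₂ (proj₂ (points (direction a) (direction≉0 a))) j))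
      (Cm.scale P _ (Comb-gen (la (inj₂ ≡.refl))))

    on-line : ∀ a → closure M (∅ ▹ s ▹ t) (l a)
    on-line a = Comb⇒closure (Cm.divide P {κ} κ≉0 (Cm.resp P (proj₂ (proj₂ pt)) (dir a)))
      where
      P : Pr n
      P = ∅ ▹ s ▹ t
      pt = points (direction a) (direction≉0 a)
      κ = proj₁ (proj₂ pt)
      κ≉0 : ¬ (κ ≈ 0#)
      κ≉0 z = direction≉0 a λ j → ≈-trans (proj₂ (proj₂ pt) j) (≈-trans (*-congʳ z) (zeroˡ _))
      dir : ∀ a → Comb P (direction a)
      dir zero = Comb-gen (inj₂ ≡.refl)
      dir (suc a) = Cm.add P (Comb-gen (inj₁ (inj₂ ≡.refl))) (Cm.scale P (enum a) (Comb-gen (inj₂ ≡.refl)))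

    spans : ∀ {a b} → a ≢ b → Comb (∅ ▹ l a ▹ l b) (v s) × Comb (∅ ▹ l a ▹ l b) (v t)
    spans {a} {b} a≢b = go a b a≢b (l-on a inj₁) (l-on b λ { (inj₂ e) → inj₂ e })
      where
      Q : Pr n
      Q = ∅ ▹ l a ▹ l b
      with-t : ∀ {a} → Comb Q (v t) → Comb Q (direction (suc a)) → Comb Q (v s) × Comb Q (v t)
      with-t {a} ct cd = Cm.resp Q (λ j → solve 3 (λ a s t → (s :+ a :* t) :+ :- a :* t := s) ≈-refl (enum a) (v s j) (v t j))
        (Cm.add Q cd (Cm.scale Q (- enum a) ct)) , ct
      go : ∀ a b → a ≢ b → Comb Q (direction a) → Comb Q (direction b) → Comb Q (v s) × Comb Q (v t)
      go zero zero a≢b _ _ = absurd (a≢b ≡.refl)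
      go zero (suc b) _ ct cd = with-t {b} ct cd
      go (suc a) zero _ cd ct = with-t {a} ct cd
      go (suc a) (suc b) a≢b ca cb = with-t {a} (Cm.divide Q {enum a - enum b}
          (λ z → a≢b (cong suc (enum-injective a b (≈-trans (solve 2 (λ x y → x := (x :- y) :+ y) ≈-refl (enum a) (enum b)) (≈-trans (+-congʳ z) (+-identityˡ _))))))
          (Cm.resp Q (λ j → solve 4 (λ a b s t → (s :+ a :* t) :+ :- :1 :* (s :+ b :* t) := (a :- b) :* t) ≈-refl (enum a) (enum b) (v s j) (v t j))
            (Cm.add Q ca (Cm.scale Q (- 1#) cb)))) ca

    pencil : ∀ {P} → ¬ closure M P t → ¬ closure M (P ▹ t) s → Pencil P s t l
    pencil {P} nt′ ns′ = (λ a → mono (λ { (inj₁ (inj₂ e)) → inj₁ (inj₂ e) ; (inj₂ e) → inj₂ e }) (on-line a)) , λ {a} {b} a≢b c →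
      let cs , ct = spans a≢b
          up : ∀ {i} → Comb (∅ ▹ l a ▹ l b) (v i) → closure M (P ▹ l b) i
          up ci = cut (λ { (inj₁ (inj₂ ≡.refl)) → c ; (inj₂ ≡.refl) → last }) (Comb⇒closure ci)
      in ns′ (parallel-trans nt′ (up cs) (up ct))

    lines : ∀ a {b c} → b ≢ c → closure M (∅ ▹ l b ▹ l c) (l a)
    lines a b≢c = cut (λ { (inj₁ (inj₂ ≡.refl)) → Comb⇒closure (proj₁ (spans b≢c)) ; (inj₂ ≡.refl) → Comb⇒closure (proj₂ (spans b≢c)) }) (on-line a)

  full : ProjectivelyFull (Closure.pregeometry M dM) q (λ _ → Unit)
  full {s} {t} _ _ s≢t K = K (l , pencil nt ns , λ _ → tt)
    where
    pair : Indep M (⁅ t ⁆ ∪ ⁅ s ⁆)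
    pair = simple _ (ℕ.≤-reflexive (≡.trans (∣∪⁅⁆∣ ⁅ t ⁆ (λ h → s≢t (x∈⁅y⁆⇒x≡y t h))) (cong suc (∣⁅x⁆∣≡1 t))))
    ns : ¬ closure M (∅ ▹ t) s
    ns c = Closure.independent⇒ M dM pair (∪⁅⁆⁺ʳ ⁅ t ⁆ s) (mono (λ { (inj₂ ≡.refl) → ∪⁅⁆⁺ˡ ⁅ t ⁆ s (x∈⁅x⁆ t) , λ e → s≢t (≡.sym e) }) c)
    nt : ¬ closure M ∅ t
    nt c = Closure.independent⇒ M dM pair (∪⁅⁆⁺ˡ ⁅ t ⁆ s (x∈⁅x⁆ t)) (mono (λ ()) c)
    open Line {s} {t} nt ns

  liftable : LiftableLines (Closure.pregeometry M dM) q
  liftable P e f h pen@(on , np) K = K (l , (on′ , proj₂ pen′) , lines)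
    where
    s = h zero
    t = h (suc zero)
    nt : ¬ closure M P t
    nt = pencil-loopless pen {b = zero} (λ ())
    ns : ¬ closure M (P ▹ t) s
    ns = np (λ ())
    ns∅ : ¬ closure M (∅ ▹ t) s
    ns∅ = ns ∘ mono λ { (inj₂ e) → inj₂ e }
    open Line {s} {t} (nt ∘ mono (λ ())) ns∅
    pen′ = pencil nt ns
    on′ : ∀ a → closure M (P ▹ e ▹ f) (l a)
    on′ a = cut (λ { (inj₁ (inj₂ ≡.refl)) → on zero ; (inj₂ ≡.refl) → on (suc zero) }) (on-line a)

  bounded : BoundedLines (Closure.pregeometry M dM) q
  bounded P e f h pen@(on , np) = ¬¬-all (λ a → closure⇒Comb (on a)) λ c → coords λ a →
      let β , c₁ = Comb-split (c a) ; α , c₂ = split₂ c₁ in α , β , c₂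
    where
    split₂ : ∀ {β a} → Comb (P ▹ e) (v (h a) ⊹ - β · v f) → ∃[ α ] Comb P (v (h a) ⊹ - β · v f ⊹ - α · v e)
    split₂ c = Comb-split c
    coords : (∀ a → ∃[ α ] ∃[ β ] Comb P (v (h a) ⊹ - β · v f ⊹ - α · v e)) → Empty
    coords c with Fin.pigeonhole {suc q} {2 ℕ.+ q} ℕ.≤-refl (λ a → ratio (proj₁ (c a)) (proj₁ (proj₂ (c a))))
    ... | a , b , a<b , eq with c a | c b
    ...   | α , β , ca | α′ , β′ , cb with ratio-≡ α β α′ β′ eq nonzero
      where
      nonzero : ¬ (α′ ≈ 0# × β′ ≈ 0#)
      nonzero (zα , zβ) = pencil-loopless pen {b} {a} (λ e → Fin.<⇒≢ a<b (≡.sym e)) (Comb⇒closure (Cm.resp P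
        (λ j → ≈-trans (+-cong (+-congˡ (*-congʳ (-‿cong zβ))) (*-congʳ (-‿cong zα)))
                 (solve 3 (λ w e f → (w :+ :- :0 :* f) :+ :- :0 :* e := w) ≈-refl (v (h b) j) (v e j) (v f j))) cb))
    ...     | κ , eα , eβ = np (Fin.<⇒≢ a<b) (Comb⇒closure (Cm.resp (P ▹ h b)
        (λ j → ≈-trans (+-congʳ (+-congʳ (+-cong (+-congˡ (*-congʳ (-‿cong eβ))) (*-congʳ (-‿cong eα)))))
          (solve 7 (λ w w′ a b k e f → ((w :+ :- (k :* b) :* f) :+ :- (k :* a) :* e) :+ (:- k :* ((w′ :+ :- b :* f) :+ :- a :* e)) :+ k :* w′ := w)
             ≈-refl (v (h a) j) (v (h b) j) α′ β′ κ (v e j) (v f j)))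
        (Cm.add (P ▹ h b) (Comb-mono inj₁ (Cm.add P ca (Cm.scale P (- κ) cb))) (Cm.scale (P ▹ h b) κ (Comb-gen (inj₂ ≡.refl))))))

module Forward {q} (𝔽 : FiniteField q) (2≤q : 2 ≤ q) where

  inMq-tame : ∀ {n} {M : Matroid n} → InMq 𝔽 M → ¬ ¬ Tame q M
  inMq-tame {M = M} (mq-pg r (simple , v , rep , points)) K = ¬¬-indep? M λ dM →
    K (record { indep? = dM ; bounded = bounded dM ; liftable = liftable dM })
    where open module G dM = Geometry 𝔽 M dM simple v rep points
  inMq-tame (mq-gpc {M₁ = M₁} {M₂} P f₁ f₂ m₁ m₂ i₁ i₂ cover _ agree (k , N , g , r , restr , simple , v , rep , points) flats) K =
    inMq-tame m₁ λ T₁ → inMq-tame m₂ λ T₂ → ¬¬-indep? P λ dP → ¬¬-indep? N λ dN →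
    K (connection-tame {M₁ = M₁} {M₂} P f₁ f₂ 2≤q i₁ i₂ cover agree flats {N = N} {g} dN restr (Geometry.full 𝔽 N dN simple v rep points) T₁ T₂ dP)

  inMq-not-forbidden : ∀ {m n} {N : Matroid m} {M : Matroid n} → InMq 𝔽 M → Forbidden q N → ¬ InducedMinor N M
  inMq-not-forbidden m F im = inMq-tame m λ T → NoForbidden.not-forbidden 2≤q (Tame.indep? T) (Tame.liftable T) F im

record Enumeration {n} (P : Fin n → Set) : Set where
  constructor enumeration
  field
    {k}      : ℕ
    at       : Fin k → Fin n
    at-inj   : Injective _≡_ _≡_ at
    complete : ∀ {j} → P j → ∃[ i ] at i ≡ j
    sound    : ∀ i → P (at i)

  k≤ : k ≤ n
  k≤ = Fin.injective⇒≤ at-inj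

  k< : ∀ {j} → ¬ P j → k < n
  k< {j} nj = Fin.injective⇒≤ {f = f} f-inj
    where
    f : Fin (suc k) → Fin n
    f zero = j
    f (suc i) = at i
    f-inj : Injective _≡_ _≡_ f
    f-inj {zero} {zero} _ = ≡.refl
    f-inj {zero} {suc i} e = absurd (nj (subst P (≡.sym e) (sound i)))
    f-inj {suc i} {zero} e = absurd (nj (subst P e (sound i)))
    f-inj {suc i} {suc i′} e = cong suc (at-inj e)

enumerate : ∀ {n} {P : Fin n → Set} → (∀ i → Dec (P i)) → Enumeration P
enumerate {zero} P? = enumeration {k = 0} (λ ()) (λ {}) (λ { {()} }) (λ ())
enumerate {suc n} {P} P? with enumerate {n} {P ∘ suc} (P? ∘ suc) | P? zero
... | enumeration {k} at inj comp snd | no np = enumeration {k = k} (suc ∘ at) (inj ∘ Fin.suc-injective)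
        (λ { {zero} p → absurd (np p) ; {suc j} p → let i , e = comp p in i , cong suc e }) snd
... | enumeration {k} at inj comp snd | yes p = enumeration {k = suc k} f (λ {i} {j} → f-inj {i} {j})
        (λ { {zero} _ → zero , ≡.refl ; {suc j} p → let i , e = comp p in suc i , cong suc e }) (λ { zero → p ; (suc i) → snd i })
  where
  f : Fin (suc k) → Fin (suc n)
  f zero = zero
  f (suc i) = suc (at i)
  f-inj : Injective _≡_ _≡_ f
  f-inj {zero} {zero} _ = ≡.refl
  f-inj {suc i} {suc j} e = cong suc (inj (Fin.suc-injective e))

image-mono : ∀ {m n} (g : Fin m → Fin n) {X Y} → X ⊆ Y → image g X ⊆ image g Y
image-mono g {X} {Y} X⊆Y h = let i , i∈ , e = ∈image⁻ g {X} h in subst (_∈ image g Y) e (∈image⁺ g (X⊆Y i∈))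

image-preimage : ∀ {m n} (g : Fin m → Fin n) X → X ⊆ image g ⊤ → image g (preimage g X) ≡ X
image-preimage g X X⊆ = ⊆-antisym
  (λ h → let i , i∈ , e = ∈image⁻ g {preimage g X} h in subst (_∈ X) e (∈preimage⁻ g {X} i∈))
  (λ {x} h → let i , _ , e = ∈image⁻ g {⊤} (X⊆ h) in subst (_∈ image g (preimage g X)) e (∈image⁺ g (∈preimage⁺ g (subst (_∈ X) (≡.sym e) h))))

pullback : ∀ {m n} (M : Matroid n) (g : Fin m → Fin n) → Injective _≡_ _≡_ g → Matroid m
pullback M g inj = record
  { Indep = λ Y → Indep M (image g Y)
  ; indep-∅ = subst (Indep M) (≡.sym (image-⊥ g)) (indep-∅ M)
  ; indep-⊆ = λ {X} {Y} Y⊆X → indep-⊆ M (image-mono g {Y} {X} Y⊆X)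
  ; indep-aug = aug
  }
  where
  aug : ∀ {X Y} → Indep M (image g X) → Indep M (image g Y) → ∣ X ∣ < ∣ Y ∣ → ∃[ e ] (e ∈ Y × e ∉ X × Indep M (image g (X ∪ ⁅ e ⁆)))
  aug {X} {Y} iX iY lt with indep-aug M iX iY (≡.subst₂ _<_ (≡.sym (∣image∣ g inj X)) (≡.sym (∣image∣ g inj Y)) lt)
  ... | e , e∈ , e∉ , ind with ∈image⁻ g {Y} e∈
  ...   | i , i∈ , ≡.refl = i , i∈ , (λ h → e∉ (∈image⁺ g h)) , subst (Indep M) (≡.sym (image-∪⁅⁆ g X i)) ind

pullback-simple : ∀ {m n} {M : Matroid n} {g : Fin m → Fin n} (inj : Injective _≡_ _≡_ g) → Simple M → Simple (pullback M g inj)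
pullback-simple {g = g} inj simple X le = simple (image g X) (subst (_≤ 2) (≡.sym (∣image∣ g inj X)) le)

pullback-restriction : ∀ {n} {P : Fin n → Set} (P? : ∀ i → Dec (P i)) (M : Matroid n) (E : Enumeration P) →
  RestrictionVia (pullback M (Enumeration.at E) (Enumeration.at-inj E)) M (sub P?) (Enumeration.at E)
pullback-restriction {P = P} P? M (enumeration at inj comp snd) =
  inj , (λ j → mk⇔ (comp ∘ ∈sub⁻ P?) (λ (i , e) → subst (_∈ sub P?) e (∈sub⁺ P? (snd i)))) , λ Y → mk⇔ id id

module Linear {q} (𝔽 : FiniteField q) where
  open Field 𝔽

  searchFun : ∀ {m} {P : (Fin m → Carrier) → Set} → (∀ {c d} → (∀ i → c i ≈ d i) → P c → P d) → (∀ c → Dec (P c)) → Dec (∃ P)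
  searchFun {m} {P} resp P? = map′ (λ (k , p) → enum ∘ Fin.finToFun k , p)
    (λ (c , p) → let f = λ i → proj₁ (enum-surjective (c i)) in
       Fin.funToFin f , resp (λ i → ≈-trans (≈-sym (proj₂ (enum-surjective (c i)))) (≈-reflexive (cong enum (≡.sym (Fin.finToFun-funToFin f i))))) p)
    (Fin.any? (λ k → P? (enum ∘ Fin.finToFun k)))

  sum-swap : ∀ {m n} (f : Fin m → Fin n → Carrier) → sum (λ i → sum (f i)) ≈ sum (λ j → sum (λ i → f i j))
  sum-swap {zero} {n} f = ≈-sym (sum-0 {n} (λ _ → ≈-refl))
  sum-swap {suc m} {n} f = ≈-trans (+-congˡ (sum-swap (f ∘ suc))) (≈-sym (sum-+ (f zero) (λ j → sum (λ i → f (suc i) j))))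

  module _ {n r} (v : Fin n → Fin r → Carrier) where
    open Vectors {r}

    module _ {m} (g : Fin m → Fin n) where
      Comb-push : ∀ {P w} → Comb.Comb (v ∘ g) P w → ¬ ¬ Comb.Comb v (push g ∅ P) w
      Comb-push {P} = Comb.Comb-least¬¬ (v ∘ g) (Comb.Comb-subspace v (push g ∅ P)) λ p k → k (Comb.Comb-gen v (inj₂ (_ , p , ≡.refl)))

      Comb-pull : ∀ {P w} → Comb.Comb v (push g ∅ P) w → ¬ ¬ Comb.Comb (v ∘ g) P w
      Comb-pull {P} = Comb.Comb-least¬¬ v (Comb.Comb-subspace (v ∘ g) P) λ { (inj₂ (a , p , ≡.refl)) k → k (Comb.Comb-gen (v ∘ g) p) }

      pullback-represented : ∀ {M : Matroid n} (inj : Injective _≡_ _≡_ g) → RepresentedBy 𝔽 M v → RepresentedBy 𝔽 (pullback M g inj) (v ∘ g)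
      pullback-represented {M} inj rep X = mk⇔
        (λ ind → from (Comb.LinIndep⇔ (v ∘ g) X) λ e∈ c → to image⇔ (to (Comb.LinIndep⇔ v (image g X)) (to (rep (image g X)) ind)) e∈
           λ k → c λ c → Comb-push c k)
        (λ li → from (rep (image g X)) (from (Comb.LinIndep⇔ v (image g X)) (from image⇔ λ e∈ c → to (Comb.LinIndep⇔ (v ∘ g) X) li e∈
           λ k → c λ c → Comb-pull c k)))
        where
        image⇔ = independent-image (Comb.linear v) g inj X

    linIndep? : ∀ X → Dec (LinIndep 𝔽 v X)
    linIndep? X = map′ (λ none c s h i → decidable-stable (c i ≟ᶠ 0#) λ nc → none (c , s , h , i , nc))
        (λ li (c , s , h , i , nc) → nc (li c s h i))
        (¬? (searchFun resp λ c → (Fin.all? λ i → sup? c i) ×-dec ((Fin.all? λ j → sum (λ i → c i * v i j) ≟ᶠ 0#) ×-dec Fin.any? λ i → ¬? (c i ≟ᶠ 0#))))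
      where
      sup? : ∀ c i → Dec (i ∉ X → c i ≈ 0#)
      sup? c i with i ∈? X | c i ≟ᶠ 0#
      ... | yes i∈ | _ = yes λ n → absurd (n i∈)
      ... | no _ | yes z = yes λ _ → z
      ... | no n | no nz = no λ f → nz (f n)
      resp : ∀ {c d : Fin n → Carrier} → (∀ i → c i ≈ d i) →
        ((∀ i → i ∉ X → c i ≈ 0#) × (∀ j → sum (λ i → c i * v i j) ≈ 0#) × ∃[ i ] ¬ (c i ≈ 0#)) →
        ((∀ i → i ∉ X → d i ≈ 0#) × (∀ j → sum (λ i → d i * v i j) ≈ 0#) × ∃[ i ] ¬ (d i ≈ 0#))
      resp e (s , h , i , nc) = (λ i n → ≈-trans (≈-sym (e i)) (s i n)) , (λ j → ≈-trans (sum-cong (λ i → *-congʳ (≈-sym (e i)))) (h j)) ,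
        i , λ z → nc (≈-trans (e i) z)

  represented-indep? : ∀ {n r} {M : Matroid n} {v : Fin n → Fin r → Carrier} → RepresentedBy 𝔽 M v → DecIndep M
  represented-indep? {v = v} rep X = map′ (from (rep X)) (to (rep X)) (linIndep? v X)

  module Full {n r} (M : Matroid n) (v : Fin n → Fin r → Carrier) (rep : RepresentedBy 𝔽 M v) where
    open Vectors {r}
    open Comb v

    dM : DecIndep M
    dM = represented-indep? {M = M} {v} rep

    open Represented 𝔽 M dM v rep public
    open Bases M dM

    FullSet : Subset n → Set
    FullSet T = ∀ {w} → Comb (_∈ T) w → w ≋ 𝟘 ⊎ (∃[ i ] ∃[ b ] (i ∈ T × ¬ (b ≈ 0#) × w ≋ b · v i))

    Comb-∪ : ∀ {P Q w} → Comb (λ i → P i ⊎ Q i) w → ¬ ¬ (∃[ x ] ∃[ y ] (Comb P x × Comb Q y × w ≋ x ⊹ y))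
    Comb-∪ {P} {Q} = Comb-least¬¬ sumspace λ where
        (inj₁ p) k → k (_ , 𝟘 , Comb-gen p , Cm.zero∈ Q , λ j → ≈-sym (+-identityʳ _))
        (inj₂ p) k → k (𝟘 , _ , Cm.zero∈ P , Comb-gen p , λ j → ≈-sym (+-identityˡ _))
      where
      sumspace : Subspace (λ w → ∃[ x ] ∃[ y ] (Comb P x × Comb Q y × w ≋ x ⊹ y))
      sumspace = record
        { resp = λ e (x , y , cx , cy , eq) → x , y , cx , cy , λ j → ≈-trans (≈-sym (e j)) (eq j)
        ; zero∈ = 𝟘 , 𝟘 , Cm.zero∈ P , Cm.zero∈ Q , λ j → ≈-sym (+-identityˡ 0#)
        ; add = λ (x , y , cx , cy , eq) (x′ , y′ , cx′ , cy′ , eq′) → x ⊹ x′ , y ⊹ y′ , Cm.add P cx cx′ , Cm.add Q cy cy′ ,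
            λ j → ≈-trans (+-cong (eq j) (eq′ j)) (interchange (x j) (y j) (x′ j) (y′ j))
        ; scale = λ a (x , y , cx , cy , eq) → a · x , a · y , Cm.scale P a cx , Cm.scale Q a cy ,
            λ j → ≈-trans (*-congˡ (eq j)) (distribˡ a (x j) (y j))
        }
        where
        interchange : ∀ a b c d → (a + b) + (c + d) ≈ (a + c) + (b + d)
        interchange = solve 4 (λ a b c d → (a :+ b) :+ (c :+ d) := (a :+ c) :+ (b :+ d)) ≈-refl

    flat-Comb : ∀ {F i} → Flat M F → Comb (_∈ F) (v i) → i ∈ F
    flat-Comb fl c = Comb⇒closure c _ fl id

    private
      cancelˡ : ∀ w x y → w ≈ x + y → 1# * w + - 1# * y ≈ x
      cancelˡ w x y e = ≈-trans (+-congʳ (*-congˡ e)) (lem x y)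
        where
        lem : ∀ x y → 1# * (x + y) + - 1# * y ≈ x
        lem = solve 2 (λ x y → :1 :* (x :+ y) :+ :- :1 :* y := x) ≈-refl

    full-flat-modular : ∀ {T} → Flat M T → FullSet T → ModularFlat M T
    full-flat-modular {T} flT full = flT , λ F flF a b c d RT RF RI RU → counts F flF RT RF RI RU
      where
      counts : ∀ F → Flat M F → ∀ {a b c d} → Rank M T a → Rank M F b → Rank M (T ∩ F) c → Rank M (T ∪ F) d → a ℕ.+ b ≡ c ℕ.+ d
      counts F flF (BT₀ , bT₀ , ≡.refl) (BF₀ , bF₀ , ≡.refl) (I , bI@(I⊆ , indI , maxI) , ≡.refl) (BU₀ , bU₀ , ≡.refl)
        with extend-basis {I} {T} (λ i∈ → proj₁ (x∈p∩q⁻ T F (I⊆ i∈))) indI | extend-basis {I} {F} (λ i∈ → proj₂ (x∈p∩q⁻ T F (I⊆ i∈))) indI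
      ... | BT , I⊆BT , bT@(BT⊆ , indT , maxT) | BF , I⊆BF , bF@(BF⊆ , indF , maxF) =
        ≡.trans (cong₂ ℕ._+_ (basis-size bT₀ bT) (basis-size bF₀ bF))
          (≡.trans (≡.sym (∣∪∣+∣∩∣ BT BF)) (≡.trans (cong₂ ℕ._+_ (basis-size bU bU₀) (cong ∣_∣ meet)) (ℕ.+-comm ∣ BU₀ ∣ ∣ I ∣)))
        where
        meet : BT ∩ BF ≡ I
        meet = ⊆-antisym (λ {i} h → let i∈T , i∈F = x∈p∩q⁻ BT BF h in decidable-stable (i ∈? I) λ i∉ →
                 maxI i (x∈p∩q⁺ (BT⊆ i∈T , BF⊆ i∈F)) i∉ (indep-⊆ M (∪⁅⁆-⊆ I⊆BT i∈T) indT))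
               (λ i∈ → x∈p∩q⁺ (I⊆BT i∈ , I⊆BF i∈))

        skew : ∀ {Y e} → Y ⊆ BF → e ∈ BF → e ∉ Y → e ∉ BT → ¬ closure M (_∈ BT ∪ Y) e
        skew {Y} {e} Y⊆ e∈ e∉Y e∉BT c = closure⇒Comb c λ c → Comb-∪ {_∈ BT} {_∈ Y} (Comb-mono (x∈p∪q⁻ BT Y) c) λ (x , y , cx , cy , eq) →
            [ (λ z → refute (Cm.resp (BF ∖ e) (λ j → ≈-sym (≈-trans (eq j) (≈-trans (+-congʳ (z j)) (+-identityˡ _)))) (below Y⊆ e∉Y cy)))
            , (λ (i , b , i∈T , nb , x≋) → closure⇒Comb (Closure.basis-closure M dM bI (x∈p∩q⁺ (i∈T , flat-Comb flF (Cm.divide (_∈ F) nb (Cm.resp (_∈ F)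
                  (λ j → ≈-trans (cancelˡ (v e j) (x j) (y j) (eq j)) (x≋ j))
                  (Cm.comb (_∈ F) 1# (- 1#) (Comb-gen (BF⊆ e∈)) (Comb-mono (BF⊆ ∘ Y⊆) cy))))))) λ ci →
                refute (Cm.resp (BF ∖ e) (λ j → ≈-sym (≈-trans (eq j) (+-congʳ (x≋ j))))
                  (Cm.add (BF ∖ e) (Cm.scale (BF ∖ e) b (below I⊆BF (e∉BT ∘ I⊆BT) ci)) (below Y⊆ e∉Y cy))))
            ]′ (full (Comb-mono BT⊆ cx))
          where
          below : ∀ {Y w} → Y ⊆ BF → e ∉ Y → Comb (_∈ Y) w → Comb (BF ∖ e) w
          below Y⊆ e∉ = Comb-mono λ i∈ → Y⊆ i∈ , λ { ≡.refl → e∉ i∈ }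
          refute : ¬ Comb (BF ∖ e) (v e)
          refute c = Closure.independent⇒ M dM indF e∈ (Comb⇒closure c)

        indU : ∀ Y → Y ⊆ BF → Indep M (BT ∪ Y)
        indU = subset-ind _ (λ _ → subst (Indep M) (≡.sym (∪-identityʳ BT)) indT) λ Y e e∉Y ih Y⊆ → step Y e e∉Y (ih (Y⊆ ∘ ∪⁅⁆⁺ˡ Y e)) Y⊆
          where
          step : ∀ Y e → e ∉ Y → Indep M (BT ∪ Y) → Y ∪ ⁅ e ⁆ ⊆ BF → Indep M (BT ∪ (Y ∪ ⁅ e ⁆))
          step Y e e∉Y ih Y⊆ = subst (Indep M) (∪-assoc BT Y ⁅ e ⁆) (decide (e ∈? BT))
            where
            decide : Dec (e ∈ BT) → Indep M ((BT ∪ Y) ∪ ⁅ e ⁆)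
            decide (yes e∈) = indep-⊆ M (∪⁅⁆-⊆ id (p⊆p∪q Y e∈)) ih
            decide (no e∉) = Closure.independent-∪ M dM ih (skew (Y⊆ ∘ ∪⁅⁆⁺ˡ Y e) (Y⊆ (∪⁅⁆⁺ʳ Y e)) e∉Y e∉)

        bU : IsBasis M (BT ∪ BF) (T ∪ F)
        bU = (λ h → x∈p∪q⁺ ([ inj₁ ∘ BT⊆ , inj₂ ∘ BF⊆ ]′ (x∈p∪q⁻ BT BF h))) , indU BF id , λ e e∈ e∉ ind →
          [ (λ e∈T → maxT e e∈T (e∉ ∘ p⊆p∪q BF) (indep-⊆ M (∪⁅⁆-⊆ (∪⁅⁆⁺ˡ _ e ∘ p⊆p∪q BF) (∪⁅⁆⁺ʳ _ e)) ind))
          , (λ e∈F → maxF e e∈F (e∉ ∘ q⊆p∪q BT BF) (indep-⊆ M (∪⁅⁆-⊆ (∪⁅⁆⁺ˡ _ e ∘ q⊆p∪q BT BF) (∪⁅⁆⁺ʳ _ e)) ind)) ]′ (x∈p∪q⁻ T F e∈)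

module Coordinates {q} (𝔽 : FiniteField q) {n r} (M : Matroid n) (v : Fin n → Fin r → FiniteField.Carrier 𝔽) (rep : RepresentedBy 𝔽 M v) where
  open Field 𝔽
  open Vectors {r}
  open Linear 𝔽
  open Full M v rep
  open Comb v

  private
    basis-⊤ = Bases.basis M dM ⊤
    B = proj₁ basis-⊤
    bB = proj₂ basis-⊤
    E = enumerate (_∈? B)

  dimension : ℕ
  dimension = Enumeration.k E

  private
    b : Fin dimension → Fin n
    b = Enumeration.at E

    lin-b : LinIndep 𝔽 (v ∘ b) ⊤
    lin-b = to (pullback-represented v b {M = M} (Enumeration.at-inj E) rep ⊤)
      (indep-⊆ M (λ h → let i , _ , e = ∈image⁻ b {⊤} h in subst (_∈ B) e (Enumeration.sound E i)) (proj₁ (proj₂ bB)))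

    Coord : V → Set
    Coord w = Σ (Fin dimension → Carrier) λ c → ∀ j → sum (λ l → c l * v (b l) j) ≈ w j

    coord? : ∀ w → Dec (Coord w)
    coord? w = searchFun (λ e h j → ≈-trans (sum-cong (λ l → *-congʳ (≈-sym (e l)))) (h j))
      λ c → Fin.all? λ j → sum (λ l → c l * v (b l) j) ≟ᶠ w j

    coord : ∀ i → Coord (v i)
    coord i = decidable-stable (coord? (v i)) λ k → closure⇒Comb (Closure.basis-closure M dM bB (∈⊤ {x = i})) λ c →
      Comb-pull v b (Comb-mono {Q = push b ∅ (λ _ → Unit)} (λ {l} l∈ → let m , e = Enumeration.complete E l∈ in inj₂ (m , tt , e)) c)
        λ (c , _ , h) → k (c , h)

  coordinates : Fin n → Fin dimension → Carrier
  coordinates i = proj₁ (coord i)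

  private
    expand : ∀ (c : Fin n → Carrier) j → sum (λ i → c i * v i j) ≈ sum (λ l → sum (λ i → c i * coordinates i l) * v (b l) j)
    expand c j = ≈-trans (sum-cong (λ i → ≈-trans (*-congˡ (≈-sym (proj₂ (coord i) j))) (≈-sym (sum-* (c i) (λ l → coordinates i l * v (b l) j)))))
      (≈-trans (sum-swap (λ i l → c i * (coordinates i l * v (b l) j)))
        (sum-cong λ l → ≈-trans (sum-cong (λ i → rotate (c i) (coordinates i l) (v (b l) j)))
          (≈-trans (sum-* (v (b l) j) (λ i → c i * coordinates i l)) (*-comm _ _))))
      where
      rotate : ∀ a x y → a * (x * y) ≈ y * (a * x)
      rotate = solve 3 (λ a x y → a :* (x :* y) := y :* (a :* x)) ≈-refl

  coordinates-represent : RepresentedBy 𝔽 M coordinates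
  coordinates-represent X = mk⇔
    (λ ind c s h → to (rep X) ind c s λ j → ≈-trans (expand c j) (sum-0 (λ l → ≈-trans (*-congʳ (h l)) (zeroˡ _))))
    (λ li → from (rep X) λ c s h → li c s λ l → lin-b (λ l → sum (λ i → c i * coordinates i l)) (λ l l∉ → absurd (l∉ ∈⊤))
      (λ j → ≈-trans (≈-sym (expand c j)) (h j)) l)

  full⇒PG : Simple M → FullSet ⊤ → IsPG 𝔽 dimension M
  full⇒PG simple full = simple , coordinates , coordinates-represent , points
    where
    points : ∀ (w : Fin dimension → Carrier) → ¬ (∀ l → w l ≈ 0#) → ∃[ i ] ∃[ a ] (∀ l → w l ≈ a * coordinates i l)
    points w nw = [ (λ z → absurd (nw (lin-b w (λ l l∉ → absurd (l∉ ∈⊤)) z))) , (λ (i , a , _ , _ , h) → i , a , point i a h) ]′ (full in-span)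
      where
      x : V
      x j = sum (λ l → w l * v (b l) j)
      in-span : Comb (_∈ ⊤) x
      in-span = (λ i → sum (λ l → w l * δ (b l) i)) , (λ i i∉ → absurd (i∉ ∈⊤)) , λ j →
        ≈-trans (sum-cong (λ i → ≈-trans (*-comm _ _) (≈-sym (sum-* (v i j) (λ l → w l * δ (b l) i)))))
          (≈-trans (sum-swap (λ i l → v i j * (w l * δ (b l) i)))
            (sum-cong λ l → ≈-trans (sum-cong (λ i → rotate (v i j) (w l) (δ (b l) i)))
              (≈-trans (sum-* (w l) (λ i → δ (b l) i * v i j)) (*-congˡ (sum-δ (b l) (λ i → v i j))))))
        where
        rotate : ∀ a x y → a * (x * y) ≈ x * (y * a)
        rotate = solve 3 (λ a x y → a :* (x :* y) := x :* (y :* a)) ≈-refl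
      point : ∀ i a → x ≋ a · v i → ∀ l → w l ≈ a * coordinates i l
      point i a h l = ≈-trans (add-back (w l) (a * coordinates i l)) (≈-trans (+-congʳ (zero-at l)) (+-identityˡ _))
        where
        add-back : ∀ x y → x ≈ (x + - 1# * y) + y
        add-back = solve 2 (λ x y → x := (x :+ :- :1 :* y) :+ y) ≈-refl
        spread : ∀ w a c x → (w + - 1# * (a * c)) * x ≈ w * x + (- 1# * a) * (c * x)
        spread = solve 4 (λ w a c x → (w :+ :- :1 :* (a :* c)) :* x := w :* x :+ (:- :1 :* a) :* (c :* x)) ≈-refl
        vanish : ∀ a y → a * y + (- 1# * a) * y ≈ 0#
        vanish = solve 2 (λ a y → a :* y :+ (:- :1 :* a) :* y := :0) ≈-refl
        zero-at : ∀ l → w l + - 1# * (a * coordinates i l) ≈ 0#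
        zero-at = lin-b (λ l → w l + - 1# * (a * coordinates i l)) (λ l l∉ → absurd (l∉ ∈⊤)) λ j →
          ≈-trans (sum-cong (λ l → spread (w l) a (coordinates i l) (v (b l) j)))
            (≈-trans (sum-+ (λ l → w l * v (b l) j) (λ l → (- 1# * a) * (coordinates i l * v (b l) j)))
              (≈-trans (+-cong (h j) (≈-trans (sum-* (- 1# * a) (λ l → coordinates i l * v (b l) j)) (*-congˡ (proj₂ (coord i) j))))
                (vanish a (v i j))))

filter-filter-≤ : {A : Set} {P Q R : A → Set} (P? : ∀ x → Dec (P x)) (Q? : ∀ x → Dec (Q x)) (R? : ∀ x → Dec (R x)) →
  (∀ {x} → P x → R x) → ∀ xs → length (filter P? (filter Q? xs)) ≤ length (filter R? xs)
filter-filter-≤ P? Q? R? P⊆R [] = z≤n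
filter-filter-≤ P? Q? R? P⊆R (x ∷ xs) with Q? x
... | no _ with R? x
...   | yes _ = ℕ.m≤n⇒m≤1+n (filter-filter-≤ P? Q? R? P⊆R xs)
...   | no _ = filter-filter-≤ P? Q? R? P⊆R xs
filter-filter-≤ P? Q? R? P⊆R (x ∷ xs) | yes _ with P? x | R? x
...   | yes _ | yes _ = s≤s (filter-filter-≤ P? Q? R? P⊆R xs)
...   | yes p | no nr = absurd (nr (P⊆R p))
...   | no _ | yes _ = ℕ.m≤n⇒m≤1+n (filter-filter-≤ P? Q? R? P⊆R xs)
...   | no _ | no _ = filter-filter-≤ P? Q? R? P⊆R xs

filter-filter-< : {A : Set} {P Q R : A → Set} (P? : ∀ x → Dec (P x)) (Q? : ∀ x → Dec (Q x)) (R? : ∀ x → Dec (R x)) →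
  (∀ {x} → P x → R x) → ∀ {z xs} → z L.∈ xs → R z → ¬ (P z × Q z) → length (filter P? (filter Q? xs)) < length (filter R? xs)
filter-filter-< P? Q? R? P⊆R {xs = x ∷ xs} (here ≡.refl) r npq with Q? x | R? x
... | _ | no nr = absurd (nr r)
... | no _ | yes _ = s≤s (filter-filter-≤ P? Q? R? P⊆R xs)
... | yes q | yes _ with P? x
...   | yes p = absurd (npq (p , q))
...   | no _ = s≤s (filter-filter-≤ P? Q? R? P⊆R xs)
filter-filter-< P? Q? R? P⊆R {xs = x ∷ xs} (there z∈) r npq with Q? x
... | no _ with R? x
...   | yes _ = ℕ.m≤n⇒m≤1+n (filter-filter-< P? Q? R? P⊆R z∈ r npq)
...   | no _ = filter-filter-< P? Q? R? P⊆R z∈ r npq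
filter-filter-< P? Q? R? P⊆R {xs = x ∷ xs} (there z∈) r npq | yes _ with P? x | R? x
...   | yes _ | yes _ = s≤s (filter-filter-< P? Q? R? P⊆R z∈ r npq)
...   | yes p | no nr = absurd (nr (P⊆R p))
...   | no _ | yes _ = ℕ.m≤n⇒m≤1+n (filter-filter-< P? Q? R? P⊆R z∈ r npq)
...   | no _ | no _ = filter-filter-< P? Q? R? P⊆R z∈ r npq

fresh₁ : ∀ {m} → 2 ≤ m → ∀ (a : Fin m) → ∃[ b ] b ≢ a
fresh₁ (s≤s (s≤s _)) zero = suc zero , λ ()
fresh₁ (s≤s (s≤s _)) (suc a) = zero , λ ()

fresh₂ : ∀ {m} → 3 ≤ m → ∀ (a b : Fin m) → ∃[ c ] (c ≢ a × c ≢ b)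
fresh₂ (s≤s (s≤s (s≤s _))) zero zero = suc zero , (λ ()) , λ ()
fresh₂ (s≤s (s≤s (s≤s _))) zero (suc zero) = suc (suc zero) , (λ ()) , λ ()
fresh₂ (s≤s (s≤s (s≤s _))) zero (suc (suc b)) = suc zero , (λ ()) , λ ()
fresh₂ (s≤s (s≤s (s≤s _))) (suc zero) zero = suc (suc zero) , (λ ()) , λ ()
fresh₂ (s≤s (s≤s (s≤s _))) (suc (suc a)) zero = suc zero , (λ ()) , λ ()
fresh₂ (s≤s (s≤s (s≤s _))) (suc a) (suc b) = zero , (λ ()) , λ ()

ForbiddenFree : ℕ → ∀ {n} → Matroid n → Set₁
ForbiddenFree q M = ¬ (∃[ m ] Σ (Matroid m) λ N → Forbidden q N × InducedMinor N M)

-- The scalar t ≠ 0, 1 exists because q > 2.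
module Chordal {q} (𝔽 : FiniteField q) {r : ℕ} (t : FiniteField.Carrier 𝔽)
  (t≉0 : ¬ (FiniteField._≈_ 𝔽 t (FiniteField.0# 𝔽)))
  (1-t≉0 : ¬ (FiniteField._≈_ 𝔽 (FiniteField._-_ 𝔽 (FiniteField.1# 𝔽) t) (FiniteField.0# 𝔽))) where
  open Field 𝔽
  open Vectors {r}
  open Linear 𝔽

  module Identities where
    split-sum : ∀ a e x y w → w + - a * e ≈ x + y → w ≈ (a * e + x) + y
    split-sum a e x y w eq = ≈-trans (lem₁ a e w) (≈-trans (+-congʳ eq) (lem₂ a e x y))
      where
      lem₁ : ∀ a e w → w ≈ (w + - a * e) + a * e
      lem₁ = solve 3 (λ a e w → w := (w :+ :- a :* e) :+ a :* e) ≈-refl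
      lem₂ : ∀ a e x y → (x + y) + a * e ≈ (a * e + x) + y
      lem₂ = solve 4 (λ a e x y → (x :+ y) :+ a :* e := (a :* e :+ x) :+ y) ≈-refl

    cancel : ∀ a e x → x ≈ (a * e + x) + - a * e
    cancel = solve 3 (λ a e x → x := (a :* e :+ x) :+ :- a :* e) ≈-refl

    restore : ∀ c e w → (w + - c * e) + c * e ≈ w
    restore = solve 3 (λ c e w → (w :+ :- c :* e) :+ c :* e := w) ≈-refl

    rescale : ∀ {a a′ b b′} c d x y → a * a′ ≈ 1# → b * b′ ≈ 1# → (c * a′) * (a * x) + (d * b′) * (b * y) ≈ c * x + d * y
    rescale {a} {a′} {b} {b′} c d x y aa′ bb′ = +-cong (≈-trans (lem c a′ a x) (*-congˡ (≈-trans (*-congʳ aa′) (*-identityˡ x))))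
                                                       (≈-trans (lem d b′ b y) (*-congˡ (≈-trans (*-congʳ bb′) (*-identityˡ y))))
      where
      lem : ∀ c a′ a x → (c * a′) * (a * x) ≈ c * ((a * a′) * x)
      lem = solve 4 (λ c a′ a x → (c :* a′) :* (a :* x) := c :* ((a :* a′) :* x)) ≈-refl

    skip-middle : ∀ {b} a c x y z → b ≈ 0# → a * x + c * z ≈ a * x + b * y + c * z
    skip-middle a c x y z b≈0 = +-congʳ (≈-trans (≈-sym (+-identityʳ _)) (+-congˡ (≈-sym (≈-trans (*-congʳ b≈0) (zeroˡ y)))))

    plane-sum : ∀ a b c t x y z → 1# * (a * x + (t * b) * y) + 1# * (((1# - t) * b) * y + c * z) ≈ a * x + b * y + c * z
    plane-sum = solve 7 (λ a b c t x y z → :1 :* (a :* x :+ (t :* b) :* y) :+ :1 :* (((:1 :- t) :* b) :* y :+ c :* z)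
                                  := a :* x :+ b :* y :+ c :* z) ≈-refl

    plane-side : ∀ a b c t x y z → ((1# - t) * b * a) * x + (- (t * b) * c) * z
      ≈ ((1# - t) * b) * (a * x + (t * b) * y) + - (t * b) * (((1# - t) * b) * y + c * z)
    plane-side = solve 7 (λ a b c t x y z → ((:1 :- t) :* b :* a) :* x :+ (:- (t :* b) :* c) :* z
                            := ((:1 :- t) :* b) :* (a :* x :+ (t :* b) :* y) :+ :- (t :* b) :* (((:1 :- t) :* b) :* y :+ c :* z)) ≈-refl

    -≈0 : ∀ {a} → - a ≈ 0# → a ≈ 0#
    -≈0 {a} e = ≈-trans (neg-neg a) (≈-trans (-‿cong e) neg-0)
      where
      neg-neg : ∀ a → a ≈ - - a
      neg-neg = solve 1 (λ a → a := :- :- a) ≈-refl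
      neg-0 : - 0# ≈ 0#
      neg-0 = solve 0 (:- :0 := :0) ≈-refl

    shortcut-zero : ∀ t k d u v f → (1# - t) * k ≈ 1# →
      1# * (1# * u + - (t * d * k) * f) + t * ((d + t * d * k) * f + 1# * v) ≈ 1# * u + t * v
    shortcut-zero t k d u v f e = ≈-trans (lem₁ t k d u v f) (≈-trans (+-congʳ (+-congˡ (*-congʳ (*-congˡ (+-congˡ (-‿cong e)))))) (lem₂ t d u v f))
      where
      lem₁ : ∀ t k d u v f → 1# * (1# * u + - (t * d * k) * f) + t * ((d + t * d * k) * f + 1# * v)
        ≈ u + (t * d * (1# + - ((1# - t) * k))) * f + t * v
      lem₁ = solve 6 (λ t k d u v f → :1 :* (:1 :* u :+ :- (t :* d :* k) :* f) :+ t :* ((d :+ t :* d :* k) :* f :+ :1 :* v)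
        := u :+ (t :* d :* (:1 :+ :- ((:1 :- t) :* k))) :* f :+ t :* v) ≈-refl
      lem₂ : ∀ t d u v f → u + (t * d * (1# + - 1#)) * f + t * v ≈ 1# * u + t * v
      lem₂ = solve 5 (λ t d u v f → u :+ (t :* d :* (:1 :+ :- :1)) :* f :+ t :* v := :1 :* u :+ t :* v) ≈-refl

    shortcut-split : ∀ b d u v f → (u + v) + d * f ≈ (1# * u + - b * f) + ((d + b) * f + 1# * v)
    shortcut-split = solve 5 (λ b d u v f → (u :+ v) :+ d :* f := (:1 :* u :+ :- b :* f) :+ ((d :+ b) :* f :+ :1 :* v)) ≈-refl

    shear : ∀ c d b b′ u f → (c + d) * u + (c * b + d * b′) * f ≈ c * (u + b * f) + d * (u + b′ * f)
    shear = solve 6 (λ c d b b′ u f → (c :+ d) :* u :+ (c :* b :+ d :* b′) :* f := c :* (u :+ b :* f) :+ d :* (u :+ b′ :* f)) ≈-refl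

    reduce : ∀ c d u g v → (- c * g + d * v) + c * (u + g) ≈ c * u + d * v
    reduce = solve 5 (λ c d u g v → (:- c :* g :+ d :* v) :+ c :* (u :+ g) := c :* u :+ d :* v) ≈-refl

    corner : ∀ t b c ε u f v g → (b * f + (1# - t) * u + (t * c) * v) + - ε * (u + g)
      ≈ (u + b * f) + t * (g + c * v) + - (t + ε) * (u + g)
    corner = solve 8 (λ t b c ε u f v g → (b :* f :+ (:1 :- t) :* u :+ (t :* c) :* v) :+ :- ε :* (u :+ g)
      := (u :+ b :* f) :+ t :* (g :+ c :* v) :+ :- (t :+ ε) :* (u :+ g)) ≈-refl

    side₁ : ∀ b u f g → 1# * (u + b * f) + - 1# * (u + g) ≈ b * f + - 1# * g
    side₁ = solve 4 (λ b u f g → :1 :* (u :+ b :* f) :+ :- :1 :* (u :+ g) := b :* f :+ :- :1 :* g) ≈-refl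

    side₂ : ∀ c u v g → 1# * (g + c * v) + - 1# * (u + g) ≈ - 1# * u + c * v
    side₂ = solve 4 (λ c u v g → :1 :* (g :+ c :* v) :+ :- :1 :* (u :+ g) := :- :1 :* u :+ c :* v) ≈-refl

    eliminate-f : ∀ t u f y → - t * (u + 1# * f) + 1# * (u + t * f) + 1# * y ≈ (1# - t) * u + 1# * y
    eliminate-f = solve 4 (λ t u f y → :- t :* (u :+ :1 :* f) :+ :1 :* (u :+ t :* f) :+ :1 :* y
      := (:1 :- t) :* u :+ :1 :* y) ≈-refl

    eliminate-g : ∀ t u v g → 1# * u + - 1# * (g + 1# * v) + 1# * (g + t * v) ≈ 1# * u + - (1# - t) * v
    eliminate-g = solve 4 (λ t u v g → :1 :* u :+ :- :1 :* (g :+ :1 :* v) :+ :1 :* (g :+ t :* v)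
      := :1 :* u :+ :- (:1 :- t) :* v) ≈-refl

    opposite : ∀ u v g → (1# * v + - 1# * g) + (u + g) ≈ u + v
    opposite = solve 3 (λ u v g → (:1 :* v :+ :- :1 :* g) :+ (u :+ g) := u :+ v) ≈-refl

    difference : ∀ u e → 1# * (u + e) + - 1# * u ≈ e
    difference = solve 2 (λ u e → :1 :* (u :+ e) :+ :- :1 :* u := e) ≈-refl

    shift-right : ∀ u v e → (u + v) + e ≈ (u + e) + v
    shift-right = solve 3 (λ u v e → (u :+ v) :+ e := (u :+ e) :+ v) ≈-refl

    absorb : ∀ c d u e → (c + d) * u + d * e ≈ c * u + d * (u + e)
    absorb = solve 4 (λ c d u e → (c :+ d) :* u :+ d :* e := c :* u :+ d :* (u :+ e)) ≈-refl

    drop-0 : ∀ {c} w e → c ≈ 0# → w + c * e ≈ w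
    drop-0 w e z = ≈-trans (+-congˡ (≈-trans (*-congʳ z) (zeroˡ e))) (+-identityʳ w)

    1≉0 : ¬ (1# ≈ 0#)
    1≉0 e = 0≉1 (≈-sym e)

    -≉0 : ∀ {a} → ¬ (a ≈ 0#) → ¬ (- a ≈ 0#)
    -≉0 na e = na (-≈0 e)

    isolate : ∀ a p w → 1# * w + - 1# * (w + - a * p) ≈ a * p
    isolate = solve 3 (λ a p w → :1 :* w :+ :- :1 :* (w :+ :- a :* p) := a :* p) ≈-refl

    cancel-left : ∀ a b u v → a ≈ 0# → a * u + b * v ≈ b * v
    cancel-left a b u v z = ≈-trans (+-congʳ (≈-trans (*-congʳ z) (zeroˡ u))) (+-identityˡ _)

    cancel-right : ∀ a b u v → b ≈ 0# → a * u + b * v ≈ a * u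
    cancel-right a b u v z = ≈-trans (+-congˡ (≈-trans (*-congʳ z) (zeroˡ v))) (+-identityʳ _)

    swap-sum : ∀ u v e → (u + v) + e ≈ (v + u) + e
    swap-sum u v e = +-congʳ (+-comm u v)

    compare : ∀ a b u v w → - 1# * (w + - a * u) + 1# * (w + - b * v) ≈ a * u + - b * v
    compare = solve 5 (λ a b u v w → :- :1 :* (w :+ :- a :* u) :+ :1 :* (w :+ :- b :* v) := a :* u :+ :- b :* v) ≈-refl

    negate : ∀ a b u v z → - 1# * (z + - a * u + - b * v) ≈ (a * u + b * v) + - 1# * z
    negate = solve 5 (λ a b u v z → :- :1 :* (z :+ :- a :* u :+ :- b :* v) := (a :* u :+ b :* v) :+ :- :1 :* z) ≈-refl

    drop-first : ∀ a b u v z → a ≈ 0# → z + - a * u + - b * v ≈ z + - b * v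
    drop-first a b u v z e = +-congʳ (drop-0 z u (-‿zero e))

    drop-second : ∀ a b u v z → b ≈ 0# → z + - a * u + - b * v ≈ z + - a * u
    drop-second a b u v z e = drop-0 (z + - a * u) v (-‿zero e)

    solve-third : ∀ a b c u v z → 1# * (a * u + b * v) + - 1# * (a * u + b * v + - c * z) ≈ c * z
    solve-third = solve 6 (λ a b c u v z → :1 :* (a :* u :+ b :* v) :+ :- :1 :* (a :* u :+ b :* v :+ :- c :* z) := c :* z) ≈-refl

    left-part : ∀ a b c d e u v z x y → (a * u + b * v) + - c * (d * u + e * z) ≈ x + y → (a + - (c * d)) * u + (- (c * e)) * z + - 1# * x ≈ y + - b * v
    left-part a b c d e u v z x y h = ≈-trans (lem₁ a b c d e u v z x) (≈-trans (+-congʳ (+-congʳ h)) (lem₂ b v x y))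
      where
      lem₁ : ∀ a b c d e u v z x → (a + - (c * d)) * u + (- (c * e)) * z + - 1# * x ≈ ((a * u + b * v) + - c * (d * u + e * z)) + - 1# * x + - b * v
      lem₁ = solve 9 (λ a b c d e u v z x → (a :+ :- (c :* d)) :* u :+ (:- (c :* e)) :* z :+ :- :1 :* x
        := ((a :* u :+ b :* v) :+ :- c :* (d :* u :+ e :* z)) :+ :- :1 :* x :+ :- b :* v) ≈-refl
      lem₂ : ∀ b v x y → (x + y) + - 1# * x + - b * v ≈ y + - b * v
      lem₂ = solve 4 (λ b v x y → (x :+ y) :+ :- :1 :* x :+ :- b :* v := y :+ :- b :* v) ≈-refl

    collect-left : ∀ k l m u z x → 1# * ((k * u + l * z + - 1# * x) + - m * z) + 1# * x ≈ k * u + (l + - m) * z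
    collect-left = solve 6 (λ k l m u z x → :1 :* ((k :* u :+ l :* z :+ :- :1 :* x) :+ :- m :* z) :+ :1 :* x := k :* u :+ (l :+ :- m) :* z) ≈-refl

    collect-right : ∀ b m v z y → 1# * y + - 1# * ((y + - b * v) + - m * z) ≈ m * z + b * v
    collect-right = solve 5 (λ b m v z y → :1 :* y :+ :- :1 :* ((y :+ :- b :* v) :+ :- m :* z) := m :* z :+ b :* v) ≈-refl

    substitute : ∀ a b c d e u v z → b * e ≈ 1# → (c * z + d * v) + - (c * e) * (a * u + b * z) ≈ (- (c * e * a)) * u + d * v
    substitute a b c d e u v z h = ≈-trans (lem₁ a b c d e u v z) (≈-trans (+-congʳ (+-congˡ (*-congʳ (*-congˡ (+-congˡ (-‿cong h)))))) (lem₂ a c d e u v z))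
      where
      lem₁ : ∀ a b c d e u v z → (c * z + d * v) + - (c * e) * (a * u + b * z) ≈ (- (c * e * a)) * u + (c * (1# + - (b * e))) * z + d * v
      lem₁ = solve 8 (λ a b c d e u v z → (c :* z :+ d :* v) :+ :- (c :* e) :* (a :* u :+ b :* z)
        := (:- (c :* e :* a)) :* u :+ (c :* (:1 :+ :- (b :* e))) :* z :+ d :* v) ≈-refl
      lem₂ : ∀ a c d e u v z → (- (c * e * a)) * u + (c * (1# + - 1#)) * z + d * v ≈ (- (c * e * a)) * u + d * v
      lem₂ = solve 7 (λ a c d e u v z → (:- (c :* e :* a)) :* u :+ (c :* (:1 :+ :- :1)) :* z :+ d :* v := (:- (c :* e :* a)) :* u :+ d :* v) ≈-refl

    difference-right : ∀ x y → 1# * (x + y) + - 1# * x ≈ y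
    difference-right = solve 2 (λ x y → :1 :* (x :+ y) :+ :- :1 :* x := y) ≈-refl

    zero-difference : ∀ {x y} → x + - y ≈ 0# → y ≈ 0# → x ≈ 0#
    zero-difference {x} {y} h k = ≈-trans (≈-sym (≈-trans (+-congˡ (-‿zero k)) (+-identityʳ x))) h

    regroup : ∀ a b u v z → (a * u + b * v) + z ≈ (b * v + a * u) + z
    regroup a b u v z = +-congʳ (+-comm (a * u) (b * v))

    add-to : ∀ a c u z → (1# + a) * u + c * z ≈ u + (a * u + c * z)
    add-to = solve 4 (λ a c u z → (:1 :+ a) :* u :+ c :* z := u :+ (a :* u :+ c :* z)) ≈-refl

    shuffle : ∀ a b c u v z → (a * u + b * v) + c * z ≈ 1# * (a * u + c * z) + b * v
    shuffle = solve 6 (λ a b c u v z → (a :* u :+ b :* v) :+ c :* z := :1 :* (a :* u :+ c :* z) :+ b :* v) ≈-refl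

    third : ∀ a c u z → 1# * (a * u + c * z) + - a * u ≈ c * z
    third = solve 4 (λ a c u z → :1 :* (a :* u :+ c :* z) :+ :- a :* u := c :* z) ≈-refl

    expand : ∀ x y u v z → - 1# * (z + - x * u + - y * v) + 1# * z ≈ x * u + y * v
    expand = solve 5 (λ x y u v z → :- :1 :* (z :+ :- x :* u :+ :- y :* v) :+ :1 :* z := x :* u :+ y :* v) ≈-refl

    drop-both : ∀ x y u v z → x ≈ 0# → y ≈ 0# → z + - x * u + - y * v ≈ z
    drop-both x y u v z ex ey = ≈-trans (drop-second x y u v z ey) (drop-0 z u (-‿zero ex))

    move-left : ∀ a p w x y → w + - a * p ≈ x + y → 1# * (w + - a * p) + - 1# * x ≈ y
    move-left a p w x y h = ≈-trans (+-congʳ (*-congˡ h)) (difference-right x y)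

    isolate-right : ∀ f g a p x y → (f + g) + - a * p ≈ x + y → 1# * x + - 1# * f + a * p ≈ g + - 1# * y
    isolate-right f g a p x y h = ≈-trans (lem₁ f g a p x y) (≈-trans (+-congʳ (+-congˡ (-‿cong h))) (lem₂ g x y))
      where
      lem₁ : ∀ f g a p x y → 1# * x + - 1# * f + a * p ≈ (x + g) + - ((f + g) + - a * p) + 0#
      lem₁ = solve 6 (λ f g a p x y → :1 :* x :+ :- :1 :* f :+ a :* p := (x :+ g) :+ :- ((f :+ g) :+ :- a :* p) :+ :0) ≈-refl
      lem₂ : ∀ g x y → (x + g) + - (x + y) + 0# ≈ g + - 1# * y
      lem₂ = solve 3 (λ g x y → (x :+ g) :+ :- (x :+ y) :+ :0 := g :+ :- :1 :* y) ≈-refl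

    recover : ∀ a b e p w → w + - a * e + - b * p ≈ 0# → a * e + b * p ≈ w
    recover a b e p w h = ≈-trans (lem a b e p w) (≈-trans (+-congˡ (*-congˡ h)) (≈-trans (+-congˡ (zeroʳ _)) (+-identityʳ w)))
      where
      lem : ∀ a b e p w → a * e + b * p ≈ w + - 1# * (w + - a * e + - b * p)
      lem = solve 5 (λ a b e p w → a :* e :+ b :* p := w :+ :- :1 :* (w :+ :- a :* e :+ :- b :* p)) ≈-refl

    recover′ : ∀ a b e p w → w + - a * e + - b * p ≈ 0# → w + - a * e ≈ b * p
    recover′ a b e p w h = ≈-trans (lem a b e p w) (≈-trans (+-congˡ h) (+-identityʳ _))
      where
      lem : ∀ a b e p w → w + - a * e ≈ b * p + (w + - a * e + - b * p)
      lem = solve 5 (λ a b e p w → w :+ :- a :* e := b :* p :+ (w :+ :- a :* e :+ :- b :* p)) ≈-refl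

    transfer : ∀ a b k l u v → (k + (l + - b * v + - a * u)) + b * v ≈ (k + l) + - a * u
    transfer = solve 6 (λ a b k l u v → (k :+ (l :+ :- b :* v :+ :- a :* u)) :+ b :* v := (k :+ l) :+ :- a :* u) ≈-refl

    undo : ∀ g y → 1# * (g + - 1# * y) + 1# * y ≈ g
    undo = solve 2 (λ g y → :1 :* (g :+ :- :1 :* y) :+ :1 :* y := g) ≈-refl

    isolate₂ : ∀ a b c d x y → c * (a * x + b * y) + (a * d + - (c * b)) * y ≈ a * (c * x + d * y)
    isolate₂ = solve 6 (λ a b c d x y → c :* (a :* x :+ b :* y) :+ (a :* d :+ :- (c :* b)) :* y := a :* (c :* x :+ d :* y)) ≈-refl

    coefficients₁ : ∀ k β x y → y + - k * (x + β * y) ≈ - k * x + (1# + - (k * β)) * y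
    coefficients₁ = solve 4 (λ k β x y → y :+ :- k :* (x :+ β :* y) := :- k :* x :+ (:1 :+ :- (k :* β)) :* y) ≈-refl

    coefficients₂ : ∀ k α x y → (x + α * y) + - k * y ≈ 1# * x + (α + - k) * y
    coefficients₂ = solve 4 (λ k α x y → (x :+ α :* y) :+ :- k :* y := :1 :* x :+ (α :+ :- k) :* y) ≈-refl

    coefficients₃ : ∀ k α β x y → (x + α * y) + - k * (x + β * y) ≈ (1# + - k) * x + (α + - (k * β)) * y
    coefficients₃ = solve 5 (λ k α β x y → (x :+ α :* y) :+ :- k :* (x :+ β :* y) := (:1 :+ :- k) :* x :+ (α :+ :- (k :* β)) :* y) ≈-refl

    difference⇒≈ : ∀ {x y} → x + - y ≈ 0# → x ≈ y
    difference⇒≈ {x} {y} h = ≈-trans (lem x y) (≈-trans (+-congʳ h) (+-identityˡ y))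
      where
      lem : ∀ x y → x ≈ (x + - y) + y
      lem = solve 2 (λ x y → x := (x :+ :- y) :+ y) ≈-refl

    on-direction : ∀ w α β ρ x y → β ≈ α * ρ → w + - α * (x + ρ * y) ≈ w + - α * x + - β * y
    on-direction w α β ρ x y h = ≈-trans (lem w α ρ x y) (+-congˡ (*-congʳ (-‿cong (≈-sym h))))
      where
      lem : ∀ w α ρ x y → w + - α * (x + ρ * y) ≈ w + - α * x + - (α * ρ) * y
      lem = solve 5 (λ w α ρ x y → w :+ :- α :* (x :+ ρ :* y) := w :+ :- α :* x :+ :- (α :* ρ) :* y) ≈-refl

    flip : ∀ k d w → w + - 1# * (w + - k * d) ≈ k * d
    flip = solve 3 (λ k d w → w :+ :- :1 :* (w :+ :- k :* d) := k :* d) ≈-refl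

    quotient : ∀ {α k} β → α * k ≈ 1# → β ≈ α * (β * k)
    quotient {α} {k} β h = ≈-sym (≈-trans (lem α β k) (≈-trans (*-congʳ h) (*-identityˡ β)))
      where
      lem : ∀ α β k → α * (β * k) ≈ (α * k) * β
      lem = solve 3 (λ α β k → α :* (β :* k) := (α :* k) :* β) ≈-refl

    remove-e : ∀ x y e → (x + y + e) + - 1# * e ≈ x + y
    remove-e = solve 3 (λ x y e → (x :+ y :+ e) :+ :- :1 :* e := x :+ y) ≈-refl

    along-e : ∀ α γ x y e → 1# * ((1# * x + α * y) + - γ * e) + γ * e ≈ 1# * x + α * y
    along-e = solve 5 (λ α γ x y e → :1 :* ((:1 :* x :+ α :* y) :+ :- γ :* e) :+ γ :* e := :1 :* x :+ α :* y) ≈-refl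

    along-e′ : ∀ α γ x y e → 1# * ((1# * x + α * y) + - γ * e) + (γ + 1#) * e ≈ (1# * x + α * y) + 1# * e
    along-e′ = solve 5 (λ α γ x y e → :1 :* ((:1 :* x :+ α :* y) :+ :- γ :* e) :+ (γ :+ :1) :* e := (:1 :* x :+ α :* y) :+ :1 :* e) ≈-refl

    along-y : ∀ α γ x y e → 1# * ((1# * x + α * y) + - γ * e) + - α * y ≈ 1# * x + - γ * e
    along-y = solve 5 (λ α γ x y e → :1 :* ((:1 :* x :+ α :* y) :+ :- γ :* e) :+ :- α :* y := :1 :* x :+ :- γ :* e) ≈-refl

    along-y′ : ∀ α γ x y e → 1# * ((1# * x + α * y) + - γ * e) + (1# + - α) * y ≈ (x + y) + - γ * e
    along-y′ = solve 5 (λ α γ x y e → :1 :* ((:1 :* x :+ α :* y) :+ :- γ :* e) :+ (:1 :+ :- α) :* y := (x :+ y) :+ :- γ :* e) ≈-refl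

    z-difference : ∀ α β γ δ x y e → 1# * ((1# * x + α * y) + - γ * e) + - 1# * ((1# * x + β * y) + - δ * e) ≈ (α + - β) * y + (δ + - γ) * e
    z-difference = solve 7 (λ α β γ δ x y e → :1 :* ((:1 :* x :+ α :* y) :+ :- γ :* e) :+ :- :1 :* ((:1 :* x :+ β :* y) :+ :- δ :* e)
      := (α :+ :- β) :* y :+ (δ :+ :- γ) :* e) ≈-refl

    z-shift : ∀ α β γ δ x y e → γ ≈ δ → (1# * x + β * y) + - δ * e ≈ 1# * ((1# * x + α * y) + - γ * e) + (β + - α) * y
    z-shift α β γ δ x y e h = ≈-trans (+-congˡ (*-congʳ (-‿cong (≈-sym h)))) (lem α β γ x y e)
      where
      lem : ∀ α β γ x y e → (1# * x + β * y) + - γ * e ≈ 1# * ((1# * x + α * y) + - γ * e) + (β + - α) * y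
      lem = solve 6 (λ α β γ x y e → (:1 :* x :+ β :* y) :+ :- γ :* e := :1 :* ((:1 :* x :+ α :* y) :+ :- γ :* e) :+ (β :+ :- α) :* y) ≈-refl

    combine : ∀ c d k b a → c * (a + - k * b) + (c * k + d) * b ≈ c * a + d * b
    combine = solve 5 (λ c d k b a → c :* (a :+ :- k :* b) :+ (c :* k :+ d) :* b := c :* a :+ d :* b) ≈-refl

    two-terms : ∀ w α β γ x y e → w + - α * x + - β * y + - γ * e ≈ w + - (α * x + β * y + γ * e)
    two-terms = solve 7 (λ w α β γ x y e → w :+ :- α :* x :+ :- β :* y :+ :- γ :* e := w :+ :- (α :* x :+ β :* y :+ γ :* e)) ≈-refl

    minus-minus : ∀ w u → w + - 1# * (w + - u) ≈ u
    minus-minus = solve 2 (λ w u → w :+ :- :1 :* (w :+ :- u) := u) ≈-refl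

    drop-x : ∀ α β γ x y e → α ≈ 0# → α * x + β * y + γ * e ≈ β * y + γ * e
    drop-x α β γ x y e h = +-congʳ (≈-trans (+-congʳ (≈-trans (*-congʳ h) (zeroˡ x))) (+-identityˡ _))

    to-z : ∀ w α β γ δ ρ x y e → β ≈ α * ρ → (w + - α * ((1# * x + ρ * y) + - δ * e)) + - (γ + α * δ) * e ≈ w + - α * x + - β * y + - γ * e
    to-z w α β γ δ ρ x y e h = ≈-trans (lem w α γ δ ρ x y e) (+-congʳ (+-congˡ (*-congʳ (-‿cong (≈-sym h)))))
      where
      lem : ∀ w α γ δ ρ x y e → (w + - α * ((1# * x + ρ * y) + - δ * e)) + - (γ + α * δ) * e ≈ w + - α * x + - (α * ρ) * y + - γ * e
      lem = solve 8 (λ w α γ δ ρ x y e → (w :+ :- α :* ((:1 :* x :+ ρ :* y) :+ :- δ :* e)) :+ :- (γ :+ α :* δ) :* e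
        := w :+ :- α :* x :+ :- (α :* ρ) :* y :+ :- γ :* e) ≈-refl

    residue : ∀ w α z ε e → w + - 1# * ((w + - α * z) + - ε * e) ≈ α * z + ε * e
    residue = solve 5 (λ w α z ε e → w :+ :- :1 :* ((w :+ :- α :* z) :+ :- ε :* e) := α :* z :+ ε :* e) ≈-refl

  open Identities

  infix 4 _⊑_ _∣_
  _⊑_ : List V → List V → Set
  E ⊑ F = ∀ {w} → Span E w → Span F w

  All⇒⊑ : ∀ {E F} → All (Span F) E → E ⊑ F
  All⇒⊑ {E} {F} a = Span-least (Span-subspace F) a

  ∈⇒⊑ : ∀ {E F} → (∀ {e} → e L.∈ E → e L.∈ F) → E ⊑ F
  ∈⇒⊑ h = All⇒⊑ (All.tabulate (λ e∈ → Span-∈ (h e∈)))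

  ∷-⊑ : ∀ {e E F} → Span F e → E ⊑ F → e ∷ E ⊑ F
  ∷-⊑ {F = F} se h = All⇒⊑ (se ∷ All.tabulate (λ e∈ → h (Span-∈ e∈)))

  ∷-mono : ∀ {e E F} → E ⊑ F → e ∷ E ⊑ e ∷ F
  ∷-mono h (a ◂ s) = a ◂ h s

  swap-⊑ : ∀ {d e E} → d ∷ e ∷ E ⊑ e ∷ d ∷ E
  swap-⊑ = ∈⇒⊑ λ { (here p) → there (here p) ; (there (here p)) → here p ; (there (there p)) → there (there p) }

  ++-split : ∀ E {F w} → Span (E ++ F) w → ∃[ x ] ∃[ y ] (Span E x × Span F y × w ≋ x ⊹ y)
  ++-split [] {w = w} s = 𝟘 , w , null (λ _ → ≈-refl) , s , λ j → ≈-sym (+-identityˡ _)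
  ++-split (e ∷ E) {w = w} (a ◂ s) with ++-split E s
  ... | x , y , sx , sy , eq = a · e ⊹ x , y
      , (a ◂ Sp.resp E (λ j → cancel a (e j) (x j)) sx) , sy
      , λ j → split-sum a (e j) (x j) (y j) (w j) (eq j)

  ++-⊑ˡ : ∀ {E F} → E ⊑ E ++ F
  ++-⊑ˡ {E} = ∈⇒⊑ ∈-++⁺ˡ

  ++-⊑ʳ : ∀ E {F} → F ⊑ E ++ F
  ++-⊑ʳ E = ∈⇒⊑ (∈-++⁺ʳ E)

  ++-⊑ : ∀ {E F H} → E ⊑ H → F ⊑ H → E ++ F ⊑ H
  ++-⊑ {E} h k = All⇒⊑ (All.tabulate λ e∈ → [ (λ p → h (Span-∈ p)) , (λ p → k (Span-∈ p)) ]′ (∈-++⁻ E e∈))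

  Independent₂ : List V → V → V → Set
  Independent₂ W u v = ∀ a b → Span W (a · u ⊹ b · v) → a ≈ 0# × b ≈ 0#

  -- The points pts, up to scalars, of the contraction by W, seen as vectors modulo W.
  _∣_ : List V → List V → V → Set
  (pts ∣ W) w = Any.Any (λ p → Span (p ∷ W) w) pts

  _⊂_ : List V → List V → Set
  W ⊂ pts = All (L._∈ pts) W

  module Pt (pts W : List V) where
    resp : ∀ {u w} → u ≋ w → (pts ∣ W) u → (pts ∣ W) w
    resp e = Any.map λ {p} → Sp.resp (p ∷ W) e

    scale : ∀ {w} a → (pts ∣ W) w → (pts ∣ W) (a · w)
    scale a = Any.map λ {p} → Sp.scale (p ∷ W) a

    point? : ∀ w → Dec ((pts ∣ W) w)
    point? w = Any.any? (λ p → Span? (p ∷ W) w) pts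

    point∈ : ∀ {p} → p L.∈ pts → (pts ∣ W) p
    point∈ p∈ = lose p∈ (Span-here W)

    plus-W : ∀ {u w} → Span W w → (pts ∣ W) u → (pts ∣ W) (u ⊹ w)
    plus-W s = Any.map λ {p} su → Sp.add (p ∷ W) su (Span-there s)

    divide : ∀ {a w} → ¬ (a ≈ 0#) → (pts ∣ W) (a · w) → (pts ∣ W) w
    divide na = Any.map λ {p} → Sp.divide (p ∷ W) na

  mono : ∀ {pts pts′ W W′ w} → (∀ {p} → p L.∈ pts → p L.∈ pts′) → W ⊑ W′ → (pts ∣ W) w → (pts′ ∣ W′) w
  mono h k c with find c
  ... | p , p∈ , s = lose (h p∈) (∷-mono k s)

  uncontract : ∀ {pts e W w} → (pts ∣ e ∷ W) w → ∃[ c ] (pts ∣ W) (w ⊹ - c · e)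
  uncontract {pts} {e} {W} {w} c = let p , p∈ , s = find c in go p∈ (swap-⊑ s)
    where
    go : ∀ {p} → p L.∈ pts → Span (e ∷ p ∷ W) w → ∃[ c ] (pts ∣ W) (w ⊹ - c · e)
    go p∈ (c ◂ s) = c , lose p∈ s

  record LineClosed (pts : List V) : Set where
    field
      𝟘∈   : 𝟘 L.∈ pts
      line : ∀ {W x y} → W ⊂ pts → (pts ∣ W) x → (pts ∣ W) y → (pts ∣ W) (x ⊹ y) → ∀ c d → (pts ∣ W) (c · x ⊹ d · y)

  record Good (pts : List V) : Set where
    field
      lineClosed : LineClosed pts
      quad : ∀ {W x y z} → W ⊂ pts → (pts ∣ W) x → (pts ∣ W) y → (pts ∣ W) z → (pts ∣ W) (x ⊹ y ⊹ z) →
             (pts ∣ W) (x ⊹ y) ⊎ (pts ∣ W) (x ⊹ z) ⊎ (pts ∣ W) (y ⊹ z)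

    open LineClosed lineClosed public

  module Mod {pts W} (lineClosed : LineClosed pts) (W⊂ : W ⊂ pts) where
    open LineClosed lineClosed
    open Pt pts W public

    Point : V → Set
    Point = pts ∣ W

    Adjacent : V → V → Set
    Adjacent x y = ∀ c d → Point (c · x ⊹ d · y)

    span⇒point : ∀ {w} → Span W w → Point w
    span⇒point s = resp (λ j → +-identityˡ _) (plus-W s (point∈ 𝟘∈))

    adjacent : ∀ {x y a b} → Point x → Point y → ¬ (a ≈ 0#) → ¬ (b ≈ 0#) → Point (a · x ⊹ b · y) → Adjacent x y
    adjacent {x} {y} {a} {b} px py na nb h c d with inverse a na | inverse b nb
    ... | a′ , aa′ | b′ , bb′ = resp
        (λ j → rescale c d (x j) (y j) aa′ bb′)
        (line W⊂ (scale a px) (scale b py) h (c * a′) (d * b′))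

    adjacent₁ : ∀ {x y} → Point x → Point y → Point (x ⊹ y) → Adjacent x y
    adjacent₁ px py h = line W⊂ px py h

    adjacent-sum : ∀ {x y} → Adjacent x y → Point (x ⊹ y)
    adjacent-sum {x} {y} A = resp (λ j → +-cong (*-identityˡ _) (*-identityˡ _)) (A 1# 1#)

    adjacent-sym : ∀ {x y} → Adjacent x y → Adjacent y x
    adjacent-sym {x} {y} A c d = resp (λ j → +-comm (d * x j) (c * y j)) (A d c)

    plane : ∀ {x y z} → Adjacent x y → Adjacent y z → Adjacent x z → ∀ a b c → Point (a · x ⊹ b · y ⊹ c · z)
    plane {x} {y} {z} xy yz xz a b c with b ≟ᶠ 0#
    ... | yes b≈0 = resp (λ j → skip-middle a c (x j) (y j) (z j) b≈0) (xz a c)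
    ... | no nb = resp (λ j → plane-sum a b c t (x j) (y j) (z j))
        (adjacent (xy a (t * b)) (yz ((1# - t) * b) c) (nb ∘ *-cancel-0 1-t≉0) (λ e → nb (*-cancel-0 t≉0 (-≈0 e)))
          (resp (λ j → plane-side a b c t (x j) (y j) (z j)) (xz ((1# - t) * b * a) (- (t * b) * c))) 1# 1#)

    shortcut : ∀ {u v f} → Point u → Point v → Adjacent u f → Adjacent f v → ∀ d → Point (u ⊹ v ⊹ d · f) → Point (u ⊹ v)
    shortcut {u} {v} {f} pu pv uf fv d h = adjacent-sum (adjacent pu pv 1≉0 t≉0
        (resp (λ j → shortcut-zero t k d (u j) (v j) (f j) (proj₂ k⁻¹))
          (adjacent₁ (uf 1# (- (t * d * k))) (fv (d + t * d * k) 1#)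
            (resp (λ j → shortcut-split (t * d * k) d (u j) (v j) (f j)) h) 1# t)))
      where
      k⁻¹ = inverse (1# - t) 1-t≉0
      k = proj₁ k⁻¹

    adjacent-absorb : ∀ {u e} → Adjacent u e → Adjacent u (u ⊹ e)
    adjacent-absorb {u} {e} ue c d = resp (λ j → absorb c d (u j) (e j)) (ue (c + d) d)

    detour : ∀ {u v e} → Point u → Point v → Point e → ¬ Span (u ∷ W) e → ¬ Point (u ⊹ v) → Point (u ⊹ v ⊹ e) → Point (u ⊹ e) →
      ∃[ p ] (p L.∈ pts × Span (u ∷ p ∷ W) e × ¬ (pts ∣ p ∷ W) (u ⊹ v))
    detour {u} {v} {e} pu pv pe ne nuv h ue with find ue
    ... | p , p∈ , s = p , p∈ , e∈ , apart
      where
      e∈ : Span (u ∷ p ∷ W) e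
      e∈ = Sp.resp (u ∷ p ∷ W) (λ j → difference (u j) (e j)) (Sp.comb (u ∷ p ∷ W) 1# (- 1#) (Span-there s) (Span-here (p ∷ W)))
      f∉ : ¬ Span W (u ⊹ e)
      f∉ sf = ne (Sp.resp (u ∷ W) (λ j → difference (u j) (e j)) (Sp.comb (u ∷ W) 1# (- 1#) (Span-there sf) (Span-here W)))
      pW : p ∷ W ⊑ (u ⊹ e) ∷ W
      pW = ∷-⊑ (Span-exchange s f∉) Span-there
      fv : Adjacent (u ⊹ e) v
      fv = adjacent₁ ue pv (resp (λ j → shift-right (u j) (v j) (e j)) h)
      apart : ¬ (pts ∣ p ∷ W) (u ⊹ v)
      apart h′ = let c , h″ = uncontract (mono {W = p ∷ W} {(u ⊹ e) ∷ W} id pW h′)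
                 in nuv (shortcut pu pv (adjacent-absorb (adjacent₁ pu pe ue)) fv (- c) h″)

  module _ {pts W} (good : Good pts) (W⊂ : W ⊂ pts) where
    open Good good
    open Mod lineClosed W⊂

    cycle : ∀ {u f v g} → Point u → Point f → Point v → Point g →
      Adjacent u f → Adjacent f v → Adjacent v g → Adjacent g u → Point (u ⊹ v) ⊎ Point (f ⊹ g)
    cycle {u} {f} {v} {g} pu pf pv pg uf fv vg gu = go (Span? W w)
      where
      w = u ⊹ g
      pw : Point w
      pw = adjacent-sum (adjacent-sym gu)

      adjacent-shear : ∀ {x y} → Adjacent x y → ∀ b b′ → Adjacent (x ⊹ b · y) (x ⊹ b′ · y)
      adjacent-shear {x} {y} xy b b′ c d = resp (λ j → shear c d b b′ (x j) (y j)) (xy (c + d) (c * b + d * b′))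

      point₁ : ∀ {x y} → Adjacent x y → ∀ b → Point (x ⊹ b · y)
      point₁ xy b = resp (λ j → +-congʳ (*-identityˡ _)) (xy 1# b)

      Goal : Set
      Goal = Point (u ⊹ v) ⊎ Point (f ⊹ g)

      edge : ¬ Span W w → ∀ b c → ¬ (b ≈ 0#) → ¬ (c ≈ 0#) → Goal ⊎ Adjacent (u ⊹ b · f) (g ⊹ c · v)
      edge nw b c nb nc = finish (uncontract {e = w} (mono {W = p ∷ W} {w ∷ W} id (∷-⊑ (Span-exchange s nw) Span-there)
            (plane′ b (1# - t) (t * c))))
        where
        p = proj₁ (find pw)
        p∈ = proj₁ (proj₂ (find pw))
        s = proj₂ (proj₂ (find pw))
        module M′ = Mod lineClosed (p∈ ∷ W⊂)
        up : ∀ {x} → Point x → M′.Point x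
        up = mono id Span-there
        plane′ : ∀ a b c → M′.Point (a · f ⊹ b · u ⊹ c · v)
        plane′ = M′.plane (λ c d → up (adjacent-sym uf c d))
          (λ c d → M′.resp (λ j → reduce c d (u j) (g j) (v j))
             (M′.plus-W {u = - c · g ⊹ d · v} {c · w} (Sp.scale (p ∷ W) c s) (up (adjacent-sym vg (- c) d))))
          (λ c d → up (fv c d))
        pu′ = point₁ uf b
        pv′ = point₁ (adjacent-sym vg) c
        finish : ∃[ ε ] Point ((b · f ⊹ (1# - t) · u ⊹ (t * c) · v) ⊹ - ε · w) → Goal ⊎ Adjacent (u ⊹ b · f) (g ⊹ c · v)
        finish (ε , h) = corner-case (t + ε ≟ᶠ 0#) (resp (λ j → corner t b c ε (u j) (f j) (v j) (g j)) h)
          where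
          join : Point (u ⊹ b · f ⊹ t · (g ⊹ c · v)) → Adjacent (u ⊹ b · f) (g ⊹ c · v)
          join h = adjacent pu′ pv′ 1≉0 t≉0 (resp (λ j → +-congʳ (≈-sym (*-identityˡ _))) h)
          corner-case : Dec (t + ε ≈ 0#) → Point (u ⊹ b · f ⊹ t · (g ⊹ c · v) ⊹ - (t + ε) · w) → Goal ⊎ Adjacent (u ⊹ b · f) (g ⊹ c · v)
          corner-case (yes z) h = inj₂ (join (resp (λ j → drop-0 _ (w j) (-‿zero z)) h))
          corner-case (no nz) h =
            [ inj₂ ∘ join
            , [ (λ h₂ → inj₁ (inj₂ (adjacent-sum (adjacent pf pg nb (-≉0 1≉0)
                  (resp (λ j → side₁ b (u j) (f j) (g j))
                    (adjacent pu′ pw 1≉0 (-≉0 nz) (resp (λ j → +-congʳ (≈-sym (*-identityˡ _))) h₂) 1# (- 1#)))))))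
              , (λ h₃ → inj₁ (inj₁ (adjacent-sum (adjacent pu pv (-≉0 1≉0) nc
                  (resp (λ j → side₂ c (u j) (v j) (g j)) (adjacent pv′ pw t≉0 (-≉0 nz) h₃ 1# (- 1#)))))))
              ]′ ]′ (quad {x = u ⊹ b · f} {t · (g ⊹ c · v)} {z = - (t + ε) · w} W⊂ pu′ (scale t pv′) (scale (- (t + ε)) pw) h)

      row : ¬ Span W w → ∀ c → ¬ (c ≈ 0#) → Goal ⊎ Adjacent u (g ⊹ c · v)
      row nw c nc = [ inj₁ , (λ a₁ → [ inj₁ , (λ a₂ → inj₂ (adjacent pu (point₁ (adjacent-sym vg) c) 1-t≉0 1≉0
            (resp (λ j → eliminate-f t (u j) (f j) (g j + c * v j)) (plane (adjacent-shear uf 1# t) a₂ a₁ (- t) 1# 1#)))) ]′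
          (edge nw t c t≉0 nc)) ]′ (edge nw 1# c 1≉0 nc)

      go : Dec (Span W w) → Goal
      go (yes s) = inj₁ (resp (λ j → opposite (u j) (v j) (g j)) (plus-W {u = 1# · v ⊹ - 1# · g} s (vg 1# (- 1#))))
      go (no nw) = [ id , (λ a₁ → [ id , (λ a₂ → inj₁ (adjacent-sum (adjacent pu pv 1≉0 (-≉0 1-t≉0)
            (resp (λ j → eliminate-g t (u j) (v j) (g j)) (plane a₁ (adjacent-shear (adjacent-sym vg) 1# t) a₂ 1# (- 1#) 1#))))) ]′
          (row nw t t≉0)) ]′ (row nw 1# 1≉0)

  restrict : List V → List V → List V
  restrict A = filter (Span? A)

  ∈-restrict⁻ : ∀ {A pts p} → p L.∈ restrict A pts → p L.∈ pts × Span A p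
  ∈-restrict⁻ {A} {pts} = ∈-filter⁻ (Span? A) {xs = pts}

  ∈-restrict⁺ : ∀ {A pts p} → p L.∈ pts → Span A p → p L.∈ restrict A pts
  ∈-restrict⁺ {A} = ∈-filter⁺ (Span? A)

  ⊂⇒⊑ : ∀ {W A pts} → W ⊂ restrict A pts → W ⊑ A
  ⊂⇒⊑ {A = A} {pts} W⊂ = All⇒⊑ (All.map (λ p∈ → proj₂ (∈-restrict⁻ {A} {pts} p∈)) W⊂)

  ⊂-restrict⁻ : ∀ {W A pts} → W ⊂ restrict A pts → W ⊂ pts
  ⊂-restrict⁻ {A = A} {pts} = All.map (λ p∈ → proj₁ (∈-restrict⁻ {A} {pts} p∈))

  point-restrict⁻ : ∀ {A pts W w} → W ⊂ restrict A pts → (restrict A pts ∣ W) w → (pts ∣ W) w × Span A w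
  point-restrict⁻ {A} {pts} W⊂ h with find h
  ... | p , p∈ , s with ∈-restrict⁻ {A} {pts} p∈
  ...   | p∈pts , p∈A = lose p∈pts s , ∷-⊑ p∈A (⊂⇒⊑ {A = A} {pts} W⊂) s

  point-restrict⁺ : ∀ {A pts W w} → 𝟘 L.∈ pts → W ⊑ A → (pts ∣ W) w → Span A w → (restrict A pts ∣ W) w
  point-restrict⁺ {A} {pts} {W} {w} 𝟘∈ W⊑A h w∈A = let p , p∈ , s = find h in go p∈ s
    where
    go : ∀ {p} → p L.∈ pts → Span (p ∷ W) w → (restrict A pts ∣ W) w
    go {p} p∈ (a ◂ s) = go′ (a ≟ᶠ 0#)
      where
      go′ : Dec (a ≈ 0#) → (restrict A pts ∣ W) w
      go′ (yes z) = lose (∈-restrict⁺ 𝟘∈ (Sp.zero∈ A)) (Span-there (Sp.resp W (λ j → drop-0 (w j) (p j) (-‿zero z)) s))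
      go′ (no na) = lose (∈-restrict⁺ p∈ (Sp.divide A na (Sp.resp A (λ j → isolate a (p j) (w j)) (Sp.comb A 1# (- 1#) w∈A (W⊑A s))))) (a ◂ s)

  restrict-good : ∀ {A pts} → Good pts → Good (restrict A pts)
  restrict-good {A} {pts} good = record
    { lineClosed = record { 𝟘∈ = ∈-restrict⁺ 𝟘∈ (Sp.zero∈ A) ; line = λ W⊂ px py pxy c d →
        let x , xA = lower W⊂ px
            y , yA = lower W⊂ py
        in raise W⊂ (line (⊂-restrict⁻ {A = A} {pts} W⊂) x y (proj₁ (lower W⊂ pxy)) c d) (Sp.comb A c d xA yA) }
    ; quad = λ W⊂ px py pz h →
        let x , xA = lower W⊂ px
            y , yA = lower W⊂ py
            z , zA = lower W⊂ pz
        in [ (λ k → inj₁ (raise W⊂ k (Sp.add A xA yA)))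
           , [ (λ k → inj₂ (inj₁ (raise W⊂ k (Sp.add A xA zA)))) , (λ k → inj₂ (inj₂ (raise W⊂ k (Sp.add A yA zA)))) ]′ ]′
           (quad (⊂-restrict⁻ {A = A} {pts} W⊂) x y z (proj₁ (lower W⊂ h)))
    }
    where
    open Good good
    lower : ∀ {W w} → W ⊂ restrict A pts → (restrict A pts ∣ W) w → (pts ∣ W) w × Span A w
    lower = point-restrict⁻ {A} {pts}
    raise : ∀ {W w} → W ⊂ restrict A pts → (pts ∣ W) w → Span A w → (restrict A pts ∣ W) w
    raise W⊂ = point-restrict⁺ {A} {pts} 𝟘∈ (⊂⇒⊑ {A = A} {pts} W⊂)

  independent-mono : ∀ {W W′ u v} → W ⊑ W′ → Independent₂ W′ u v → Independent₂ W u v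
  independent-mono h ind a b s = ind a b (h s)

  independent-∉ : ∀ {W u v} → Independent₂ W u v → ¬ Span (v ∷ W) u
  independent-∉ {W} {u} {v} ind (c ◂ s) = 1≉0 (proj₁ (ind 1# (- c) (Sp.resp W (λ j → +-congʳ (≈-sym (*-identityˡ _))) s)))

  independent-sym : ∀ {W u v} → Independent₂ W u v → Independent₂ W v u
  independent-sym {W} {u} {v} ind a b s = let x , y = ind b a (Sp.resp W (λ j → +-comm (a * v j) (b * u j)) s) in y , x

  apart⇒independent : ∀ {pts W u v} → LineClosed pts → W ⊂ pts → (pts ∣ W) u → (pts ∣ W) v → ¬ (pts ∣ W) (u ⊹ v) → Independent₂ W u v
  apart⇒independent {pts} {W} {u} {v} lineClosed W⊂ pu pv nuv a b s = go (a ≟ᶠ 0#) (b ≟ᶠ 0#)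
    where
    open Mod lineClosed W⊂
    go : Dec (a ≈ 0#) → Dec (b ≈ 0#) → a ≈ 0# × b ≈ 0#
    go (yes x) (yes y) = x , y
    go (no x) (no y) = absurd (nuv (adjacent-sum (adjacent pu pv x y (span⇒point s))))
    go (yes x) (no y) = absurd (nuv (plus-W (Sp.divide W y (Sp.resp W (λ j → cancel-left a b (u j) (v j) x) s)) pu))
    go (no x) (yes y) = absurd (nuv (resp (λ j → +-comm (v j) (u j)) (plus-W (Sp.divide W x (Sp.resp W (λ j → cancel-right a b (u j) (v j) y) s)) pv)))

  module _ {pts} (good : Good pts) where
    open Good good

    record Separator (zs : List V) (W : List V) (u v : V) : Set where
      constructor separator
      field
        {W′}   : List V
        W′⊂    : W′ ⊂ pts
        W⊑W′   : W ⊑ W′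
        apart  : ¬ (pts ∣ W′) (u ⊹ v)
        covers : ∀ {p} → p L.∈ zs → Span (u ∷ W′) p ⊎ Span (v ∷ W′) p

    separator-sym : ∀ {zs W u v} → Separator zs W u v → Separator zs W v u
    separator-sym {u = u} {v} (separator {W′} a b c d) = separator a b
      (c ∘ Pt.resp pts W′ (λ j → +-comm (v j) (u j))) ([ inj₂ , inj₁ ]′ ∘ d)

    private
      via : ∀ {W u v e} → W ⊂ pts → (pts ∣ W) u → (pts ∣ W) v → ∀ {z} → z L.∈ pts → ∀ {c} → e ≡ - c · z → ¬ Span (u ∷ W) z →
        ¬ (pts ∣ W) (u ⊹ v) → (pts ∣ W) (u ⊹ v ⊹ e) → (pts ∣ W) (u ⊹ e) → Separator (z ∷ []) W u v
      via {W} {u} {v} {e} W⊂ pu pv {z} z∈ {c} ≡.refl nz nuv h ue = finish (detour pu pv (scale (- c) (point∈ z∈)) (nz ∘ Sp.divide (u ∷ W) (-≉0 nc)) nuv h ue)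
        where
        open Mod (Good.lineClosed good) W⊂
        nc : ¬ (c ≈ 0#)
        nc x = nuv (resp (λ j → drop-0 (u j + v j) (z j) (-‿zero x)) h)
        finish : ∃[ p ] (p L.∈ pts × Span (u ∷ p ∷ W) e × ¬ (pts ∣ p ∷ W) (u ⊹ v)) → Separator (z ∷ []) W u v
        finish (p , p∈ , s , ap) = separator (p∈ ∷ W⊂) Span-there ap λ { (here ≡.refl) → inj₁ (Sp.divide (u ∷ p ∷ W) (-≉0 nc) s) }

    separate-one : ∀ {W u v z} → z L.∈ pts → W ⊂ pts → (pts ∣ W) u → (pts ∣ W) v → ¬ (pts ∣ W) (u ⊹ v) → Separator (z ∷ []) W u v
    separate-one {W} {u} {v} {z} z∈ W⊂ pu pv nuv = go (Span? (u ∷ W) z) (Span? (v ∷ W) z) (Pt.point? pts (z ∷ W) (u ⊹ v))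
      where
      open Mod (Good.lineClosed good) W⊂
      go : Dec (Span (u ∷ W) z) → Dec (Span (v ∷ W) z) → Dec ((pts ∣ z ∷ W) (u ⊹ v)) → Separator (z ∷ []) W u v
      go (yes s) _ _ = separator W⊂ id nuv λ { (here ≡.refl) → inj₁ s }
      go (no _) (yes s) _ = separator W⊂ id nuv λ { (here ≡.refl) → inj₂ s }
      go (no nu) (no nv) (no ap) = separator (z∈ ∷ W⊂) Span-there ap λ { (here ≡.refl) → inj₁ (Span-there (Span-here W)) }
      go (no nu) (no nv) (yes h) = let c , h′ = uncontract h in use c h′
        where
        use : ∀ c → (pts ∣ W) (u ⊹ v ⊹ - c · z) → Separator (z ∷ []) W u v
        use c h′ = [ absurd ∘ nuv
          , [ via W⊂ pu pv z∈ {c} ≡.refl nu nuv h′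
            , (λ ve → separator-sym (via W⊂ pv pu z∈ {c} ≡.refl nv (nuv ∘ resp (λ j → +-comm (v j) (u j)))
                 (resp (λ j → swap-sum (u j) (v j) (- c * z j)) h′) ve)) ]′ ]′
          (quad {x = u} {v} {z = - c · z} W⊂ pu pv (scale (- c) (point∈ z∈)) h′)

    separate : ∀ zs → zs ⊂ pts → ∀ {W u v} → W ⊂ pts → (pts ∣ W) u → (pts ∣ W) v → ¬ (pts ∣ W) (u ⊹ v) → Separator zs W u v
    separate [] _ W⊂ pu pv nuv = separator W⊂ id nuv λ ()
    separate (z ∷ zs) (z∈ ∷ zs⊂) {W} {u} {v} W⊂ pu pv nuv = let S₁ = separate-one z∈ W⊂ pu pv nuv in
        join S₁ (separate zs zs⊂ (W′⊂ S₁) (mono id (W⊑W′ S₁) pu) (mono id (W⊑W′ S₁) pv) (apart S₁))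
      where
      open Separator
      join : (S₁ : Separator (z ∷ []) W u v) → Separator zs (Separator.W′ S₁) u v → Separator (z ∷ zs) W u v
      join S₁ S₂ = separator (W′⊂ S₂) (W⊑W′ S₂ ∘ W⊑W′ S₁) (apart S₂) λ where
        (here ≡.refl) → [ inj₁ ∘ ∷-mono (W⊑W′ S₂) , inj₂ ∘ ∷-mono (W⊑W′ S₂) ]′ (covers S₁ (here ≡.refl))
        (there p∈) → covers S₂ p∈

  *≉0 : ∀ {a b} → ¬ (a ≈ 0#) → ¬ (b ≈ 0#) → ¬ (a * b ≈ 0#)
  *≉0 na nb e = nb (*-cancel-0 na e)

  inverse≉0 : ∀ {a b} → a * b ≈ 1# → ¬ (b ≈ 0#)
  inverse≉0 e z = 1≉0 (≈-trans (≈-sym e) (≈-trans (*-congˡ z) (zeroʳ _)))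

  -- u and v lie in different components of the contraction by G.
  record Split (pts G : List V) (u v : V) : Set where
    constructor splitting
    field
      A B    : List V
      A⊑     : A ⊑ pts ++ G
      B⊑     : B ⊑ pts ++ G
      u∈A    : Span A u
      v∈B    : Span B v
      G⊑A    : G ⊑ A
      G⊑B    : G ⊑ B
      covers : ∀ {p} → p L.∈ pts → Span A p ⊎ Span B p
      meet   : ∀ {w} → Span A w → Span B w → Span G w

  -- u and v lie in a common component: contracting further points makes them adjacent.
  record Join (pts G : List V) (u v : V) : Set where
    constructor joining
    field
      Z     : List V
      Z⊂    : Z ⊂ pts
      ind   : Independent₂ (Z ++ G) u v
      a b   : Carrier
      a≉0   : ¬ (a ≈ 0#)
      b≉0   : ¬ (b ≈ 0#)
      point : (pts ∣ Z ++ G) (a · u ⊹ b · v)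

  private
    measure : List V → List V → ℕ
    measure G pts = length (filter (λ p → ¬? (Span? G p)) pts)

    measure-restrict : ∀ {G A pts v} → v L.∈ pts → ¬ Span A v → G ⊑ A → measure G (restrict A pts) < measure G pts
    measure-restrict {G} {A} {pts} v∈ nv G⊑A = filter-filter-< (λ p → ¬? (Span? G p)) (Span? A) (λ p → ¬? (Span? G p)) id v∈ (nv ∘ G⊑A) (nv ∘ proj₂)

    measure-contract : ∀ {G pts z} → z L.∈ pts → ¬ Span G z → measure (z ∷ G) pts < measure G pts
    measure-contract {G} {pts} {z} z∈ nz = subst (λ xs → length (filter (λ p → ¬? (Span? (z ∷ G) p)) xs) < measure G pts)
      (filter-all (λ _ → yes tt) {xs = pts} (All.tabulate (λ _ → tt)))
      (filter-filter-< (λ p → ¬? (Span? (z ∷ G) p)) (λ _ → yes tt) (λ p → ¬? (Span? G p)) (λ n s → n (Span-there s)) z∈ nz (λ (n , _) → n (Span-here G)))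

    mono-point : ∀ {pts pts′ W W′ w} → (∀ {p} → p L.∈ pts → p L.∈ pts′) → W ⊑ W′ → (pts ∣ W) w → (pts′ ∣ W′) w
    mono-point {W = W} {W′} = mono {W = W} {W′}

  join-trans : ∀ {pts G A B u v z} → u L.∈ pts → G ⊑ A → G ⊑ B → (∀ {w} → Span A w → Span B w → Span (z ∷ G) w) →
    Span A u → Span A z → Span B z → Span B v →
    Join (restrict A pts) G u z → Join (restrict B pts) G z v → Join pts G u v
  join-trans {pts} {G} {A} {B} {u} {v} {z} u∈ G⊑A G⊑B meet uA zA zB vB
      (joining Z₁ Z₁⊂ ind₁ a b na nb h₁) (joining Z₂ Z₂⊂ ind₂ c d nc nd h₂) =
    joining (p ∷ Z₁ ++ Z₂) (p∈ ∷ All.++⁺ (⊂-restrict⁻ {A = A} {pts} Z₁⊂) (⊂-restrict⁻ {A = B} {pts} Z₂⊂))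
      ind (- (c * e * a)) d (-≉0 (*≉0 (*≉0 nc (inverse≉0 be)) na)) nd final
    where
    w₀ = a · u ⊹ b · z
    found = find h₁
    p = proj₁ found
    p∈ : p L.∈ pts
    p∈ = proj₁ (∈-restrict⁻ {A} {pts} (proj₁ (proj₂ found)))
    s₀ : Span (p ∷ Z₁ ++ G) w₀
    s₀ = proj₂ (proj₂ found)
    e = proj₁ (inverse b nb)
    be = proj₂ (inverse b nb)
    Z₁A : Z₁ ++ G ⊑ A
    Z₁A = ++-⊑ {Z₁} (⊂⇒⊑ {A = A} {pts} Z₁⊂) G⊑A
    Z₂B : Z₂ ++ G ⊑ B
    Z₂B = ++-⊑ {Z₂} (⊂⇒⊑ {A = B} {pts} Z₂⊂) G⊑B
    W = p ∷ (Z₁ ++ Z₂) ++ G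
    Z₁W : Z₁ ++ G ⊑ (Z₁ ++ Z₂) ++ G
    Z₁W = ++-⊑ {Z₁} (λ s → ++-⊑ˡ {Z₁ ++ Z₂} (++-⊑ˡ {Z₁} s)) (++-⊑ʳ (Z₁ ++ Z₂))
    Z₂W : Z₂ ++ G ⊑ (Z₁ ++ Z₂) ++ G
    Z₂W = ++-⊑ {Z₂} (λ s → ++-⊑ˡ {Z₁ ++ Z₂} (++-⊑ʳ Z₁ s)) (++-⊑ʳ (Z₁ ++ Z₂))
    w₀∉ : ¬ Span (Z₁ ++ G) w₀
    w₀∉ s = na (proj₁ (ind₁ a b s))
    W⊑ : W ⊑ w₀ ∷ Z₁ ++ (Z₂ ++ G)
    W⊑ = ∷-⊑ (∷-mono (++-⊑ {Z₁} (++-⊑ˡ {Z₁}) (λ s → ++-⊑ʳ Z₁ (++-⊑ʳ Z₂ s))) (Span-exchange s₀ w₀∉))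
             (λ s → Span-there (subst (λ H → Span H _) (++-assoc Z₁ Z₂ G) s))
    ind : Independent₂ W u v
    ind x y s = go (W⊑ s)
      where
      go : Span (w₀ ∷ Z₁ ++ (Z₂ ++ G)) (x · u ⊹ y · v) → x ≈ 0# × y ≈ 0#
      go (k ◂ s′) = let x₁ , y₁ , sx , sy , eq = ++-split Z₁ s′ in fin x₁ y₁ (++-⊑ˡ {Z₁} sx) sy eq
        where
        fin : ∀ x₁ y₁ → Span (Z₁ ++ G) x₁ → Span (Z₂ ++ G) y₁ → (x · u ⊹ y · v) ⊹ - k · w₀ ≋ x₁ ⊹ y₁ → x ≈ 0# × y ≈ 0#
        fin x₁ y₁ sx sy eq = fin′ (meet leftA (Sp.resp B (λ j → ≈-sym (eq′ j)) rightB))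
          where
          left right : V
          left = (x + - (k * a)) · u ⊹ (- (k * b)) · z ⊹ - 1# · x₁
          right = y₁ ⊹ - y · v
          eq′ : left ≋ right
          eq′ j = left-part x y k a b (u j) (v j) (z j) (x₁ j) (y₁ j) (eq j)
          leftA : Span A left
          leftA = Sp.add A (Sp.comb A (x + - (k * a)) (- (k * b)) uA zA) (Sp.scale A (- 1#) (Z₁A sx))
          rightB : Span B right
          rightB = Sp.add B (Z₂B sy) (Sp.scale B (- y) vB)
          fin′ : Span (z ∷ G) left → x ≈ 0# × y ≈ 0#
          fin′ (m ◂ g) = x≈0 , proj₂ zy
            where
            ux : x + - (k * a) ≈ 0# × - (k * b) + - m ≈ 0#
            ux = ind₁ (x + - (k * a)) (- (k * b) + - m) (Sp.resp (Z₁ ++ G)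
              (λ j → collect-left (x + - (k * a)) (- (k * b)) m (u j) (z j) (x₁ j))
              (Sp.comb (Z₁ ++ G) 1# 1# (++-⊑ʳ Z₁ g) sx))
            zy : m ≈ 0# × y ≈ 0#
            zy = ind₂ m y (Sp.resp (Z₂ ++ G) (λ j → collect-right y m (v j) (z j) (y₁ j))
              (Sp.comb (Z₂ ++ G) 1# (- 1#) sy (Sp.resp (Z₂ ++ G) (λ j → +-congʳ (eq′ j)) (++-⊑ʳ Z₂ g))))
            kb : k * b ≈ 0#
            kb = -≈0 (zero-difference (proj₂ ux) (proj₁ zy))
            k≈0 : k ≈ 0#
            k≈0 = *-cancel-0 nb (≈-trans (*-comm b k) kb)
            x≈0 : x ≈ 0#
            x≈0 = zero-difference (proj₁ ux) (≈-trans (*-congʳ k≈0) (zeroˡ a))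
    h₂′ : (pts ∣ W) (c · z ⊹ d · v)
    h₂′ = mono-point (λ p∈ → proj₁ (∈-restrict⁻ {B} {pts} p∈)) (λ s → Span-there (Z₂W s)) h₂
    final : (pts ∣ W) ((- (c * e * a)) · u ⊹ d · v)
    final = Pt.resp pts W (λ j → substitute a b c d e (u j) (v j) (z j) be)
      (Pt.plus-W pts W {c · z ⊹ d · v} { - (c * e) · w₀} (Sp.scale W (- (c * e)) (∷-mono Z₁W s₀)) h₂′)

  connect : ∀ k pts G u v → measure G pts < k → u L.∈ pts → v L.∈ pts → Independent₂ G u v → Split pts G u v ⊎ Join pts G u v
  connect (suc k) pts G u v (s≤s le) u∈ v∈ ind =
      decide (Any.any? (λ z → ¬? (Span? (u ∷ G) z) ×-dec ¬? (Span? (v ∷ G) z)) pts)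
    where
    decide : Dec (Any.Any (λ z → ¬ Span (u ∷ G) z × ¬ Span (v ∷ G) z) pts) → Split pts G u v ⊎ Join pts G u v
    decide (no none) = inj₁ (splitting (u ∷ G) (v ∷ G) (∷-⊑ (++-⊑ˡ {pts} (Span-∈ u∈)) (++-⊑ʳ pts)) (∷-⊑ (++-⊑ˡ {pts} (Span-∈ v∈)) (++-⊑ʳ pts))
        (Span-here G) (Span-here G) Span-there Span-there covers meet)
      where
      covers : ∀ {p} → p L.∈ pts → Span (u ∷ G) p ⊎ Span (v ∷ G) p
      covers {p} p∈ with Span? (u ∷ G) p | Span? (v ∷ G) p
      ... | yes s | _ = inj₁ s
      ... | no _ | yes s = inj₂ s
      ... | no n | no m = absurd (none (lose p∈ (n , m)))
      meet : ∀ {w} → Span (u ∷ G) w → Span (v ∷ G) w → Span G w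
      meet {w} (a ◂ s) (b ◂ s′) = Sp.resp G (λ j → drop-0 (w j) (u j) (≈-trans (-‿cong a≈0) (≈-trans (≈-sym (+-identityˡ _)) (FiniteField.-‿inverseʳ 𝔽 0#)))) s
        where
        a≈0 : a ≈ 0#
        a≈0 = proj₁ (ind a (- b) (Sp.resp G (λ j → compare a b (u j) (v j) (w j)) (Sp.comb G (- 1#) 1# s s′)))
    decide (yes found) = let z , z∈ , nu , nv = find found in step z z∈ nu nv (Span? (v ∷ u ∷ G) z)
      where
      step : ∀ z → z L.∈ pts → ¬ Span (u ∷ G) z → ¬ Span (v ∷ G) z → Dec (Span (v ∷ u ∷ G) z) → Split pts G u v ⊎ Join pts G u v
      step z z∈ nu nv (yes (b ◂ (a ◂ s))) = inj₂ (joining [] [] ind a b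
          (λ x → nv (b ◂ Sp.resp G (λ j → drop-second b a (v j) (u j) (z j) x) s))
          (λ x → nu (a ◂ Sp.resp G (λ j → drop-first b a (v j) (u j) (z j) x) s))
          (lose z∈ (1# ◂ Sp.resp G (λ j → ≈-trans (negate b a (v j) (u j) (z j)) (+-congʳ (+-comm (b * v j) (a * u j)))) (Sp.scale G (- 1#) s))))
      step z z∈ nu nv (no nuv) = [ split , inj₂ ∘ lift ]′
          (connect k pts (z ∷ G) u v (ℕ.≤-trans (measure-contract z∈ (nu ∘ Span-there)) le) u∈ v∈ ind′)
        where
        ind′ : Independent₂ (z ∷ G) u v
        ind′ a b (c ◂ s) = go (c ≟ᶠ 0#)
          where
          go : Dec (c ≈ 0#) → a ≈ 0# × b ≈ 0#
          go (yes x) = ind a b (Sp.resp G (λ j → drop-0 (a * u j + b * v j) (z j) (-‿zero x)) s)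
          go (no nc) = absurd (nuv (Sp.divide (v ∷ u ∷ G) nc (Sp.resp (v ∷ u ∷ G) (λ j → solve-third a b c (u j) (v j) (z j))
            (Sp.comb (v ∷ u ∷ G) 1# (- 1#) (Sp.comb (v ∷ u ∷ G) a b (Span-there (Span-here G)) (Span-here (u ∷ G))) (Span-there (Span-there s))))))
        lift : Join pts (z ∷ G) u v → Join pts G u v
        lift (joining Z Z⊂ i a b na nb h) = joining (Z ++ (z ∷ [])) (All.++⁺ Z⊂ (z∈ ∷ []))
          (subst (λ W → Independent₂ W u v) (≡.sym (++-assoc Z (z ∷ []) G)) i) a b na nb
          (subst (λ W → (pts ∣ W) (a · u ⊹ b · v)) (≡.sym (++-assoc Z (z ∷ []) G)) h)
        uz : Independent₂ G u z
        uz a b s = go (b ≟ᶠ 0#)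
          where
          go : Dec (b ≈ 0#) → a ≈ 0# × b ≈ 0#
          go (no nb) = absurd (nu (Sp.divide (u ∷ G) nb (Sp.resp (u ∷ G) (λ j → difference-right (a * u j) (b * z j))
            (Sp.comb (u ∷ G) 1# (- 1#) (Span-there s) (Sp.scale (u ∷ G) a (Span-here G))))))
          go (yes y) = proj₁ (ind a 0# (Sp.resp G (λ j → +-congˡ (≈-trans (*-congʳ y) (≈-trans (zeroˡ _) (≈-sym (zeroˡ _))))) s)) , y
        vz : Independent₂ G v z
        vz a b s = go (b ≟ᶠ 0#)
          where
          go : Dec (b ≈ 0#) → a ≈ 0# × b ≈ 0#
          go (no nb) = absurd (nv (Sp.divide (v ∷ G) nb (Sp.resp (v ∷ G) (λ j → difference-right (a * v j) (b * z j))
            (Sp.comb (v ∷ G) 1# (- 1#) (Span-there s) (Sp.scale (v ∷ G) a (Span-here G))))))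
          go (yes y) = proj₁ (independent-sym ind a 0# (Sp.resp G (λ j → +-congˡ (≈-trans (*-congʳ y) (≈-trans (zeroˡ _) (≈-sym (zeroˡ _))))) s)) , y
        split : Split pts (z ∷ G) u v → Split pts G u v ⊎ Join pts G u v
        split (splitting A B A⊑ B⊑ uA vB GA GB cov meet) =
            [ inj₁ ∘ left , (λ j₁ → [ inj₁ ∘ right , (λ j₂ → inj₂ (join-trans u∈ G⊑A G⊑B meet uA zA zB vB j₁ j₂)) ]′
                (connect k (restrict B pts) G z v (ℕ.≤-trans (measure-restrict u∈ u∉B G⊑B) le) (∈-restrict⁺ z∈ zB) (∈-restrict⁺ v∈ vB) (independent-sym vz))) ]′
              (connect k (restrict A pts) G u z (ℕ.≤-trans (measure-restrict v∈ v∉A G⊑A) le) (∈-restrict⁺ u∈ uA) (∈-restrict⁺ z∈ zA) uz)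
          where
          G⊑A : G ⊑ A
          G⊑A s = GA (Span-there s)
          G⊑B : G ⊑ B
          G⊑B s = GB (Span-there s)
          zA = GA (Span-here G)
          zB = GB (Span-here G)
          v∉A : ¬ Span A v
          v∉A s = independent-∉ (independent-sym ind′) (Span-there (meet s vB))
          u∉B : ¬ Span B u
          u∉B s = independent-∉ ind′ (Span-there (meet uA s))
          into : ∀ {H} → restrict H pts ++ G ⊑ pts ++ G
          into {H} = ++-⊑ {restrict H pts} (∈⇒⊑ (λ p∈ → ∈-++⁺ˡ (proj₁ (∈-restrict⁻ {H} {pts} p∈)))) (++-⊑ʳ pts)
          within : ∀ {H} → G ⊑ H → restrict H pts ++ G ⊑ H
          within {H} = ++-⊑ {restrict H pts} (All⇒⊑ (All.tabulate (λ p∈ → proj₂ (∈-restrict⁻ {H} {pts} p∈))))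
          z∷G⊑pts : z ∷ G ⊑ pts ++ G
          z∷G⊑pts = ∷-⊑ (++-⊑ˡ {pts} (Span-∈ z∈)) (++-⊑ʳ pts)
          fix : pts ++ (z ∷ G) ⊑ pts ++ G
          fix = ++-⊑ {pts} (++-⊑ˡ {pts}) z∷G⊑pts
          left : Split (restrict A pts) G u z → Split pts G u v
          left (splitting A₁ A₂ A₁⊑ A₂⊑ uA₁ zA₂ G₁ G₂ cov₁ meet₁) = splitting A₁ (A₂ ++ B) (into {A} ∘ A₁⊑)
              (++-⊑ {A₂} (into {A} ∘ A₂⊑) (fix ∘ B⊑)) uA₁ (++-⊑ʳ A₂ vB) G₁ (++-⊑ˡ {A₂} ∘ G₂)
              (λ p∈ → [ (λ pA → [ inj₁ , inj₂ ∘ ++-⊑ˡ {A₂} ]′ (cov₁ (∈-restrict⁺ p∈ pA))) , inj₂ ∘ ++-⊑ʳ A₂ ]′ (cov p∈))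
              meet′
            where
            meet′ : ∀ {w} → Span A₁ w → Span (A₂ ++ B) w → Span G w
            meet′ {w} s s′ = let x , y , sx , sy , eq = ++-split A₂ s′ in go x y sx sy eq
              where
              go : ∀ x y → Span A₂ x → Span B y → w ≋ x ⊹ y → Span G w
              go x y sx sy eq = meet₁ s (Sp.resp A₂ (λ j → ≈-sym (eq j)) (Sp.add A₂ sx (∷-⊑ zA₂ G₂ (meet yA sy))))
                where
                yA : Span A y
                yA = Sp.resp A (λ j → ≈-trans (+-congʳ (*-congˡ (eq j))) (difference-right (x j) (y j)))
                  (Sp.comb A 1# (- 1#) (within {A} G⊑A (A₁⊑ s)) (within {A} G⊑A (A₂⊑ sx)))
          right : Split (restrict B pts) G z v → Split pts G u v
          right (splitting B₁ B₂ B₁⊑ B₂⊑ zB₁ vB₂ G₁ G₂ cov₁ meet₁) = splitting (B₁ ++ A) B₂ (++-⊑ {B₁} (into {B} ∘ B₁⊑) (fix ∘ A⊑)) (into {B} ∘ B₂⊑)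
              (++-⊑ʳ B₁ uA) vB₂ (++-⊑ˡ {B₁} ∘ G₁) G₂
              (λ p∈ → [ inj₁ ∘ ++-⊑ʳ B₁ , (λ pB → [ inj₁ ∘ ++-⊑ˡ {B₁} , inj₂ ]′ (cov₁ (∈-restrict⁺ p∈ pB))) ]′ (cov p∈))
              meet′
            where
            meet′ : ∀ {w} → Span (B₁ ++ A) w → Span B₂ w → Span G w
            meet′ {w} s′ s = let x , y , sx , sy , eq = ++-split B₁ s′ in go x y sx sy eq
              where
              go : ∀ x y → Span B₁ x → Span A y → w ≋ x ⊹ y → Span G w
              go x y sx sy eq = meet₁ (Sp.resp B₁ (λ j → ≈-sym (eq j)) (Sp.add B₁ sx (∷-⊑ zB₁ G₁ (meet sy yB)))) s
                where
                yB : Span B y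
                yB = Sp.resp B (λ j → ≈-trans (+-congʳ (*-congˡ (eq j))) (difference-right (x j) (y j)))
                  (Sp.comb B 1# (- 1#) (within {B} G⊑B (B₂⊑ s)) (within {B} G⊑B (B₁⊑ sx)))

  record Neighbour (pts G : List V) (u v : V) : Set where
    constructor neighbour
    field
      {W}   : List V
      W⊂    : W ⊂ pts
      G⊑W   : G ⊑ W
      apart : ¬ (pts ∣ W) (u ⊹ v)
      f     : V
      pf    : (pts ∣ W) f
      uf    : (pts ∣ W) (u ⊹ f)
      fv    : (pts ∣ W) (f ⊹ v)
      f∉    : ¬ Span (u ∷ v ∷ W) f

  find-neighbour : ∀ {pts G u v} → Good pts → G ⊂ pts → u L.∈ pts → v L.∈ pts → ¬ (pts ∣ G) (u ⊹ v) → Join pts G u v → Neighbour pts G u v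
  find-neighbour {pts} {G} {u} {v} good G⊂ u∈ v∈ nuv (joining Z Z⊂ ind a b na nb h) = go Z Z⊂ ind a b na nb h
    where
    open Good good
    go : ∀ Z → Z ⊂ pts → Independent₂ (Z ++ G) u v → ∀ a b → ¬ (a ≈ 0#) → ¬ (b ≈ 0#) → (pts ∣ Z ++ G) (a · u ⊹ b · v) → Neighbour pts G u v
    go [] _ ind a b na nb h = absurd (nuv (adjacent-sum (adjacent (point∈ u∈) (point∈ v∈) na nb h)))
      where open Mod (Good.lineClosed good) G⊂
    go (z ∷ Z) (z∈ ∷ Z⊂) ind a b na nb h = decide (Pt.point? pts W (u ⊹ v))
      where
      W = Z ++ G
      W⊂ : W ⊂ pts
      W⊂ = All.++⁺ Z⊂ G⊂
      open Mod (Good.lineClosed good) W⊂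
      decide : Dec (Point (u ⊹ v)) → Neighbour pts G u v
      decide (yes p) = go Z Z⊂ (independent-mono {W} {z ∷ W} Span-there ind) 1# 1# 1≉0 1≉0
        (resp (λ j → +-cong (≈-sym (*-identityˡ _)) (≈-sym (*-identityˡ _))) p)
      decide (no ap) = let c , h′ = uncontract h in use c h′
        where
        ap′ : ¬ Point (a · u ⊹ b · v)
        ap′ k = ap (adjacent-sum (adjacent (point∈ u∈) (point∈ v∈) na nb k))
        z∉W : ¬ Span W z
        z∉W s = ap′ (mono {W = z ∷ W} {W} id (∷-⊑ s id) h)
        z∉ : ¬ Span (u ∷ v ∷ W) z
        z∉ (x ◂ (y ◂ s)) = z∉W (Sp.resp W (λ j → drop-both x y (u j) (v j) (z j) (proj₁ xy) (proj₂ xy)) s)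
          where
          xy = ind x y (Sp.resp (z ∷ W) (λ j → expand x y (u j) (v j) (z j)) (Sp.comb (z ∷ W) (- 1#) 1# (Span-there s) (Span-here W)))
        z∉′ : ¬ Span (v ∷ u ∷ W) z
        z∉′ = z∉ ∘ swap-⊑
        use : ∀ c → Point (a · u ⊹ b · v ⊹ - c · z) → Neighbour pts G u v
        use c h′ = [ absurd ∘ ap′ , [ case-u , case-v ]′ ]′
            (quad {x = a · u} {b · v} { - c · z} W⊂ (scale a (point∈ u∈)) (scale b (point∈ v∈)) (scale (- c) (point∈ z∈)) h′)
          where
          nc : ¬ (c ≈ 0#)
          nc x = ap′ (resp (λ j → drop-0 (a * u j + b * v j) (z j) (-‿zero x)) h′)
          case-u : Point (a · u ⊹ - c · z) → Neighbour pts G u v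
          case-u pf = neighbour W⊂ (++-⊑ʳ Z) ap (a · u ⊹ - c · z) pf
            (resp (λ j → add-to a (- c) (u j) (z j)) (adjacent (point∈ u∈) (point∈ z∈) na (-≉0 nc) pf (1# + a) (- c)))
            (adjacent-sum (adjacent pf (point∈ v∈) 1≉0 nb (resp (λ j → shuffle a b (- c) (u j) (v j) (z j)) h′)))
            (λ s → z∉ (Sp.divide (u ∷ v ∷ W) (-≉0 nc) (Sp.resp (u ∷ v ∷ W) (λ j → third a (- c) (u j) (z j))
              (Sp.comb (u ∷ v ∷ W) 1# (- a) s (Span-here (v ∷ W))))))
          case-v : Point (b · v ⊹ - c · z) → Neighbour pts G u v
          case-v pf = neighbour W⊂ (++-⊑ʳ Z) ap (b · v ⊹ - c · z) pf
            (resp (λ j → +-comm (b * v j + - c * z j) (u j))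
              (adjacent-sum (adjacent pf (point∈ u∈) 1≉0 na (resp (λ j → ≈-trans (regroup a b (u j) (v j) (- c * z j)) (shuffle b a (- c) (v j) (u j) (z j))) h′))))
            (resp (λ j → +-comm (v j) (b * v j + - c * z j))
              (resp (λ j → add-to b (- c) (v j) (z j)) (adjacent (point∈ v∈) (point∈ z∈) nb (-≉0 nc) pf (1# + b) (- c))))
            (λ s → z∉′ (Sp.divide (v ∷ u ∷ W) (-≉0 nc) (Sp.resp (v ∷ u ∷ W) (λ j → third b (- c) (v j) (z j))
              (Sp.comb (v ∷ u ∷ W) 1# (- b) (swap-⊑ s) (Span-here (u ∷ W))))))

  -- Two parts of the points meeting in the span of u, v and G cannot both connect u to v:
  -- otherwise common neighbours from the two parts would give a chordless 4-cycle.
  module _ {pts} (good : Good pts) {A B G u v} (covers : ∀ {p} → p L.∈ pts → Span A p ⊎ Span B p)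
    (uA : Span A u) (vA : Span A v) (uB : Span B u) (vB : Span B v)
    (G⊂ : G ⊂ pts) (G⊑A : G ⊑ A) (G⊑B : G ⊑ B) (u∈ : u L.∈ pts) (v∈ : v L.∈ pts)
    (meet : ∀ {w} → Span A w → Span B w → Span (u ∷ v ∷ G) w) (nuv : ¬ (pts ∣ G) (u ⊹ v)) where
    open Good good

    private
      module Part {A B} (uA : Span A u) (vA : Span A v) (uB : Span B u) (vB : Span B v) (G⊑A : G ⊑ A) (G⊑B : G ⊑ B)
        (meet : ∀ {w} → Span A w → Span B w → Span (u ∷ v ∷ G) w)
        (NA : Neighbour (restrict A pts) G u v) (NB : Neighbour (restrict B pts) G u v) where
        module NA = Neighbour NA
        module NB = Neighbour NB
        WA⊑ : NA.W ⊑ A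
        WA⊑ = ⊂⇒⊑ {A = A} {pts} NA.W⊂
        WB⊑ : NB.W ⊑ B
        WB⊑ = ⊂⇒⊑ {A = B} {pts} NB.W⊂
        indB : Independent₂ NB.W u v
        indB = apart⇒independent (Good.lineClosed (restrict-good {B} good)) NB.W⊂ (Pt.point∈ (restrict B pts) NB.W (∈-restrict⁺ u∈ uB))
          (Pt.point∈ (restrict B pts) NB.W (∈-restrict⁺ v∈ vB)) NB.apart

        trivial : ∀ {w} → Span A w → Span NB.W w → Span NA.W w
        trivial {w} wA wW = go (meet wA (WB⊑ wW))
          where
          go : Span (u ∷ v ∷ G) w → Span NA.W w
          go (x ◂ (y ◂ s)) = NA.G⊑W (Sp.resp G (λ j → drop-both x y (u j) (v j) (w j) (proj₁ xy) (proj₂ xy)) s)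
            where
            xy : x ≈ 0# × y ≈ 0#
            xy = indB x y (Sp.resp NB.W (λ j → expand x y (u j) (v j) (w j)) (Sp.comb NB.W (- 1#) 1# (NB.G⊑W s) wW))

        no-uv : ∀ {p} → p L.∈ pts → Span A p → ¬ Span (p ∷ NA.W ++ NB.W) (u ⊹ v)
        no-uv {p} p∈ pA (a ◂ s) = let x , y , sx , sy , eq = ++-split NA.W s in go x y sx sy eq
          where
          go : ∀ x y → Span NA.W x → Span NB.W y → (u ⊹ v) ⊹ - a · p ≋ x ⊹ y → Empty
          go x y sx sy eq = NA.apart (lose (∈-restrict⁺ p∈ pA) (a ◂ Sp.resp NA.W (λ j → ≈-sym (eq j)) (Sp.add NA.W sx (trivial yA sy))))
            where
            yA : Span A y
            yA = Sp.resp A (λ j → move-left a (p j) (u j + v j) (x j) (y j) (eq j))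
              (Sp.comb A 1# (- 1#) (Sp.add A (Sp.add A uA vA) (Sp.scale A (- a) pA)) (WA⊑ sx))

        no-fg : ∀ {p} → p L.∈ pts → Span A p → ¬ Span (p ∷ NA.W ++ NB.W) (NA.f ⊹ NB.f)
        no-fg {p} p∈ pA (a ◂ s) = let x , y , sx , sy , eq = ++-split NA.W s in go x y sx sy eq
          where
          go : ∀ x y → Span NA.W x → Span NB.W y → (NA.f ⊹ NB.f) ⊹ - a · p ≋ x ⊹ y → Empty
          go x y sx sy eq = NB.f∉ (Sp.resp (u ∷ v ∷ NB.W) (λ j → undo (NB.f j) (y j))
              (Sp.comb (u ∷ v ∷ NB.W) 1# 1# (∷-mono (∷-mono NB.G⊑W) (meet gA gB)) (Span-there (Span-there sy))))
            where
            fA : Span A NA.f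
            fA = proj₂ (point-restrict⁻ {A} {pts} NA.W⊂ NA.pf)
            gB : Span B (NB.f ⊹ - 1# · y)
            gB = Sp.add B (proj₂ (point-restrict⁻ {B} {pts} NB.W⊂ NB.pf)) (Sp.scale B (- 1#) (WB⊑ sy))
            gA : Span A (NB.f ⊹ - 1# · y)
            gA = Sp.resp A (λ j → isolate-right (NA.f j) (NB.f j) a (p j) (x j) (y j) (eq j))
              (Sp.add A (Sp.comb A 1# (- 1#) (WA⊑ sx) fA) (Sp.scale A a pA))

    no-two-neighbours : Neighbour (restrict A pts) G u v → Neighbour (restrict B pts) G u v → Empty
    no-two-neighbours NA NB = [ contra-uv , contra-fg ]′
        (cycle good W⊂ (point∈ u∈) (inA (NA.pf)) (point∈ v∈) (inB NB.pf)
          (adjacent₁ (point∈ u∈) (inA NA.pf) (inA NA.uf)) (adjacent₁ (inA NA.pf) (point∈ v∈) (inA NA.fv))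
          (adjacent-sym (adjacent₁ (inB NB.pf) (point∈ v∈) (inB NB.fv))) (adjacent-sym (adjacent₁ (point∈ u∈) (inB NB.pf) (inB NB.uf))))
      where
      module NA = Neighbour NA
      module NB = Neighbour NB
      module P = Part {A} {B} uA vA uB vB G⊑A G⊑B meet NA NB
      module Q = Part {B} {A} uB vB uA vA G⊑B G⊑A (λ b a → meet a b) NB NA
      W = NA.W ++ NB.W
      W⊂ : W ⊂ pts
      W⊂ = All.++⁺ (⊂-restrict⁻ {A = A} {pts} NA.W⊂) (⊂-restrict⁻ {A = B} {pts} NB.W⊂)
      open Mod (Good.lineClosed good) W⊂
      inA : ∀ {w} → (restrict A pts ∣ NA.W) w → Point w
      inA = mono {W = NA.W} {W} (λ p∈ → proj₁ (∈-restrict⁻ {A} {pts} p∈)) (++-⊑ˡ {NA.W})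
      inB : ∀ {w} → (restrict B pts ∣ NB.W) w → Point w
      inB = mono {W = NB.W} {W} (λ p∈ → proj₁ (∈-restrict⁻ {B} {pts} p∈)) (++-⊑ʳ NA.W)
      commute : ∀ {p} → p ∷ W ⊑ p ∷ NB.W ++ NA.W
      commute = ∷-mono (++-⊑ {NA.W} (++-⊑ʳ NB.W) (++-⊑ˡ {NB.W}))
      contra-uv : Point (u ⊹ v) → Empty
      contra-uv h = let p , p∈ , s = find h in [ (λ pA → P.no-uv p∈ pA s) , (λ pB → Q.no-uv p∈ pB (commute s)) ]′ (covers p∈)
      contra-fg : Point (NA.f ⊹ NB.f) → Empty
      contra-fg h = let p , p∈ , s = find h in
        [ (λ pA → P.no-fg p∈ pA s)
        , (λ pB → Q.no-fg p∈ pB (Sp.resp (p ∷ NB.W ++ NA.W) (λ j → +-comm (NA.f j) (NB.f j)) (commute s))) ]′ (covers p∈)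

    split-one-part : Split (restrict A pts) G u v ⊎ Split (restrict B pts) G u v
    split-one-part = [ inj₁ , (λ jA → [ inj₂ , (λ jB → absurd (no-two-neighbours (near uA vA G⊑A jA) (near uB vB G⊑B jB))) ]′
                         (conn uB vB)) ]′ (conn uA vA)
      where
      ind : Independent₂ G u v
      ind = apart⇒independent (Good.lineClosed good) G⊂ (Pt.point∈ pts G u∈) (Pt.point∈ pts G v∈) nuv
      conn : ∀ {H} → Span H u → Span H v → Split (restrict H pts) G u v ⊎ Join (restrict H pts) G u v
      conn {H} uH vH = connect _ (restrict H pts) G u v ℕ.≤-refl (∈-restrict⁺ u∈ uH) (∈-restrict⁺ v∈ vH) ind
      near : ∀ {H} → Span H u → Span H v → G ⊑ H → Join (restrict H pts) G u v → Neighbour (restrict H pts) G u v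
      near {H} uH vH G⊑H = find-neighbour (restrict-good {H} good)
        (All.zipWith (λ (p∈ , s) → ∈-restrict⁺ p∈ s) (G⊂ , All.tabulate (λ p∈ → G⊑H (Span-∈ p∈))))
        (∈-restrict⁺ u∈ uH) (∈-restrict⁺ v∈ vH)
        (nuv ∘ mono {W = G} {G} (λ p∈ → proj₁ (∈-restrict⁻ {H} {pts} p∈)) id)

  record Cut (pts : List V) (x y : V) : Set where
    constructor cutting
    field
      A B    : List V
      covers : ∀ {p} → p L.∈ pts → Span A p ⊎ Span B p
      x∈A    : Span A x
      y∈B    : Span B y
      x∉B    : ¬ Span B x
      y∉A    : ¬ Span A y

  cut-sym : ∀ {pts x y} → Cut pts x y → Cut pts y x
  cut-sym (cutting A B cov xA yB x∉ y∉) = cutting B A ([ inj₂ , inj₁ ]′ ∘ cov) yB xA y∉ x∉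

  MeetsIn : ∀ {pts x y} → (V → Set) → Cut pts x y → Set
  MeetsIn P c = ∀ {w} → Span (Cut.A c) w → Span (Cut.B c) w → P w

  spanned-points : ∀ {pts F} → Good pts → (∀ {u v} → u L.∈ restrict F pts → v L.∈ restrict F pts → (pts ∣ []) (u ⊹ v)) →
    F ⊂ pts → ∀ {w} → Span F w → (pts ∣ []) w
  spanned-points {pts} {F} good adj F⊂ {w} s = go F (All.tabulate (λ e∈ → ∈-restrict⁺ (All.lookup F⊂ e∈) (Span-∈ e∈))) s
    where
    open Good good
    open Mod (Good.lineClosed good) []
    go : ∀ E → E ⊂ restrict F pts → ∀ {w} → Span E w → Point w
    go [] _ (null z) = span⇒point (null z)
    go (e ∷ E) (e∈ ∷ E⊂) {w} (a ◂ s) = let p , p∈ , s′ = find (go E E⊂ s) in step p p∈ s′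
      where
      e-part = ∈-restrict⁻ {F} {pts} e∈
      step : ∀ p → p L.∈ pts → Span (p ∷ []) (w ⊹ - a · e) → Point w
      step p p∈ (b ◂ null z) = decide (b ≟ᶠ 0#)
        where
        decide : Dec (b ≈ 0#) → Point w
        decide (yes b≈0) = resp (λ j → ≈-trans (≈-sym (drop-0 (a * e j) (p j) b≈0)) (recover a b (e j) (p j) (w j) (z j)))
          (scale a (point∈ (proj₁ e-part)))
        decide (no nb) = resp (λ j → recover a b (e j) (p j) (w j) (z j))
          (adjacent₁ (point∈ (proj₁ e-part)) (point∈ p∈) (adj e∈ (∈-restrict⁺ p∈ p∈F)) a b)
          where
          p∈F : Span F p
          p∈F = Sp.divide F nb (Sp.resp F (λ j → recover′ a b (e j) (p j) (w j) (z j)) (⊂⇒⊑ {A = F} {pts} E⊂ s))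

  split-sym : ∀ {pts G u v} → Split pts G u v → Split pts G v u
  split-sym (splitting A B a b c d e f g h) = splitting B A b a d c f e ([ inj₂ , inj₁ ]′ ∘ g) (λ x y → h y x)

  -- A cut refined along one of its two sides: the new meet is spanned by u and G.
  module Refine {pts x y} (c : Cut pts x y) {F G u v}
    (F⊑A : F ⊑ Cut.A c) (F⊑B : F ⊑ Cut.B c) (meet : MeetsIn (Span F) c)
    (uF : Span F u) (vF : Span F v) (G⊑F : G ⊑ F) (F⊑ : F ⊑ u ∷ v ∷ G) (s : Split (restrict (Cut.A c) pts) G u v) where
    open Cut c
    private module S = Split s

    A₁⊑A : S.A ⊑ A
    A₁⊑A h = ++-⊑ {restrict A pts} (All⇒⊑ (All.tabulate λ p∈ → proj₂ (∈-restrict⁻ {A} {pts} p∈))) (λ g → F⊑A (G⊑F g)) (S.A⊑ h)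

    A₂⊑A : S.B ⊑ A
    A₂⊑A h = ++-⊑ {restrict A pts} (All⇒⊑ (All.tabulate λ p∈ → proj₂ (∈-restrict⁻ {A} {pts} p∈))) (λ g → F⊑A (G⊑F g)) (S.B⊑ h)

    u∷G⊑F : u ∷ G ⊑ F
    u∷G⊑F = ∷-⊑ uF G⊑F

    refined-meet : ∀ {w} → Span S.A w → Span (S.B ++ B) w → Span (u ∷ G) w
    refined-meet {w} s₁ s₂ = let k , l , sk , sl , eq = ++-split S.B s₂ in go k l sk sl eq
      where
      go : ∀ k l → Span S.B k → Span B l → w ≋ k ⊹ l → Span (u ∷ G) w
      go k l sk sl eq = go′ (swap-⊑ (F⊑ (meet lA sl)))
        where
        lA : Span A l
        lA = Sp.resp A (λ j → ≈-trans (+-congʳ (*-congˡ (eq j))) (difference-right (k j) (l j))) (Sp.comb A 1# (- 1#) (A₁⊑A s₁) (A₂⊑A sk))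
        go′ : Span (v ∷ u ∷ G) l → Span (u ∷ G) w
        go′ (b ◂ (a ◂ g)) = a ◂ S.meet (Sp.add S.A s₁ (Sp.scale S.A (- a) S.u∈A))
            (Sp.resp S.B (λ j → ≈-trans (transfer a b (k j) (l j) (u j) (v j)) (+-congʳ (≈-sym (eq j))))
              (Sp.add S.B (Sp.add S.B sk (S.G⊑B g)) (Sp.scale S.B b S.v∈B)))

    refined : Span S.A x → Cut pts x y
    refined xA₁ = cutting S.A (S.B ++ B)
      (λ p∈ → [ (λ pA → [ inj₁ , inj₂ ∘ ++-⊑ˡ {S.B} ]′ (S.covers (∈-restrict⁺ p∈ pA))) , inj₂ ∘ ++-⊑ʳ S.B ]′ (covers p∈))
      xA₁ (++-⊑ʳ S.B y∈B) (λ h → x∉B (F⊑B (u∷G⊑F (refined-meet xA₁ h)))) (y∉A ∘ A₁⊑A)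

  PerfectCut : List V → V → V → Set
  PerfectCut pts x y = Σ (Cut pts x y) (MeetsIn (pts ∣ []))

  perfect-sym : ∀ {pts x y} → PerfectCut pts x y → PerfectCut pts y x
  perfect-sym (c , m) = cut-sym c , λ a b → m b a

  private
    size : List V → List V → ℕ
    size F pts = length (filter (Span? F) pts)

    size-< : ∀ {F F′ pts v} → F′ ⊑ F → v L.∈ pts → Span F v → ¬ Span F′ v → size F′ pts < size F pts
    size-< {F} {F′} {pts} h v∈ vF v∉ = subst (λ xs → length (filter (Span? F′) xs) < size F pts)
      (filter-all (λ _ → yes tt) {xs = pts} (All.tabulate (λ _ → tt)))
      (filter-filter-< (Span? F′) (λ _ → yes tt) (Span? F) h v∈ vF (v∉ ∘ proj₁))

  perfect : ∀ k {pts x y F} → Good pts → x L.∈ pts → y L.∈ pts → (c : Cut pts x y) → F ⊂ pts → F ⊑ Cut.A c → F ⊑ Cut.B c →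
    MeetsIn (Span F) c → size F pts < k → PerfectCut pts x y
  perfect (suc k) {pts} {x} {y} {F} good x∈ y∈ c F⊂ F⊑A F⊑B meet (s≤s le) =
      decide (Any.any? (λ u → Any.any? (λ v → ¬? (Pt.point? pts [] (u ⊹ v))) (restrict F pts)) (restrict F pts))
    where
    open Good good
    open Cut c
    decide : Dec (Any.Any (λ u → Any.Any (λ v → ¬ (pts ∣ []) (u ⊹ v)) (restrict F pts)) (restrict F pts)) → PerfectCut pts x y
    decide (no none) = c , λ a b → spanned-points good adj F⊂ (meet a b)
      where
      adj : ∀ {u v} → u L.∈ restrict F pts → v L.∈ restrict F pts → (pts ∣ []) (u ⊹ v)
      adj {u} {v} u∈ v∈ = decidable-stable (Pt.point? pts [] (u ⊹ v)) λ n → none (lose u∈ (lose v∈ n))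
    decide (yes some) = let u , u∈ , some′ = find some ; v , v∈ , nuv = find some′ in go u v u∈ v∈ nuv
      where
      go : ∀ u v → u L.∈ restrict F pts → v L.∈ restrict F pts → ¬ (pts ∣ []) (u ⊹ v) → PerfectCut pts x y
      go u v u∈F v∈F nuv = [ side₁′ , side₂′ ]′
          (split-one-part good {A} {B} {G} covers (F⊑A uF) (F⊑A vF) (F⊑B uF) (F⊑B vF) G⊂ (λ g → F⊑A (G⊑F g)) (λ g → F⊑B (G⊑F g))
            u∈ v∈ (λ a b → F⊑ (meet a b)) nuvG)
        where
        u∈ = proj₁ (∈-restrict⁻ {F} {pts} u∈F)
        v∈ = proj₁ (∈-restrict⁻ {F} {pts} v∈F)
        uF = proj₂ (∈-restrict⁻ {F} {pts} u∈F)
        vF = proj₂ (∈-restrict⁻ {F} {pts} v∈F)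
        goodF = restrict-good {F} good
        sep : Separator goodF (restrict F pts) [] u v
        sep = separate goodF (restrict F pts) (All.tabulate id) [] (Pt.point∈ (restrict F pts) [] u∈F) (Pt.point∈ (restrict F pts) [] v∈F)
          (λ h → nuv (proj₁ (point-restrict⁻ {F} {pts} [] h)))
        module Sep = Separator sep
        G = Sep.W′
        G⊂ : G ⊂ pts
        G⊂ = ⊂-restrict⁻ {A = F} {pts} Sep.W′⊂
        G⊑F : G ⊑ F
        G⊑F = ⊂⇒⊑ {A = F} {pts} Sep.W′⊂
        F⊑ : F ⊑ u ∷ v ∷ G
        F⊑ = All⇒⊑ (All.tabulate λ e∈ → [ ∷-mono Span-there , Span-there ]′ (Sep.covers (∈-restrict⁺ (All.lookup F⊂ e∈) (Span-∈ e∈))))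
        nuvG : ¬ (pts ∣ G) (u ⊹ v)
        nuvG h = Sep.apart (point-restrict⁺ {F} {pts} 𝟘∈ G⊑F h (Sp.add F uF vF))
        ind : Independent₂ G u v
        ind = apart⇒independent (Good.lineClosed good) G⊂ (Pt.point∈ pts G u∈) (Pt.point∈ pts G v∈) nuvG
        F⊑′ : F ⊑ v ∷ u ∷ G
        F⊑′ h = swap-⊑ (F⊑ h)

        next : ∀ {x y u v} → x L.∈ pts → y L.∈ pts → (c : Cut pts x y) → u L.∈ pts → v L.∈ pts → Span F u → Span F v → F ⊑ u ∷ v ∷ G → Independent₂ G u v →
          F ⊑ Cut.A c → F ⊑ Cut.B c → MeetsIn (Span F) c → (s : Split (restrict (Cut.A c) pts) G u v) → Span (Split.A s) x → PerfectCut pts x y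
        next {u = u} {v} x∈ y∈ c u∈ v∈ uF vF F⊑ ind F⊑A F⊑B meet s xA₁ =
          perfect k good x∈ y∈ (R.refined xA₁) (u∈ ∷ G⊂) (∷-⊑ S.u∈A S.G⊑A) (λ h → ++-⊑ʳ S.B (F⊑B (R.u∷G⊑F h))) R.refined-meet
            (ℕ.≤-trans (size-< R.u∷G⊑F v∈ vF (independent-∉ (independent-sym ind))) le)
          where
          module R = Refine c F⊑A F⊑B meet uF vF G⊑F F⊑ s
          module S = Split s

        side₁′ : Split (restrict A pts) G u v → PerfectCut pts x y
        side₁′ s = [ next x∈ y∈ c u∈ v∈ uF vF F⊑ ind F⊑A F⊑B meet s
                   , next x∈ y∈ c v∈ u∈ vF uF F⊑′ (independent-sym ind) F⊑A F⊑B meet (split-sym s) ]′ (Split.covers s (∈-restrict⁺ x∈ x∈A))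

        side₂′ : Split (restrict B pts) G u v → PerfectCut pts x y
        side₂′ s = perfect-sym ([ next y∈ x∈ c′ u∈ v∈ uF vF F⊑ ind F⊑B F⊑A meet′ s
                   , next y∈ x∈ c′ v∈ u∈ vF uF F⊑′ (independent-sym ind) F⊑B F⊑A meet′ (split-sym s) ]′ (Split.covers s (∈-restrict⁺ y∈ y∈B)))
          where
          c′ = cut-sym c
          meet′ : MeetsIn (Span F) c′
          meet′ b a = meet a b

  perfect-cut : ∀ {pts x y} → Good pts → x L.∈ pts → y L.∈ pts → ¬ (pts ∣ []) (x ⊹ y) → PerfectCut pts x y
  perfect-cut {pts} {x} {y} good x∈ y∈ nxy = perfect _ good x∈ y∈
      (cutting (x ∷ W) (y ∷ W) S.covers (Span-here W) (Span-here W) (independent-∉ ind) (independent-∉ (independent-sym ind)))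
      S.W′⊂ Span-there Span-there meet ℕ.≤-refl
    where
    module S = Separator (separate good pts (All.tabulate id) [] (Pt.point∈ pts [] x∈) (Pt.point∈ pts [] y∈) nxy)
    W = S.W′
    ind : Independent₂ W x y
    ind = apart⇒independent (Good.lineClosed good) S.W′⊂ (Pt.point∈ pts W x∈) (Pt.point∈ pts W y∈) S.apart
    meet : ∀ {w} → Span (x ∷ W) w → Span (y ∷ W) w → Span W w
    meet {w} s s′ = decidable-stable (Span? W w) λ n → independent-∉ ind (∷-⊑ s′ Span-there (Span-exchange s n))

  points : ∀ {n} → (Fin n → V) → List V
  points v = 𝟘 ∷ List.tabulate v

  module _ {n} (v : Fin n → V) where
    open Comb v

    point-index : ∀ {w} → (points v ∣ []) w → w ≋ 𝟘 ⊎ (∃[ i ] ∃[ b ] (¬ (b ≈ 0#) × w ≋ b · v i))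
    point-index {w} h = let p , p∈ , s = find h in go p p∈ s
      where
      strip : ∀ w e → w ≈ (w + - 0# * e)
      strip = solve 2 (λ w e → w := w :+ :- :0 :* e) ≈-refl
      undo′ : ∀ w b e → w + - b * e ≈ 0# → w ≈ b * e
      undo′ w b e z = ≈-trans (≈-sym (restore b e w)) (≈-trans (+-congʳ z) (+-identityˡ _))
      go : ∀ p → p L.∈ points v → Span (p ∷ []) w → w ≋ 𝟘 ⊎ (∃[ i ] ∃[ b ] (¬ (b ≈ 0#) × w ≋ b · v i))
      go _ (here ≡.refl) (b ◂ null z) = inj₁ λ j → ≈-trans (undo′ (w j) b 0# (z j)) (zeroʳ b)
      go _ (there p∈) (b ◂ null z) with ∈-tabulate⁻ p∈
      ... | i , ≡.refl = decide (b ≟ᶠ 0#)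
        where
        decide : Dec (b ≈ 0#) → w ≋ 𝟘 ⊎ (∃[ i ] ∃[ b ] (¬ (b ≈ 0#) × w ≋ b · v i))
        decide (yes b≈0) = inj₁ λ j → ≈-trans (undo′ (w j) b (v i j) (z j)) (≈-trans (*-congʳ b≈0) (zeroˡ _))
        decide (no nb) = inj₂ (i , b , nb , λ j → undo′ (w j) b (v i j) (z j))

    v∈points : ∀ i → v i L.∈ points v
    v∈points i = there (∈-tabulate⁺ i)

    Comb⇒Span : ∀ {E P} → (∀ {i} → P i → Span E (v i)) → ∀ {w} → Comb P w → Span E w
    Comb⇒Span {E} h {w} c = decidable-stable (Span? E w) (Comb-least¬¬ (Span-subspace E) (λ p k → k (h p)) c)

  module _ {n} (v : Fin n → V) (good : Good (points v)) where
    all-adjacent-full : (∀ i j → (points v ∣ []) (v i ⊹ v j)) → ∀ {w} → Span (points v) w → (points v ∣ []) w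
    all-adjacent-full adj = spanned-points {points v} {points v} good adj′ (All.tabulate id)
      where
      open Mod (Good.lineClosed good) []
      adj′ : ∀ {x y} → x L.∈ restrict (points v) (points v) → y L.∈ restrict (points v) (points v) → Point (x ⊹ y)
      adj′ x∈ y∈ = go (proj₁ (∈-restrict⁻ {points v} {points v} x∈)) (proj₁ (∈-restrict⁻ {points v} {points v} y∈))
        where
        go : ∀ {x y} → x L.∈ points v → y L.∈ points v → Point (x ⊹ y)
        go (here ≡.refl) y∈ = resp (λ j → ≈-sym (+-identityˡ _)) (point∈ y∈)
        go (there x∈) (here ≡.refl) = resp (λ j → ≈-sym (+-identityʳ _)) (point∈ (there x∈))
        go (there x∈) (there y∈) with ∈-tabulate⁻ x∈ | ∈-tabulate⁻ y∈
        ... | i , ≡.refl | j , ≡.refl = adj i j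

  module Connect {n} (M : Matroid n) (v : Fin n → V) (rep : RepresentedBy 𝔽 M v) (A B : List V)
    (covers : ∀ i → Span A (v i) ⊎ Span B (v i))
    (perfect : ∀ {w} → Span A w → Span B w → w ≋ 𝟘 ⊎ (∃[ i ] ∃[ b ] (¬ (b ≈ 0#) × w ≋ b · v i))) where

    module FM = Full M v rep
    EA = enumerate (λ i → Span? A (v i))
    EB = enumerate (λ i → Span? B (v i))
    module EA = Enumeration EA
    module EB = Enumeration EB
    fA = EA.at
    fB = EB.at
    MA = pullback M fA EA.at-inj
    MB = pullback M fB EB.at-inj
    repA = pullback-represented v fA {M = M} EA.at-inj rep
    repB = pullback-represented v fB {M = M} EB.at-inj rep

    section-full : ∀ {m} (g : Fin m → Fin n) (X : Subset m) →
      (∀ {i} → i ∈ X → Span A (v (g i)) × Span B (v (g i))) → (∀ {i} → Span A (v i) → Span B (v i) → ∃[ a ] (a ∈ X × g a ≡ i)) →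
      ∀ {w} → Comb.Comb (v ∘ g) (_∈ X) w → w ≋ 𝟘 ⊎ (∃[ i ] ∃[ b ] (i ∈ X × ¬ (b ≈ 0#) × w ≋ b · v (g i)))
    section-full g X inAB index {w} c = [ inj₁ , inj₂ ∘ locate ]′ (perfect wA wB)
      where
      wA = Comb⇒Span (v ∘ g) {A} (proj₁ ∘ inAB) c
      wB = Comb⇒Span (v ∘ g) {B} (proj₂ ∘ inAB) c
      locate : ∃[ i ] ∃[ b ] (¬ (b ≈ 0#) × w ≋ b · v i) → ∃[ i ] ∃[ b ] (i ∈ X × ¬ (b ≈ 0#) × w ≋ b · v (g i))
      locate (i , b , nb , eq) = finish (index (Sp.divide A nb (Sp.resp A eq wA)) (Sp.divide B nb (Sp.resp B eq wB)))
        where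
        finish : ∃[ a ] (a ∈ X × g a ≡ i) → ∃[ i ] ∃[ b ] (i ∈ X × ¬ (b ≈ 0#) × w ≋ b · v (g i))
        finish (a , a∈ , ≡.refl) = a , b , a∈ , nb , eq

    part-flat : ∀ E → Flat M (sub (λ i → Span? E (v i)))
    part-flat E = Closure.closed⇒Flat M FM.dM λ {e} c → ∈sub⁺ E? (decidable-stable (E? e) λ k →
        FM.closure⇒Comb c λ c → k (Comb⇒Span v {E} (∈sub⁻ E?) c))
      where
      E? : ∀ i → Dec (Span E (v i))
      E? i = Span? E (v i)

    T : Subset EA.k
    T = preimage fA (image fB ⊤)

    T⁺ : ∀ {a} → Span B (v (fA a)) → a ∈ T
    T⁺ {a} s = let b , e = EB.complete s in ∈preimage⁺ fA {image fB ⊤} (subst (_∈ image fB ⊤) e (∈image⁺ fB {⊤} ∈⊤))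

    T⁻ : ∀ {a} → a ∈ T → Span B (v (fA a))
    T⁻ {a} h = let b , _ , e = ∈image⁻ fB {⊤} (∈preimage⁻ fA {image fB ⊤} h) in subst (Span B ∘ v) e (EB.sound b)

    T-index : ∀ {i} → Span A (v i) → Span B (v i) → ∃[ a ] (a ∈ T × fA a ≡ i)
    T-index sA sB = let a , e = EA.complete sA in a , T⁺ (subst (Span B ∘ v) (≡.sym e) sB) , e

    module FA = Full MA (v ∘ fA) repA
    module FB = Full MB (v ∘ fB) repB

    T-full : FA.FullSet T
    T-full = section-full fA T (λ a∈ → EA.sound _ , T⁻ a∈) T-index

    T-modular : ModularFlat MA T
    T-modular = FA.full-flat-modular (Closure.closed⇒Flat MA FA.dM λ {a} c → T⁺ (decidable-stable (Span? B (v (fA a))) λ k →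
      FA.closure⇒Comb c λ c → k (Comb⇒Span (v ∘ fA) {B} T⁻ c))) T-full

    agree : ∀ X → X ⊆ (image fA ⊤ ∩ image fB ⊤) → Indep MA (preimage fA X) ⇔ Indep MB (preimage fB X)
    agree X X⊆ = mk⇔ (subst (Indep M) (≡.trans eA (≡.sym eB))) (subst (Indep M) (≡.trans eB (≡.sym eA)))
      where
      eA = image-preimage fA X λ h → proj₁ (x∈p∩q⁻ (image fA ⊤) (image fB ⊤) (X⊆ h))
      eB = image-preimage fB X λ h → proj₂ (x∈p∩q⁻ (image fA ⊤) (image fB ⊤) (X⊆ h))

    ET = enumerate (_∈? T)
    module ET = Enumeration ET
    N = pullback MA ET.at ET.at-inj
    repN = pullback-represented (v ∘ fA) ET.at {M = MA} ET.at-inj repA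

    N-full : Full.FullSet N (v ∘ fA ∘ ET.at) repN ⊤
    N-full = section-full (fA ∘ ET.at) ⊤ (λ {i} _ → EA.sound _ , T⁻ (ET.sound i))
      λ sA sB → let a , a∈ , e = T-index sA sB ; l , e′ = ET.complete a∈ in l , ∈⊤ , ≡.trans (cong fA e′) e

    flats : ∀ X → Flat M X ⇔ (Flat MA (preimage fA X) × Flat MB (preimage fB X))
    flats X = mk⇔ (λ fl → down fA EA.at-inj repA fl , down fB EB.at-inj repB fl) (λ (flA , flB) → up flA flB)
      where
      down : ∀ {m} (g : Fin m → Fin n) (inj : Injective _≡_ _≡_ g) (rep′ : RepresentedBy 𝔽 (pullback M g inj) (v ∘ g)) →
        Flat M X → Flat (pullback M g inj) (preimage g X)
      down g inj rep′ fl = Closure.closed⇒Flat (pullback M g inj) F.dM λ {a} c → ∈preimage⁺ g {X} (decidable-stable (g a ∈? X) λ k →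
          F.closure⇒Comb c λ c → Comb-push v g c λ c → k (FM.flat-Comb fl (Comb.Comb-mono v in-X c)))
        where
        module F = Full (pullback M g inj) (v ∘ g) rep′
        in-X : ∀ {i} → push g ∅ (_∈ preimage g X) i → i ∈ X
        in-X (inj₂ (a , a∈ , ≡.refl)) = ∈preimage⁻ g {X} a∈

      module _ (flA : Flat MA (preimage fA X)) (flB : Flat MB (preimage fB X)) where
        in-A : ∀ {i} → Span A (v i) → Comb.Comb v (λ k → k ∈ X × Span A (v k)) (v i) → i ∈ X
        in-A {i} s c = decidable-stable (i ∈? X) λ k → finish k (EA.complete s)
          where
          finish : ¬ (i ∈ X) → ∃[ a ] fA a ≡ i → Empty
          finish k (a , ≡.refl) = Comb-pull v fA (Comb.Comb-mono v (λ (i∈ , s) → let a , e = EA.complete s in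
            inj₂ (a , ∈preimage⁺ fA {X} (subst (_∈ X) (≡.sym e) i∈) , e)) c) λ c → k (∈preimage⁻ fA {X} (FA.flat-Comb flA c))
        in-B : ∀ {i} → Span B (v i) → Comb.Comb v (λ k → k ∈ X × Span B (v k)) (v i) → i ∈ X
        in-B {i} s c = decidable-stable (i ∈? X) λ k → finish k (EB.complete s)
          where
          finish : ¬ (i ∈ X) → ∃[ a ] fB a ≡ i → Empty
          finish k (a , ≡.refl) = Comb-pull v fB (Comb.Comb-mono v (λ (i∈ , s) → let a , e = EB.complete s in
            inj₂ (a , ∈preimage⁺ fB {X} (subst (_∈ X) (≡.sym e) i∈) , e)) c) λ c → k (∈preimage⁻ fB {X} (FB.flat-Comb flB c))

        -- If v e = x + y with x spanned by X ∩ C and y by X ∩ D, and e lies in C, then y is a multiple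
        -- of a point of C ∩ D, which belongs to the flat X ∩ D and hence to X ∩ C.
        absorb-part : ∀ C D → (∀ {w} → Span C w → Span D w → w ≋ 𝟘 ⊎ (∃[ i ] ∃[ b ] (¬ (b ≈ 0#) × w ≋ b · v i))) →
          (∀ {i} → Span D (v i) → Comb.Comb v (λ k → k ∈ X × Span D (v k)) (v i) → i ∈ X) →
          ∀ {e x y} → Span C (v e) → Comb.Comb v (λ k → k ∈ X × Span C (v k)) x → Comb.Comb v (λ k → k ∈ X × Span D (v k)) y → v e ≋ x ⊹ y →
          Comb.Comb v (λ k → k ∈ X × Span C (v k)) (v e)
        absorb-part C D meet in-D {e} {x} {y} sC cx cy eq = go (meet yC yD)
          where
          module CC = Subspace (Comb.Comb-subspace v (λ k → k ∈ X × Span C (v k)))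
          yD : Span D y
          yD = Comb⇒Span v {D} proj₂ cy
          yC : Span C y
          yC = Sp.resp C (λ j → ≈-trans (+-congʳ (*-congˡ (eq j))) (difference-right (x j) (y j))) (Sp.comb C 1# (- 1#) sC (Comb⇒Span v {C} proj₂ cx))
          go : y ≋ 𝟘 ⊎ (∃[ i ] ∃[ b ] (¬ (b ≈ 0#) × y ≋ b · v i)) → Comb.Comb v (λ k → k ∈ X × Span C (v k)) (v e)
          go (inj₁ z) = CC.resp (λ j → ≈-sym (≈-trans (eq j) (≈-trans (+-congˡ (z j)) (+-identityʳ _)))) cx
          go (inj₂ (i , b , nb , h)) = CC.resp (λ j → ≈-sym (≈-trans (eq j) (+-congˡ (h j))))
              (CC.add cx (CC.scale b (Comb.Comb-gen v (i∈X , Sp.divide C nb (Sp.resp C h yC)))))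
            where
            i∈X : i ∈ X
            i∈X = in-D (Sp.divide D nb (Sp.resp D h yD))
              (Subspace.divide (Comb.Comb-subspace v _) nb (Subspace.resp (Comb.Comb-subspace v _) h cy))

        up : Flat M X
        up = Closure.closed⇒Flat M FM.dM λ {e} c → decidable-stable (e ∈? X) λ k → FM.closure⇒Comb c λ c →
            FM.Comb-∪ {λ i → i ∈ X × Span A (v i)} {λ i → i ∈ X × Span B (v i)} (Comb.Comb-mono v (λ {i} i∈ → [ (λ s → inj₁ (i∈ , s)) , (λ s → inj₂ (i∈ , s)) ]′ (covers i)) c)
            λ (x , y , cx , cy , eq) → k
              ([ (λ s → in-A s (absorb-part A B perfect in-B s cx cy eq))
               , (λ s → in-B s (absorb-part B A (λ b a → perfect a b) in-A s cy cx (λ j → ≈-trans (eq j) (+-comm (x j) (y j))))) ]′ (covers e))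

    connection-InMq : Simple M → InMq 𝔽 MA → InMq 𝔽 MB → InMq 𝔽 M
    connection-InMq simple inA inB = mq-gpc M fA fB inA inB EA.at-inj EB.at-inj
      (λ x → [ (λ s → inj₁ (EA.complete s)) , (λ s → inj₂ (EB.complete s)) ]′ (covers x)) T-modular agree
      (ET.k , N , ET.at , Coordinates.dimension 𝔽 N (v ∘ fA ∘ ET.at) repN ,
        (ET.at-inj , (λ j → mk⇔ ET.complete (λ (i , e) → subst (_∈ T) e (ET.sound i))) , λ Y → mk⇔ id id) ,
        Coordinates.full⇒PG 𝔽 N (v ∘ fA ∘ ET.at) repN (pullback-simple {M = MA} ET.at-inj (pullback-simple {M = M} EA.at-inj simple)) N-full)
      flats

  noForbidden-pullback : ∀ {n} {M : Matroid n} {P : Fin n → Set} (P? : ∀ i → Dec (P i)) (E : Enumeration P) → Flat M (sub P?) →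
    ForbiddenFree q M → ForbiddenFree q (pullback M (Enumeration.at E) (Enumeration.at-inj E))
  noForbidden-pullback {M = M} P? E fl none (m , N , F , im) = none (m , N , F , im-restr (sub P?) (Enumeration.at E) fl (pullback-restriction P? M E) im)

  module Build (good : ∀ {n} (M : Matroid n) (v : Fin n → V) → RepresentedBy 𝔽 M v → Simple M → ForbiddenFree q M → Good (points v)) where

    build : ∀ k {n} (M : Matroid n) (v : Fin n → V) → RepresentedBy 𝔽 M v → Simple M → ForbiddenFree q M → n < k → InMq 𝔽 M
    build (suc k) {n} M v rep simple none (s≤s n≤k) =
        decide (Fin.any? λ i → Fin.any? λ j → ¬? (Pt.point? (points v) [] (v i ⊹ v j)))
      where
      g = good M v rep simple none
      decide : Dec (∃[ i ] ∃[ j ] ¬ (points v ∣ []) (v i ⊹ v j)) → InMq 𝔽 M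
      decide (no adj) = mq-pg (Coordinates.dimension 𝔽 M v rep) (Coordinates.full⇒PG 𝔽 M v rep simple λ c →
          [ inj₁ , (λ (i , b , nb , h) → inj₂ (i , b , ∈⊤ , nb , h)) ]′ (point-index v
            (all-adjacent-full v g (λ i j → decidable-stable (Pt.point? (points v) [] (v i ⊹ v j)) λ n → adj (i , j , n))
              (Comb⇒Span v {points v} (λ {i} _ → Span-∈ (v∈points v i)) c))))
      decide (yes (i , j , nij)) = cut (perfect-cut g (v∈points v i) (v∈points v j) nij)
        where
        cut : PerfectCut (points v) (v i) (v j) → InMq 𝔽 M
        cut (c , perfect) = C.connection-InMq simple
            (build k C.MA (v ∘ C.fA) C.repA (pullback-simple {M = M} C.EA.at-inj simple)
              (noForbidden-pullback {M = M} (λ i → Span? A (v i)) C.EA (C.part-flat A) none) (ℕ.≤-trans (C.EA.k< {j} y∉A) n≤k))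
            (build k C.MB (v ∘ C.fB) C.repB (pullback-simple {M = M} C.EB.at-inj simple)
              (noForbidden-pullback {M = M} (λ i → Span? B (v i)) C.EB (C.part-flat B) none) (ℕ.≤-trans (C.EB.k< {i} x∉B) n≤k))
          where
          open Cut c
          module C = Connect M v rep A B (λ i → covers (v∈points v i)) (λ a b → point-index v (perfect a b))

  span-line : ∀ {W x y a b} → Span (x ∷ y ∷ W) a → Span (x ∷ y ∷ W) b → ¬ Span W b → ¬ Span (b ∷ W) a → x ∷ y ∷ W ⊑ a ∷ b ∷ W
  span-line {W} {x} {y} {a} {b} sa sb nb na = go (Span? (y ∷ W) b)
    where
    W⊑ : W ⊑ a ∷ b ∷ W
    W⊑ s = Span-there (Span-there s)
    go : Dec (Span (y ∷ W) b) → x ∷ y ∷ W ⊑ a ∷ b ∷ W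
    go (yes s) = ∷-⊑ (Span-exchange (∷-mono (∷-⊑ yb Span-there) sa) na) (∷-⊑ (Span-there yb) W⊑)
      where
      yb : Span (b ∷ W) y
      yb = Span-exchange s nb
    go (no ns) = ∷-⊑ (∷-⊑ (Span-there (Span-here W)) (∷-⊑ yab W⊑) xb) (∷-⊑ yab W⊑)
      where
      xb : Span (b ∷ y ∷ W) x
      xb = Span-exchange sb ns
      yab : Span (a ∷ b ∷ W) y
      yab = Span-exchange (∷-⊑ (swap-⊑ xb) (∷-mono Span-there) sa) na

  span-plane : ∀ {W x y z a b c} → Span (x ∷ y ∷ z ∷ W) a → Span (x ∷ y ∷ z ∷ W) b → Span (x ∷ y ∷ z ∷ W) c →
    ¬ Span W c → ¬ Span (c ∷ W) b → ¬ Span (b ∷ c ∷ W) a → x ∷ y ∷ z ∷ W ⊑ a ∷ b ∷ c ∷ W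
  span-plane {W} {x} {y} {z} {a} {b} {c} sa sb sc nc nb na = go (Span? (y ∷ z ∷ W) c) (Span? (z ∷ W) c)
    where
    through : ∀ {k l} → x ∷ y ∷ z ∷ W ⊑ k ∷ l ∷ c ∷ W → x ∷ y ∷ z ∷ W ⊑ a ∷ b ∷ c ∷ W
    through h s = span-line (h sa) (h sb) nb na (h s)
    go : Dec (Span (y ∷ z ∷ W) c) → Dec (Span (z ∷ W) c) → x ∷ y ∷ z ∷ W ⊑ a ∷ b ∷ c ∷ W
    go (no n) _ = through (∷-⊑ (∷-⊑ (Span-there (Span-there (Span-here W))) rest (Span-exchange sc n)) rest)
      where
      rest : y ∷ z ∷ W ⊑ y ∷ z ∷ c ∷ W
      rest = ∷-mono (∷-mono Span-there)
    go (yes s) (no n) = through (∷-mono (∷-⊑ (swap-⊑ (Span-exchange s n)) (∷-mono Span-there)))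
    go (yes s) (yes s′) = through (∷-mono (∷-mono (∷-⊑ (Span-exchange s′ nc) Span-there)))

  module Directions {W x y} (ind : Independent₂ W x y) where
    D : Fin (suc q) → V
    D zero = y
    D (suc a) = x ⊹ enum a · y

    D-in : ∀ a → Span (x ∷ y ∷ W) (D a)
    D-in zero = Span-there (Span-here W)
    D-in (suc a) = Sp.add (x ∷ y ∷ W) (Span-here (y ∷ W)) (Sp.scale (x ∷ y ∷ W) (enum a) (Span-there (Span-here W)))

    D∉ : ∀ a → ¬ Span W (D a)
    D∉ zero s = 1≉0 (proj₂ (ind 0# 1# (Sp.resp W (λ j → ≈-sym (≈-trans (+-cong (zeroˡ _) (*-identityˡ _)) (+-identityˡ _))) s)))
    D∉ (suc a) s = 1≉0 (proj₁ (ind 1# (enum a) (Sp.resp W (λ j → +-congʳ (≈-sym (*-identityˡ _))) s)))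

    D-distinct : ∀ a b → a ≢ b → ¬ Span (D b ∷ W) (D a)
    D-distinct zero zero a≢b _ = a≢b ≡.refl
    D-distinct zero (suc b) _ (k ◂ s) = let k≈0 , z = ind (- k) (1# + - (k * enum b)) (Sp.resp W (λ j → coefficients₁ k (enum b) (x j) (y j)) s)
      in 1≉0 (≈-trans (difference⇒≈ z) (≈-trans (*-congʳ (-≈0 k≈0)) (zeroˡ _)))
    D-distinct (suc a) zero _ (k ◂ s) = 1≉0 (proj₁ (ind 1# (enum a + - k) (Sp.resp W (λ j → coefficients₂ k (enum a) (x j) (y j)) s)))
    D-distinct (suc a) (suc b) a≢b (k ◂ s) = let z , z′ = ind (1# + - k) (enum a + - (k * enum b)) (Sp.resp W (λ j → coefficients₃ k (enum a) (enum b) (x j) (y j)) s)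
      in a≢b (cong suc (enum-injective a b (≈-trans (difference⇒≈ z′) (≈-trans (*-congʳ (≈-sym (difference⇒≈ z))) (*-identityˡ _)))))

  module Contraction {n} (M : Matroid n) (v : Fin n → V) (rep : RepresentedBy 𝔽 M v) where
    module Vectored (W X : List V) (W⊂ : W ⊂ points v) {m} (K : Fin m → V)
      (K∈ : ∀ a → (points v ∣ W) (K a)) (K-in : ∀ a → Span (X ++ W) (K a)) (K∉ : ∀ a → ¬ Span W (K a))
      (distinct : ∀ {a b} → a ≢ b → ¬ Span (K b ∷ W) (K a))
      (complete : ∀ i → Span (X ++ W) (v i) → ¬ Span W (v i) → ∃[ a ] Span (K a ∷ W) (v i)) where

      in-F? : ∀ i → Dec (Span (X ++ W) (v i))
      in-F? i = Span? (X ++ W) (v i)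

      F = enumerate in-F?
      module F = Enumeration F
      f = F.at
      MF = pullback M f F.at-inj
      repF = pullback-represented v f {M = M} F.at-inj rep
      module FF = Full MF (v ∘ f) repF

      index : ∀ a → ∃[ i ] (Span (K a ∷ W) (v (f i)) × Span (v (f i) ∷ W) (K a))
      index a = let p , p∈ , s = find (K∈ a) in go p∈ s
        where
        go : ∀ {p} → p L.∈ points v → Span (p ∷ W) (K a) → ∃[ i ] (Span (K a ∷ W) (v (f i)) × Span (v (f i) ∷ W) (K a))
        go (here ≡.refl) s = absurd (K∉ a (∷-⊑ (Sp.zero∈ W) id s))
        go (there p∈) s with ∈-tabulate⁻ p∈
        ... | i , ≡.refl = finish (F.complete (∷-⊑ (K-in a) (++-⊑ʳ X) s′))
          where
          s′ : Span (K a ∷ W) (v i)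
          s′ = Span-exchange s (K∉ a)
          finish : ∃[ l ] f l ≡ i → ∃[ i ] (Span (K a ∷ W) (v (f i)) × Span (v (f i) ∷ W) (K a))
          finish (l , ≡.refl) = l , s′ , s

      g : Fin m → Fin F.k
      g a = proj₁ (index a)

      vg∈ : ∀ a → Span (K a ∷ W) (v (f (g a)))
      vg∈ a = proj₁ (proj₂ (index a))

      K∈g : ∀ a → Span (v (f (g a)) ∷ W) (K a)
      K∈g a = proj₂ (proj₂ (index a))

      g-inj : Injective _≡_ _≡_ g
      g-inj {a} {b} e = decidable-stable (a Fin.≟ b) λ a≢b → distinct a≢b
        (∷-⊑ (subst (λ z → Span (K b ∷ W) (v (f z))) (≡.sym e) (vg∈ b)) Span-there (K∈g a))

      C? : ∀ i → Dec (Span W (v (f i)))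
      C? i = Span? W (v (f i))

      C : Subset F.k
      C = sub C?

      G : Pregeometry F.k
      G = Closure.pregeometry MF FF.dM

      closure⇒Span : ∀ {P i E} → (∀ {j} → P j → Span E (v (f j))) → closure MF P i → Span E (v (f i))
      closure⇒Span {P} {i} {E} h c = decidable-stable (Span? E (v (f i))) λ k → FF.closure⇒Comb c λ c → k (Comb⇒Span (v ∘ f) {E} h c)

      Span⇒closure : ∀ {P i E} → (∀ {e} → e L.∈ E → Span W e ⊎ (∃[ a ] (Span (K a ∷ W) e × P (g a)))) → (∀ {j} → j ∈ C → P j) →
        Span E (v (f i)) → closure MF P i
      Span⇒closure {P} {i} {E} gen C⊆ s = Pregeometry.stable G λ k → all E gen λ a → k (FF.Comb⇒closure (Span-least (Comb.Comb-subspace (v ∘ f) P) a s))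
        where
        CS = Comb.Comb-subspace (v ∘ f) P
        W∈ : ∀ {w} → w L.∈ W → Comb.Comb (v ∘ f) P w
        W∈ {w} w∈ = go (All.lookup W⊂ w∈)
          where
          go : w L.∈ points v → Comb.Comb (v ∘ f) P w
          go (here ≡.refl) = Subspace.zero∈ CS
          go (there w∈′) with ∈-tabulate⁻ w∈′
          ... | i , ≡.refl with F.complete (++-⊑ʳ X (Span-∈ w∈))
          ...   | l , ≡.refl = Comb.Comb-gen (v ∘ f) (C⊆ (∈sub⁺ C? (Span-∈ w∈)))
        W⊑ : ∀ {w} → Span W w → Comb.Comb (v ∘ f) P w
        W⊑ = Span-least CS (All.tabulate W∈)
        one : ∀ {e} → Span W e ⊎ (∃[ a ] (Span (K a ∷ W) e × P (g a))) → Comb.Comb (v ∘ f) P e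
        one (inj₁ s) = W⊑ s
        one (inj₂ (a , s , p)) = Span-least CS (Comb.Comb-gen (v ∘ f) p ∷ All.tabulate W∈) (∷-⊑ (K∈g a) Span-there s)
        all : ∀ E → (∀ {e} → e L.∈ E → Span W e ⊎ (∃[ a ] (Span (K a ∷ W) e × P (g a)))) → ¬ ¬ All (Comb.Comb (v ∘ f) P) E
        all E gen k = k (All.tabulate (one ∘ gen))

      H : Pregeometry m
      H = over G (_∈ C) g

      H⇒Span : ∀ {P a E} → W ⊑ E → (∀ {b} → P b → Span E (K b)) → Pregeometry.cl H P a → Span E (K a)
      H⇒Span {P} {a} {E} W⊑E h c = ∷-⊑ (closure⇒Span {E = E} (λ { (inj₁ j∈) → W⊑E (∈sub⁻ C? j∈)
          ; (inj₂ (b , p , ≡.refl)) → ∷-⊑ (h p) W⊑E (vg∈ b) }) c) W⊑E (K∈g a)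

      Span⇒H : ∀ {P a E} → (∀ {e} → e L.∈ E → Span W e ⊎ (∃[ b ] (Span (K b ∷ W) e × P b))) → W ⊑ E → Span E (K a) → Pregeometry.cl H P a
      Span⇒H {P} {a} {E} gen W⊑E s = Span⇒closure {E = E}
        (λ e∈ → [ inj₁ , (λ (b , s , p) → inj₂ (b , s , inj₂ (b , p , ≡.refl))) ]′ (gen e∈)) inj₁ (∷-⊑ s W⊑E (vg∈ a))

      uniform-minor : ∀ ρ → 2 ≤ ρ → (∀ Y → ∣ Y ∣ ≤ ρ ⇔ Independent (Pregeometry.cl H) Y) → InducedMinor (uniform {m} ρ) M
      uniform-minor ρ 2≤ρ crit = im-restr {M' = MF} (sub in-F?) f flat (pullback-restriction in-F? M F)
          (im-contr {M' = uniform ρ} {M = MF} C g (simple , g-inj , indep , parallel) (im-iso {N = uniform ρ} {M = uniform ρ} ((λ a → a) , id , (λ a → a , id) , λ Y → mk⇔ (subst (λ Z → ∣ Z ∣ ≤ ρ) (≡.sym (image-id Y))) (subst (λ Z → ∣ Z ∣ ≤ ρ) (image-id Y)))))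
        where
        image-id : ∀ (Y : Subset m) → image (λ a → a) Y ≡ Y
        image-id Y = ⊆-antisym (λ h → let i , i∈ , e = ∈image⁻ (λ a → a) {Y} h in subst (_∈ Y) e i∈) (λ i∈ → ∈image⁺ (λ a → a) i∈)
        flat : Flat M (sub in-F?)
        flat = Closure.closed⇒Flat M FM.dM λ {e} c → ∈sub⁺ in-F? (decidable-stable (in-F? e) λ k →
              FM.closure⇒Comb c λ c → k (Comb⇒Span v {X ++ W} (∈sub⁻ in-F?) c))
          where module FM = Full M v rep
        simple : Simple (uniform {m} ρ)
        simple X le = ℕ.≤-trans le 2≤ρ
        contracted⇐ : ∀ Y → IndepContr MF C (image g Y) → Independent (Pregeometry.cl H) Y
        contracted⇐ Y ic {e} e∈ c = Closure.contr⇒ MF FF.dM ic (∈image⁺ g e∈)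
            (Pregeometry.mono G (λ { (inj₁ i) → inj₁ i ; (inj₂ (a , (a∈ , a≢e) , ≡.refl)) → inj₂ (∈image⁺ g a∈ , a≢e ∘ g-inj) }) c)
        contracted⇒ : ∀ Y → Independent (Pregeometry.cl H) Y → IndepContr MF C (image g Y)
        contracted⇒ Y ind = Closure.contr⇐ MF FF.dM λ {e} e∈ c → from-image (λ {e} → ind {e}) e e∈ c
          where
          from-image : Independent (Pregeometry.cl H) Y → ∀ e → e ∈ image g Y → ¬ closure MF ((_∈ C) ⊕ (image g Y ∖ e)) e
          from-image ind e e∈ c with ∈image⁻ g {Y} e∈
          ... | i , i∈ , ≡.refl = ind i∈ (Pregeometry.mono G (λ { (inj₁ i) → inj₁ i
                  ; (inj₂ (j∈ , j≢)) → let a , a∈ , e = ∈image⁻ g {Y} j∈ in inj₂ (a , (a∈ , λ a≡i → j≢ (≡.trans (≡.sym e) (cong g a≡i))) , e) }) c)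
        indep : ∀ Y → ∣ Y ∣ ≤ ρ ⇔ IndepContr MF C (image g Y)
        indep Y = mk⇔ (λ le → contracted⇒ Y λ {e} → to (crit Y) le {e}) (λ ic → from (crit Y) λ {e} → contracted⇐ Y ic {e})
        parallel : ∀ e → ¬ IndepContr MF C ⁅ e ⁆ ⊎ (∃[ i ] (g i ≡ e ⊎ ¬ IndepContr MF C (⁅ e ⁆ ∪ ⁅ g i ⁆)))
        parallel e = decide (C? e)
          where
          decide : Dec (Span W (v (f e))) → ¬ IndepContr MF C ⁅ e ⁆ ⊎ (∃[ i ] (g i ≡ e ⊎ ¬ IndepContr MF C (⁅ e ⁆ ∪ ⁅ g i ⁆)))
          decide (yes s) = inj₁ λ ic → Closure.contr⇒ MF FF.dM ic (x∈⁅x⁆ e) (Pregeometry.ext G (inj₁ (∈sub⁺ C? s)))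
          decide (no ns) = let a , s = complete (f e) (F.sound e) ns in inj₂ (a , near a s (g a Fin.≟ e))
            where
            near : ∀ a → Span (K a ∷ W) (v (f e)) → Dec (g a ≡ e) → g a ≡ e ⊎ ¬ IndepContr MF C (⁅ e ⁆ ∪ ⁅ g a ⁆)
            near a s (yes eq) = inj₁ eq
            near a s (no neq) = inj₂ λ ic → Closure.contr⇒ MF FF.dM ic (∪⁅⁆⁺ˡ ⁅ e ⁆ (g a) (x∈⁅x⁆ e))
              (Span⇒closure {P = (_∈ C) ⊕ ((⁅ e ⁆ ∪ ⁅ g a ⁆) ∖ e)} {E = K a ∷ W}
                (λ { (here ≡.refl) → inj₂ (a , Span-here W , inj₂ (∪⁅⁆⁺ʳ ⁅ e ⁆ (g a) , neq)) ; (there w∈) → inj₁ (Span-∈ w∈) }) inj₁ s)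

  module Excluding (2<q : 2 < q) {n} (M : Matroid n) (v : Fin n → V) (rep : RepresentedBy 𝔽 M v) (none : ForbiddenFree q M) where
    open Contraction M v rep

    drop-scaled : ∀ {W w z α} → α ≈ 0# → Span W (w ⊹ - α · z) → Span W w
    drop-scaled {W} {w} {z} α≈0 = Sp.resp W λ j → drop-0 (w j) (z j) (≈-trans (-‿cong α≈0) (≈-trans (≈-sym (+-identityˡ _)) (FiniteField.-‿inverseʳ 𝔽 0#)))

    line : ∀ {W x y} → W ⊂ points v → (points v ∣ W) x → (points v ∣ W) y → (points v ∣ W) (x ⊹ y) → ∀ c d → (points v ∣ W) (c · x ⊹ d · y)
    line {W} {x} {y} W⊂ px py pxy c d = decidable-stable (point? (c · x ⊹ d · y)) refute
      where
      open Pt (points v) W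
      module Refute (missing : ¬ (points v ∣ W) (c · x ⊹ d · y)) where
        ind : Independent₂ W x y
        ind a b s = go (a ≟ᶠ 0#) (b ≟ᶠ 0#)
          where
          go : Dec (a ≈ 0#) → Dec (b ≈ 0#) → a ≈ 0# × b ≈ 0#
          go (yes za) (yes zb) = za , zb
          go (no na) _ = absurd (missing (divide na (resp (λ j → ≈-trans (+-comm _ _) (isolate₂ a b c d (x j) (y j)))
            (plus-W {u = (a * d + - (c * b)) · y} (Sp.scale W c s) (scale (a * d + - (c * b)) py)))))
          go (yes za) (no nb) = absurd (missing (plus-W (Sp.scale W d (Sp.divide W nb (Sp.resp W (λ j → ≈-trans (+-congʳ (≈-trans (*-congʳ za) (zeroˡ _))) (+-identityˡ _)) s))) (scale c px)))

        c≉0 : ¬ (c ≈ 0#)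
        c≉0 z = missing (resp (λ j → ≈-sym (≈-trans (+-congʳ (≈-trans (*-congʳ z) (zeroˡ _))) (+-identityˡ _))) (scale d py))

        open Directions ind

        E = enumerate (λ a → point? (D a))
        module E = Enumeration E

        K : Fin E.k → V
        K l = D (E.at l)

        distinct : ∀ {a b} → a ≢ b → ¬ Span (K b ∷ W) (K a)
        distinct a≢b = D-distinct _ _ (a≢b ∘ E.at-inj)

        direction-present : ∀ {a w} → Span (D a ∷ W) w → ¬ Span W w → (points v ∣ W) w → ∃[ l ] Span (K l ∷ W) w
        direction-present {a} {w} s nw pw = finish (E.complete {a} (go s))
          where
          finish : ∃[ l ] E.at l ≡ a → ∃[ l ] Span (K l ∷ W) w
          finish (l , e) = l , subst (λ z → Span (D z ∷ W) w) (≡.sym e) s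
          go : Span (D a ∷ W) w → (points v ∣ W) (D a)
          go (k ◂ s) = divide {k} (λ z → nw (drop-scaled {z = D a} z s)) (resp (λ j → flip k (D a j) (w j))
            (plus-W (Sp.scale W (- 1#) s) pw))

        complete : ∀ i → Span (x ∷ y ∷ W) (v i) → ¬ Span W (v i) → ∃[ l ] Span (K l ∷ W) (v i)
        complete i (α ◂ (β ◂ s)) nw = go (α ≟ᶠ 0#)
          where
          pv : (points v ∣ W) (v i)
          pv = point∈ (v∈points v i)
          go : Dec (α ≈ 0#) → ∃[ l ] Span (K l ∷ W) (v i)
          go (yes z) = direction-present {zero} (β ◂ Sp.resp W (λ j → +-congʳ (drop-0 (v i j) (x j) (-‿zero z))) s) nw pv
          go (no nα) = direction-present {suc a} (α ◂ Sp.resp W (λ j → ≈-sym (on-direction (v i j) α β (enum a) (x j) (y j)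
              (≈-trans (quotient β (proj₂ k)) (*-congˡ (≈-sym ea))))) s) nw pv
            where
            k = inverse α nα
            a = proj₁ (enum-surjective (β * proj₁ k))
            ea = proj₂ (enum-surjective (β * proj₁ k))

        -- the directions y, x and x + y
        three : 3 ≤ E.k
        three = Fin.injective⇒≤ {f = f} λ {i} {j} → f-inj {i} {j}
          where
          at-0 = enum-surjective 0#
          at-1 = enum-surjective 1#
          code : Fin 3 → Fin (suc q)
          code zero = zero
          code (suc zero) = suc (proj₁ at-0)
          code (suc (suc zero)) = suc (proj₁ at-1)
          present : ∀ i → (points v ∣ W) (D (code i))
          present zero = py
          present (suc zero) = resp (λ j → ≈-sym (≈-trans (+-congˡ (≈-trans (*-congʳ (proj₂ at-0)) (zeroˡ _))) (+-identityʳ _))) px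
          present (suc (suc zero)) = resp (λ j → +-congˡ (≈-sym (≈-trans (*-congʳ (proj₂ at-1)) (*-identityˡ _)))) pxy
          code-inj : ∀ {i j} → code i ≡ code j → i ≡ j
          code-inj {zero} {zero} _ = ≡.refl
          code-inj {suc zero} {suc zero} _ = ≡.refl
          code-inj {suc (suc zero)} {suc (suc zero)} _ = ≡.refl
          code-inj {zero} {suc zero} ()
          code-inj {zero} {suc (suc zero)} ()
          code-inj {suc zero} {zero} ()
          code-inj {suc (suc zero)} {zero} ()
          code-inj {suc zero} {suc (suc zero)} e = absurd (0≉1 (≈-trans (≈-sym (proj₂ at-0)) (≈-trans (≈-reflexive (cong enum (Fin.suc-injective e))) (proj₂ at-1))))
          code-inj {suc (suc zero)} {suc zero} e = absurd (1≉0 (≈-trans (≈-sym (proj₂ at-1)) (≈-trans (≈-reflexive (cong enum (Fin.suc-injective e))) (proj₂ at-0))))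
          f : Fin 3 → Fin E.k
          f i = proj₁ (E.complete (present i))
          f-inj : ∀ {i j} → f i ≡ f j → i ≡ j
          f-inj {i} {j} e = code-inj (≡.trans (≡.sym (proj₂ (E.complete (present i)))) (≡.trans (cong E.at e) (proj₂ (E.complete (present j)))))

        short : E.k ≤ q
        short = ℕ.≤-pred (E.k< {suc (proj₁ absent)} λ p → missing (resp (λ j → scaled (x j) (y j)) (scale c p)))
          where
          k = inverse c c≉0
          absent = enum-surjective (d * proj₁ k)
          scaled : ∀ x y → c * (x + enum (proj₁ absent) * y) ≈ c * x + d * y
          scaled x y = ≈-trans (distribˡ c x _) (+-congˡ (≈-trans (≈-sym (*-assoc c _ y)) (*-congʳ (≈-trans (*-congˡ (proj₂ absent)) (≈-sym (quotient d (proj₂ k)))))))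

        module VC = Vectored W (x ∷ y ∷ []) W⊂ K E.sound (D-in ∘ E.at) (D∉ ∘ E.at) distinct complete

        contradiction : Empty
        contradiction = none (E.k , uniform 2 , inj₁ (three , short , uniform-IsUniform 2) , VC.uniform-minor 2 ℕ.≤-refl
          (UniformCriterion.uniform₂ VC.H (λ {a} c → D∉ (E.at a) (VC.H⇒Span {a = a} {E = W} id (λ ()) c))
            (λ {a} {b} a≢b c → distinct {a} {b} a≢b (VC.H⇒Span {a = a} {E = K b ∷ W} Span-there (λ { (inj₂ ≡.refl) → Span-here W }) c))
            (λ {a} {b} {c} b≢c a≢b a≢c → VC.Span⇒H {a = a} {E = K b ∷ K c ∷ W}
              (λ { (here ≡.refl) → inj₂ (b , Span-here W , inj₁ (inj₂ ≡.refl)) ; (there (here ≡.refl)) → inj₂ (c , Span-here W , inj₂ ≡.refl) ; (there (there w)) → inj₁ (Span-∈ w) })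
              (λ s → Span-there (Span-there s))
              (span-line (D-in (E.at b)) (D-in (E.at c)) (D∉ (E.at c)) (distinct {b} {c} b≢c) (D-in (E.at a))))))

      refute : ¬ ¬ (points v ∣ W) (c · x ⊹ d · y)
      refute = Refute.contradiction

    lineClosed : LineClosed (points v)
    lineClosed = record { 𝟘∈ = here ≡.refl ; line = line }

    private
      -0≈0 : ∀ {z} → z ≈ 0# → - z ≈ 0#
      -0≈0 z≈0 = ≈-trans (-‿cong z≈0) (≈-trans (≈-sym (+-identityˡ _)) (FiniteField.-‿inverseʳ 𝔽 0#))

    module Quad {W x y e} (W⊂ : W ⊂ points v) (px : (points v ∣ W) x) (py : (points v ∣ W) y) (pe : (points v ∣ W) e)
      (pxye : (points v ∣ W) (x ⊹ y ⊹ e))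
      (nxy : ¬ (points v ∣ W) (x ⊹ y)) (nxe : ¬ (points v ∣ W) (x ⊹ e)) (nye : ¬ (points v ∣ W) (y ⊹ e)) where
      open Mod lineClosed W⊂

      offset : ∀ a → ∃[ γ ] Point ((1# · x ⊹ enum a · y) ⊹ - γ · e)
      offset a = let p , p∈ , s = find pe in go p p∈ s
        where
        e∉ : ¬ Span W e
        e∉ s = nxe (plus-W s px)
        go : ∀ p → p L.∈ points v → Span (p ∷ W) e → ∃[ γ ] Point ((1# · x ⊹ enum a · y) ⊹ - γ · e)
        go p p∈ s = uncontract (mono {W = p ∷ W} {e ∷ W} id (∷-⊑ (Span-exchange s e∉) Span-there)
            (line (p∈ ∷ W⊂) (mono id Span-there px) (mono id Span-there py)
              (Pt.resp (points v) (p ∷ W) (λ j → remove-e (x j) (y j) (e j))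
                (Pt.plus-W (points v) (p ∷ W) {x ⊹ y ⊹ e} { - 1# · e} (Sp.scale (p ∷ W) (- 1#) s) (mono id Span-there pxye))) 1# (enum a)))

      γ : Fin q → Carrier
      γ a = proj₁ (offset a)

      K : Fin (2 ℕ.+ q) → V
      K zero = e
      K (suc zero) = y
      K (suc (suc a)) = (1# · x ⊹ enum a · y) ⊹ - γ a · e

      K∈ : ∀ a → Point (K a)
      K∈ zero = pe
      K∈ (suc zero) = py
      K∈ (suc (suc a)) = proj₂ (offset a)

      apart-xy : ¬ Adjacent x y
      apart-xy = nxy ∘ adjacent-sum
      apart-xe : ¬ Adjacent x e
      apart-xe = nxe ∘ adjacent-sum
      apart-ye : ¬ Adjacent y e
      apart-ye = nye ∘ adjacent-sum

      apart-ze : ∀ a → ¬ Adjacent (K (suc (suc a))) e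
      apart-ze a A = go (enum a ≟ᶠ 0#)
        where
        go : Dec (enum a ≈ 0#) → Empty
        go (no nα) = apart-xy (adjacent px py 1≉0 nα (resp (λ j → along-e (enum a) (γ a) (x j) (y j) (e j)) (A 1# (γ a))))
        go (yes z) = apart-xe (adjacent px pe 1≉0 1≉0 (resp (λ j → ≈-trans (along-e′ (enum a) (γ a) (x j) (y j) (e j)) (+-congʳ (drop-0 _ (y j) z))) (A 1# (γ a + 1#))))

      apart-zy : ∀ a → ¬ Adjacent (K (suc (suc a))) y
      apart-zy a A = go (γ a ≟ᶠ 0#)
        where
        go : Dec (γ a ≈ 0#) → Empty
        go (no nγ) = apart-xe (adjacent px pe 1≉0 (-≉0 nγ) (resp (λ j → along-y (enum a) (γ a) (x j) (y j) (e j)) (A 1# (- enum a))))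
        go (yes z) = nxy (resp (λ j → ≈-trans (along-y′ (enum a) (γ a) (x j) (y j) (e j)) (drop-0 _ (e j) (-0≈0 z))) (A 1# (1# + - enum a)))

      apart-zz : ∀ a b → a ≢ b → ¬ Adjacent (K (suc (suc a))) (K (suc (suc b)))
      apart-zz a b a≢b A = go ((γ b + - γ a) ≟ᶠ 0#)
        where
        nonzero : ∀ {a b} → a ≢ b → ¬ (enum a + - enum b ≈ 0#)
        nonzero a≢b z = a≢b (enum-injective _ _ (difference⇒≈ z))
        go : Dec (γ b + - γ a ≈ 0#) → Empty
        go (no n) = apart-ye (adjacent py pe (nonzero a≢b) n (resp (λ j → z-difference (enum a) (enum b) (γ a) (γ b) (x j) (y j) (e j)) (A 1# (- 1#))))
        go (yes z) = apart-zy a (adjacent (K∈ (suc (suc a))) py 1≉0 (nonzero (a≢b ∘ ≡.sym))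
          (resp (λ j → z-shift (enum a) (enum b) (γ a) (γ b) (x j) (y j) (e j) (≈-sym (difference⇒≈ z))) (K∈ (suc (suc b)))))

      K-apart : ∀ a b → a ≢ b → ¬ Adjacent (K a) (K b)
      K-apart zero zero a≢b _ = a≢b ≡.refl
      K-apart zero (suc zero) _ = apart-ye ∘ adjacent-sym
      K-apart zero (suc (suc b)) _ = apart-ze b ∘ adjacent-sym
      K-apart (suc zero) zero _ = apart-ye
      K-apart (suc zero) (suc zero) a≢b _ = a≢b ≡.refl
      K-apart (suc zero) (suc (suc b)) _ = apart-zy b ∘ adjacent-sym
      K-apart (suc (suc a)) zero _ = apart-ze a
      K-apart (suc (suc a)) (suc zero) _ = apart-zy a
      K-apart (suc (suc a)) (suc (suc b)) a≢b = apart-zz a b (λ eq → a≢b (cong (λ c → suc (suc c)) eq))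

      3≤2+q : 3 ≤ 2 ℕ.+ q
      3≤2+q = s≤s (s≤s (ℕ.≤-trans (s≤s z≤n) 2<q))

      distinct : ∀ {a b} → a ≢ b → ¬ Span (K b ∷ W) (K a)
      distinct {a} {b} a≢b (k ◂ s) = K-apart a b a≢b λ c d → resp (λ j → ≈-trans (+-comm _ _) (combine c d k (K b j) (K a j)))
        (plus-W {u = (c * k + d) · K b} (Sp.scale W c s) (scale (c * k + d) (K∈ b)))

      K∉ : ∀ a → ¬ Span W (K a)
      K∉ a s = let b , b≢a = fresh₁ (ℕ.<⇒≤ 3≤2+q) a in distinct {a} {b} (b≢a ∘ ≡.sym) (Span-there s)

      no-three : ∀ {a b c} → b ≢ c → a ≢ b → a ≢ c → ¬ Span (K b ∷ K c ∷ W) (K a)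
      no-three {a} {b} {c} b≢c a≢b a≢c (k ◂ (l ◂ s)) = go (k ≟ᶠ 0#) (l ≟ᶠ 0#)
        where
        go : Dec (k ≈ 0#) → Dec (l ≈ 0#) → Empty
        go (yes z) _ = distinct a≢c (l ◂ Sp.resp W (λ j → +-congʳ (drop-0 (K a j) (K b j) (-0≈0 z))) s)
        go (no _) (yes z) = distinct a≢b (k ◂ Sp.resp W (λ j → drop-0 _ (K c j) (-0≈0 z)) s)
        go (no nk) (no nl) = K-apart b c b≢c (adjacent (K∈ b) (K∈ c) nk nl (resp (λ j → residue (K a j) k (K b j) l (K c j))
          (plus-W (Sp.scale W (- 1#) s) (K∈ a))))

      K-in : ∀ a → Span (x ∷ y ∷ e ∷ W) (K a)
      K-in zero = Span-there (Span-there (Span-here W))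
      K-in (suc zero) = Span-there (Span-here (e ∷ W))
      K-in (suc (suc a)) = Sp.add (x ∷ y ∷ e ∷ W) (Sp.comb (x ∷ y ∷ e ∷ W) 1# (enum a) (Span-here (y ∷ e ∷ W)) (K-in (suc zero)))
        (Sp.scale (x ∷ y ∷ e ∷ W) (- γ a) (K-in zero))

      complete : ∀ i → Span (x ∷ y ∷ e ∷ W) (v i) → ¬ Span W (v i) → ∃[ a ] Span (K a ∷ W) (v i)
      complete i (α ◂ (β ◂ (δ ◂ s))) _ = go (α ≟ᶠ 0#)
        where
        pv : Point (v i)
        pv = point∈ (v∈points v i)
        go : Dec (α ≈ 0#) → ∃[ a ] Span (K a ∷ W) (v i)
        go (yes z) = go′ (β ≟ᶠ 0#) (δ ≟ᶠ 0#)
          where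
          go′ : Dec (β ≈ 0#) → Dec (δ ≈ 0#) → ∃[ a ] Span (K a ∷ W) (v i)
          go′ (yes z′) _ = zero , (δ ◂ Sp.resp W (λ j → +-congʳ (≈-trans (drop-0 _ (y j) (-0≈0 z′)) (drop-0 (v i j) (x j) (-0≈0 z)))) s)
          go′ (no _) (yes z″) = suc zero , (β ◂ Sp.resp W (λ j → ≈-trans (drop-0 _ (e j) (-0≈0 z″)) (+-congʳ (drop-0 (v i j) (x j) (-0≈0 z)))) s)
          go′ (no nβ) (no nδ) = absurd (apart-ye (adjacent py pe nβ nδ (resp
            (λ j → ≈-trans (+-congˡ (*-congˡ (two-terms (v i j) α β δ (x j) (y j) (e j)))) (≈-trans (minus-minus (v i j) _) (drop-x α β δ (x j) (y j) (e j) z)))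
            (plus-W (Sp.scale W (- 1#) s) pv))))
        go (no nα) = suc (suc a) , (α ◂ decide ((δ + α * γ a) ≟ᶠ 0#))
          where
          k = inverse α nα
          a = proj₁ (enum-surjective (β * proj₁ k))
          βα : β ≈ α * enum a
          βα = ≈-trans (quotient β (proj₂ k)) (*-congˡ (≈-sym (proj₂ (enum-surjective (β * proj₁ k)))))
          s′ : Span W ((v i ⊹ - α · K (suc (suc a))) ⊹ - (δ + α * γ a) · e)
          s′ = Sp.resp W (λ j → ≈-sym (to-z (v i j) α β δ (γ a) (enum a) (x j) (y j) (e j) βα)) s
          decide : Dec (δ + α * γ a ≈ 0#) → Span W (v i ⊹ - α · K (suc (suc a)))
          decide (yes z) = Sp.resp W (λ j → drop-0 _ (e j) (-0≈0 z)) s′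
          decide (no nε) = absurd (apart-ze a (adjacent (K∈ (suc (suc a))) pe nα nε (resp (λ j → residue (v i j) α (K (suc (suc a)) j) (δ + α * γ a) (e j))
            (plus-W (Sp.scale W (- 1#) s′) pv))))

      module VC = Vectored W (x ∷ y ∷ e ∷ []) W⊂ K K∈ K-in K∉ distinct complete

      contradiction : Empty
      contradiction = none (2 ℕ.+ q , uniform 3 , inj₂ (ℕ.+-comm 2 q , uniform-IsUniform 3) , VC.uniform-minor 3 (s≤s (s≤s z≤n))
        (UniformCriterion.uniform₃ VC.H (fresh₂ 3≤2+q)
          (λ {a} {b} {c} b≢c a≢b a≢c h → no-three {a} {b} {c} b≢c a≢b a≢c (VC.H⇒Span {a = a} {E = K b ∷ K c ∷ W} (λ s → Span-there (Span-there s))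
            (λ { (inj₁ (inj₂ ≡.refl)) → Span-here (K c ∷ W) ; (inj₂ ≡.refl) → Span-there (Span-here W) }) h))
          (λ {a} {b} {c} {d} b≢c b≢d c≢d a≢b a≢c a≢d → VC.Span⇒H {a = a} {E = K b ∷ K c ∷ K d ∷ W}
            (λ { (here ≡.refl) → inj₂ (b , Span-here W , inj₁ (inj₁ (inj₂ ≡.refl))) ; (there (here ≡.refl)) → inj₂ (c , Span-here W , inj₁ (inj₂ ≡.refl))
               ; (there (there (here ≡.refl))) → inj₂ (d , Span-here W , inj₂ ≡.refl) ; (there (there (there w))) → inj₁ (Span-∈ w) })
            (λ s → Span-there (Span-there (Span-there s)))
            (span-plane (K-in b) (K-in c) (K-in d) (K∉ d) (distinct {c} {d} c≢d) (no-three {b} {c} {d} c≢d b≢c b≢d) (K-in a)))))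

    good : Good (points v)
    good = record { lineClosed = lineClosed ; quad = λ {W} {x} {y} {z} W⊂ px py pz h → quad {W} {x} {y} {z} W⊂ px py pz h }
      where
      quad : ∀ {W x y z} → W ⊂ points v → (points v ∣ W) x → (points v ∣ W) y → (points v ∣ W) z → (points v ∣ W) (x ⊹ y ⊹ z) →
        (points v ∣ W) (x ⊹ y) ⊎ (points v ∣ W) (x ⊹ z) ⊎ (points v ∣ W) (y ⊹ z)
      quad {W} {x} {y} {z} W⊂ px py pz h = go (Pt.point? (points v) W (x ⊹ y)) (Pt.point? (points v) W (x ⊹ z)) (Pt.point? (points v) W (y ⊹ z))
        where
        go : Dec ((points v ∣ W) (x ⊹ y)) → Dec ((points v ∣ W) (x ⊹ z)) → Dec ((points v ∣ W) (y ⊹ z)) →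
          (points v ∣ W) (x ⊹ y) ⊎ (points v ∣ W) (x ⊹ z) ⊎ (points v ∣ W) (y ⊹ z)
        go (yes a) _ _ = inj₁ a
        go (no _) (yes b) _ = inj₂ (inj₁ b)
        go (no _) (no _) (yes c) = inj₂ (inj₂ c)
        go (no a) (no b) (no c) = absurd (Quad.contradiction W⊂ px py pz h a b c)

image-id : ∀ {m} (Y : Subset m) → image id Y ≡ Y
image-id Y = ⊆-antisym (λ h → let i , i∈ , e = ∈image⁻ id {Y} h in subst (_∈ Y) e i∈) (λ i∈ → ∈image⁺ id {Y} i∈)

uniform-iso : ∀ {r k m} {N : Matroid k} {M : Matroid m} → IsUniform r N → IsUniform r M → k ≡ m → Iso N M
uniform-iso {N = N} {M} U U′ ≡.refl = id , id , (λ y → y , id) , λ Y →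
  mk⇔ (λ ind → subst (Indep M) (≡.sym (image-id Y)) (from (U′ Y) (to (U Y) ind))) (λ ind → from (U Y) (to (U′ Y) (subst (Indep M) (image-id Y) ind)))

bijection-≡ : ∀ {k n} {g : Fin k → Fin n} → Injective _≡_ _≡_ g → (∀ j → ∃[ i ] g i ≡ j) → k ≡ n
bijection-≡ {g = g} inj surj = ℕ.≤-antisym (Fin.injective⇒≤ inj)
  (Fin.injective⇒≤ {f = proj₁ ∘ surj} λ {i} {j} e → ≡.trans (≡.sym (proj₂ (surj i))) (≡.trans (cong g e) (proj₂ (surj j))))

image-uniform : ∀ {k n ρ} {N′ : Matroid k} {N : Matroid n} {g : Fin k → Fin n} → Injective _≡_ _≡_ g → IsUniform ρ N →
  (∀ Y → Indep N′ Y ⇔ Indep N (image g Y)) → IsUniform ρ N′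
image-uniform {ρ = ρ} {g = g} inj U h Y = mk⇔ (λ ind → subst (_≤ ρ) (∣image∣ g inj Y) (to (U _) (to (h Y) ind)))
  (λ le → from (h Y) (from (U _) (subst (_≤ ρ) (≡.sym (∣image∣ g inj Y)) le)))

∣X∣≤size : ∀ {k c} (X : Subset k) → k ≤ c → ∣ X ∣ ≤ c
∣X∣≤size X le = ℕ.≤-trans (∣p∣≤n X) le

pick-two : ∀ {k} → 2 ≤ k → Σ (Fin k) λ i → Σ (Fin k) λ j → i ≢ j
pick-two (s≤s (s≤s _)) = zero , suc zero , λ ()

pick-three : ∀ {k} → 3 ≤ k → Σ (Fin k) λ a → Σ (Fin k) λ b → Σ (Fin k) λ c → a ≢ b × c ≢ a × c ≢ b
pick-three (s≤s (s≤s (s≤s _))) = zero , suc zero , suc (suc zero) , (λ ()) , (λ ()) , λ ()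

module _ {k n ρ} {N′ : Matroid k} {N : Matroid n} (U : IsUniform ρ N) where
  private
    dN : DecIndep N
    dN = uniform-indep? {N = N} U
    module U = Uniform {N = N} U
    module N = Closure N dN
    open Pregeometry N.pregeometry

  flat-surjective : ∀ {F g} → Flat N F → RestrictionVia N′ N F g → (∀ e → closure N (λ i → ∃[ a ] g a ≡ i) e) → k ≡ n
  flat-surjective {F} {g} fl (inj , im , _) spans = bijection-≡ inj λ e → to (im e) (spans e F fl λ (a , eq) → from (im _) (a , eq))

  module _ {C : Subset n} {g : Fin k → Fin n} (si : SiContrVia N′ N C g) where
    private
      simple = proj₁ si
      inj = proj₁ (proj₂ si)
      indep = proj₁ (proj₂ (proj₂ si))
      simplified = proj₂ (proj₂ (proj₂ si))

    contraction-disjoint : ∀ {i c} → c ∈ C → g i ≢ c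
    contraction-disjoint {i} c∈ ≡.refl = N.contr⇒ (to (indep ⁅ i ⁆) (simple ⁅ i ⁆ (ℕ.≤-trans (ℕ.≤-reflexive (∣⁅x⁆∣≡1 i)) (s≤s z≤n))))
      (∈image⁺ g {⁅ i ⁆} (x∈⁅x⁆ i)) (ext (inj₁ c∈))

    trivial-contraction : (∀ {i} → i ∉ C) → 2 ≤ ρ → IsUniform ρ N′ × k ≡ n
    trivial-contraction C∅ 2≤ρ = image-uniform {N′ = N′} {N} inj U (λ Y → mk⇔ (λ ind → down (to (indep Y) ind)) (λ ind → from (indep Y) (up ind))) , bijection-≡ inj surj
      where
      down : ∀ {X} → IndepContr N C X → Indep N X
      down ic = N.independent⇐ λ e∈ c → N.contr⇒ ic e∈ (mono inj₂ c)
      up : ∀ {X} → Indep N X → IndepContr N C X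
      up ind = N.contr⇐ λ e∈ c → N.independent⇒ ind e∈ (mono (λ { (inj₁ i) → absurd (C∅ i) ; (inj₂ h) → h }) c)
      surj : ∀ e → ∃[ i ] g i ≡ e
      surj e with simplified e
      ... | inj₁ dep = absurd (dep (up (from (U ⁅ e ⁆) (ℕ.≤-trans (ℕ.≤-reflexive (∣⁅x⁆∣≡1 e)) (ℕ.≤-trans (s≤s z≤n) 2≤ρ)))))
      ... | inj₂ (i , inj₁ eq) = i , eq
      ... | inj₂ (i , inj₂ dep) = absurd (dep (up (from (U _) (ℕ.≤-trans (ℕ.≤-trans (∣∪⁅⁆∣≤ ⁅ e ⁆ (g i)) (s≤s (ℕ.≤-reflexive (∣⁅x⁆∣≡1 e)))) 2≤ρ))))

    independent-contraction : ∀ {Y} → Indep N′ Y → ∀ {a} → a ∈ Y → ¬ closure N (λ i → i ∈ C ⊎ (∃[ b ] (b ∈ Y × b ≢ a × g b ≡ i))) (g a)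
    independent-contraction {Y} ind {a} a∈ c = N.contr⇒ (to (indep Y) ind) (∈image⁺ g {Y} a∈)
      (mono (λ { (inj₁ i) → inj₁ i ; (inj₂ (b , b∈ , b≢a , ≡.refl)) → inj₂ (∈image⁺ g {Y} b∈ , b≢a ∘ inj) }) c)

    pair-independent : ∀ i j → Indep N′ (⁅ i ⁆ ∪ ⁅ j ⁆)
    pair-independent i j = simple _ (ℕ.≤-trans (∣∪⁅⁆∣≤ ⁅ i ⁆ j) (s≤s (ℕ.≤-reflexive (∣⁅x⁆∣≡1 i))))

    spanned-pair : ∀ {i j} → i ≢ j → ¬ closure N ((_∈ C) ▹ g j) (g i)
    spanned-pair {i} {j} i≢j c = independent-contraction (pair-independent i j) (∪⁅⁆⁺ˡ ⁅ i ⁆ j (x∈⁅x⁆ i))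
      (mono (λ { (inj₁ i) → inj₁ i ; (inj₂ eq) → inj₂ (j , ∪⁅⁆⁺ʳ ⁅ i ⁆ j , i≢j ∘ ≡.sym , ≡.sym eq) }) c)

small-uniform : ∀ {k} {N : Matroid k} → Simple N → k ≤ 2 → IsUniform 2 N
small-uniform simple le Y = mk⇔ (λ _ → ∣X∣≤size Y le) (simple Y)

module Uniform₂ {k n} {N′ : Matroid k} {N : Matroid n} (U : IsUniform 2 N) where
  private
    open module G = Pregeometry (Closure.pregeometry N (uniform-indep? {N = N} U)) using (ext; mono)
    module UN = Uniform {N = N} U

  restriction-size : ∀ {F g} → Flat N F → RestrictionVia N′ N F g → k ≤ 1 ⊎ k ≡ n
  restriction-size {g = g} fl R@(inj , _ , _) = decide (k ℕ.≤? 1)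
    where
    spans : ∀ a b → a ≢ b → ∀ e → closure N (λ i → ∃[ a ] g a ≡ i) e
    spans a b a≢b e with e Fin.≟ g a | e Fin.≟ g b
    ... | yes ≡.refl | _ = ext (a , ≡.refl)
    ... | no _ | yes ≡.refl = ext (b , ≡.refl)
    ... | no na | no nb = mono (λ { (inj₁ (inj₂ eq)) → a , ≡.sym eq ; (inj₂ eq) → b , ≡.sym eq }) (UN.∈closure₂ ≡.refl (a≢b ∘ inj) na nb)
    decide : Dec (k ≤ 1) → k ≤ 1 ⊎ k ≡ n
    decide (yes le) = inj₁ le
    decide (no nle) = let a , b , a≢b = pick-two (ℕ.≰⇒> nle) in inj₂ (flat-surjective {N′ = N′} {N} U fl R (spans a b a≢b))

  contraction : ∀ {C g} → SiContrVia N′ N C g → IsUniform 2 N′ × (k ≤ 1 ⊎ k ≡ n)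
  contraction {C} {g} si = decide (nonempty? C)
    where
    disjoint : ∀ {i c} → c ∈ C → g i ≢ c
    disjoint = contraction-disjoint {N′ = N′} {N} U si
    no-pair : ∀ {c} → c ∈ C → ¬ (2 ≤ k)
    no-pair {c} c∈ le = let i , j , i≢j = pick-two le in spanned-pair {N′ = N′} {N} U si {i} {j} i≢j
      (mono (λ { (inj₁ (inj₂ ≡.refl)) → inj₁ c∈ ; (inj₂ eq) → inj₂ eq })
        (UN.∈closure₂ ≡.refl {c} {g j} {g i} (disjoint c∈ ∘ ≡.sym) (disjoint c∈) (i≢j ∘ proj₁ (proj₂ si))))
    decide : Dec (Nonempty C) → IsUniform 2 N′ × (k ≤ 1 ⊎ k ≡ n)
    decide (no em) = let u , e = trivial-contraction {N′ = N′} {N} U si (λ i∈ → em (_ , i∈)) ℕ.≤-refl in u , inj₂ e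
    decide (yes (c , c∈)) = let le = ℕ.≤-pred (ℕ.≰⇒> (no-pair c∈)) in small-uniform {N = N′} (proj₁ si) (ℕ.m≤n⇒m≤1+n le) , inj₁ le

uniform₂-minor : ∀ {k n} {N′ : Matroid k} {N : Matroid n} → IsUniform 2 N → InducedMinor N′ N → IsUniform 2 N′ × (k ≤ 1 ⊎ k ≡ n)
uniform₂-minor {k} {n} {N′} {N} U im = go im
  where
  combine : ∀ {m} → IsUniform 2 N′ × (k ≤ 1 ⊎ k ≡ m) → m ≤ 1 ⊎ m ≡ n → IsUniform 2 N′ × (k ≤ 1 ⊎ k ≡ n)
  combine (u , inj₁ le) _ = u , inj₁ le
  combine (u , inj₂ ≡.refl) s = u , s
  go : InducedMinor N′ N → IsUniform 2 N′ × (k ≤ 1 ⊎ k ≡ n)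
  go (im-iso (g , inj , surj , h)) = image-uniform {N′ = N′} {N} inj U h , inj₂ (bijection-≡ inj λ j → let i , e = surj j in i , e ≡.refl)
  go (im-restr {M' = M′} F g fl R rest) =
    combine (uniform₂-minor {N′ = N′} {M′} (image-uniform {N′ = M′} {N} (proj₁ R) U (proj₂ (proj₂ R))) rest) (Uniform₂.restriction-size {N′ = M′} {N} U fl R)
  go (im-contr {M' = M′} C g si rest) = let u , s = Uniform₂.contraction {N′ = M′} {N} U si in combine (uniform₂-minor {N′ = N′} {M′} u rest) s

module Uniform₃ {k n} {N′ : Matroid k} {N : Matroid n} (U : IsUniform 3 N) where
  private
    open module G = Pregeometry (Closure.pregeometry N (uniform-indep? {N = N} U)) using (ext; mono)
    module UN = Uniform {N = N} U

  restriction-size : ∀ {F g} → Flat N F → RestrictionVia N′ N F g → k ≤ 2 ⊎ k ≡ n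
  restriction-size {g = g} fl R@(inj , _ , _) = decide (k ℕ.≤? 2)
    where
    spans : ∀ a b c → a ≢ b → c ≢ a → c ≢ b → ∀ e → closure N (λ i → ∃[ a ] g a ≡ i) e
    spans a b c a≢b c≢a c≢b e with e Fin.≟ g a | e Fin.≟ g b | e Fin.≟ g c
    ... | yes ≡.refl | _ | _ = ext (a , ≡.refl)
    ... | no _ | yes ≡.refl | _ = ext (b , ≡.refl)
    ... | no _ | no _ | yes ≡.refl = ext (c , ≡.refl)
    ... | no na | no nb | no nc = mono (λ { (inj₁ (inj₁ (inj₂ eq))) → a , ≡.sym eq ; (inj₁ (inj₂ eq)) → b , ≡.sym eq ; (inj₂ eq) → c , ≡.sym eq })
            (UN.∈closure₃ ≡.refl (a≢b ∘ inj) (c≢a ∘ inj) (c≢b ∘ inj) na nb nc)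
    decide : Dec (k ≤ 2) → k ≤ 2 ⊎ k ≡ n
    decide (yes le) = inj₁ le
    decide (no nle) = let a , b , c , a≢b , c≢a , c≢b = pick-three (ℕ.≰⇒> nle) in
      inj₂ (flat-surjective {N′ = N′} {N} U fl R (spans a b c a≢b c≢a c≢b))

  module Contracted {C c} {g : Fin k → Fin n} (si : SiContrVia N′ N C g) (c∈ : c ∈ C) where
    private
      inj = proj₁ (proj₂ si)
      disjoint : ∀ {i c} → c ∈ C → g i ≢ c
      disjoint = contraction-disjoint {N′ = N′} {N} U si

    uniform₂ : IsUniform 2 N′
    uniform₂ Y = mk⇔ (λ ind → decidable-stable (∣ Y ∣ ℕ.≤? 2) λ nle → let f , f-inj , f∈ = pick 3 Y (ℕ.≰⇒> nle) in refute ind f f-inj f∈) (proj₁ si Y)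
      where
      refute : Indep N′ Y → (f : Fin 3 → Fin k) → Injective _≡_ _≡_ f → (∀ i → f i ∈ Y) → Empty
      refute ind f f-inj f∈ = independent-contraction {N′ = N′} {N} U si ind (f∈ zero)
          (mono (λ { (inj₁ (inj₁ (inj₂ ≡.refl))) → inj₁ c∈
                   ; (inj₁ (inj₂ eq)) → inj₂ (f (suc zero) , f∈ (suc zero) , apart {suc zero} {zero} (λ ()) , ≡.sym eq)
                   ; (inj₂ eq) → inj₂ (f (suc (suc zero)) , f∈ (suc (suc zero)) , apart {suc (suc zero)} {zero} (λ ()) , ≡.sym eq) })
            (UN.∈closure₃ ≡.refl {c} {g (f (suc zero))} {g (f (suc (suc zero)))} {g (f zero)} (disjoint c∈ ∘ ≡.sym) (disjoint c∈)
              (apart {suc (suc zero)} {suc zero} (λ ()) ∘ inj) (disjoint c∈) (apart {zero} {suc zero} (λ ()) ∘ inj) (apart {zero} {suc (suc zero)} (λ ()) ∘ inj)))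
        where
        apart : ∀ {i j} → i ≢ j → f i ≢ f j
        apart i≢j e = i≢j (f-inj e)

    no-pair : ∀ {d} → d ∈ C → d ≢ c → ¬ (2 ≤ k)
    no-pair {d} d∈ d≢c le = let i , j , i≢j = pick-two le in spanned-pair {N′ = N′} {N} U si {i} {j} i≢j
      (mono (λ { (inj₁ (inj₁ (inj₂ ≡.refl))) → inj₁ c∈ ; (inj₁ (inj₂ ≡.refl)) → inj₁ d∈ ; (inj₂ eq) → inj₂ eq })
        (UN.∈closure₃ ≡.refl {c} {d} {g j} {g i} (d≢c ∘ ≡.sym) (disjoint c∈) (disjoint d∈) (disjoint c∈) (disjoint d∈) (i≢j ∘ inj)))

    module Single (C-only : ∀ {i} → i ∈ C → i ≡ c) where
      f : Fin (suc k) → Fin n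
      f zero = c
      f (suc i) = g i
      f-inj : Injective _≡_ _≡_ f
      f-inj {zero} {zero} _ = ≡.refl
      f-inj {zero} {suc j} e = absurd (disjoint c∈ (≡.sym e))
      f-inj {suc i} {zero} e = absurd (disjoint c∈ e)
      f-inj {suc i} {suc j} e = cong suc (inj e)
      nonloop : ∀ {e} → e ≢ c → IndepContr N C ⁅ e ⁆
      nonloop {e} e≢c = Closure.contr⇐ N (uniform-indep? {N = N} U) {C} {⁅ e ⁆} λ {i} i∈ h → UN.∉closure ⁅ c ⁆
        (λ { (inj₁ j∈) → subst (_∈ ⁅ c ⁆) (≡.sym (C-only j∈)) (x∈⁅x⁆ c) ; (inj₂ (j∈ , j≢)) → absurd (j≢ (≡.trans (x∈⁅y⁆⇒x≡y e j∈) (≡.sym (x∈⁅y⁆⇒x≡y e i∈)))) })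
        (∉⁅⁆ (λ i≡c → e≢c (≡.trans (≡.sym (x∈⁅y⁆⇒x≡y e i∈)) i≡c))) (s≤s (ℕ.≤-trans (ℕ.≤-reflexive (∣⁅x⁆∣≡1 c)) (s≤s z≤n))) h
      nonparallel : ∀ {e d} → e ≢ c → d ≢ c → d ≢ e → IndepContr N C (⁅ e ⁆ ∪ ⁅ d ⁆)
      nonparallel {e} {d} e≢c d≢c d≢e = Closure.contr⇐ N (uniform-indep? {N = N} U) {C} {⁅ e ⁆ ∪ ⁅ d ⁆} λ {i} i∈ h → case i i∈ h
        where
        ∈pair : ∀ {j} → j ∈ ⁅ e ⁆ ∪ ⁅ d ⁆ → j ≡ e ⊎ j ≡ d
        ∈pair j∈ = [ inj₁ ∘ x∈⁅y⁆⇒x≡y e , inj₂ ]′ (∪⁅⁆⁻ ⁅ e ⁆ d j∈)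
        other : ∀ {i o} → i ≢ c → o ≢ c → i ≢ o → ¬ closure N ((_∈ C) ▹ o) i
        other {i} {o} i≢c o≢c i≢o h = UN.∉closure₂ (s≤s (s≤s (s≤s z≤n))) {c} {o} {i} (o≢c ∘ ≡.sym) i≢c i≢o (mono (λ { (inj₁ j∈) → inj₁ (inj₂ (C-only j∈)) ; (inj₂ eq) → inj₂ eq }) h)
        case : ∀ i → i ∈ ⁅ e ⁆ ∪ ⁅ d ⁆ → ¬ closure N ((_∈ C) ⊕ ((⁅ e ⁆ ∪ ⁅ d ⁆) ∖ i)) i
        case i i∈ h with ∈pair i∈
        ... | inj₁ ≡.refl = other e≢c d≢c (d≢e ∘ ≡.sym) (mono (λ { (inj₁ j) → inj₁ j ; (inj₂ (j∈ , j≢)) → inj₂ ([ (λ p → absurd (j≢ p)) , id ]′ (∈pair j∈)) }) h)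
        ... | inj₂ ≡.refl = other d≢c e≢c d≢e (mono (λ { (inj₁ j) → inj₁ j ; (inj₂ (j∈ , j≢)) → inj₂ ([ id , (λ p → absurd (j≢ p)) ]′ (∈pair j∈)) }) h)
      surj : ∀ e → ∃[ i ] f i ≡ e
      surj e = decide (e Fin.≟ c)
        where
        near : e ≢ c → ∀ i → g i ≡ e ⊎ ¬ IndepContr N C (⁅ e ⁆ ∪ ⁅ g i ⁆) → ∃[ i ] f i ≡ e
        near e≢c i (inj₁ eq) = suc i , eq
        near e≢c i (inj₂ dep) = suc i , decidable-stable (g i Fin.≟ e) λ ne → dep (nonparallel e≢c (disjoint c∈) ne)
        decide : Dec (e ≡ c) → ∃[ i ] f i ≡ e
        decide (yes eq) = zero , ≡.sym eq
        decide (no e≢c) = [ (λ dep → absurd (dep (nonloop e≢c))) , (λ (i , h) → near e≢c i h) ]′ (proj₂ (proj₂ (proj₂ si)) e)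

      bijective : suc k ≡ n
      bijective = bijection-≡ {g = f} (λ {i} {j} → f-inj {i} {j}) surj

    size : k ≤ 2 ⊎ suc k ≡ n
    size = decide (Fin.any? (λ d → (d ∈? C) ×-dec ¬? (d Fin.≟ c)))
      where
      decide : Dec (∃[ d ] (d ∈ C × d ≢ c)) → k ≤ 2 ⊎ suc k ≡ n
      decide (yes (d , d∈ , d≢c)) = inj₁ (ℕ.<⇒≤ (ℕ.≰⇒> (no-pair d∈ d≢c)))
      decide (no only) = inj₂ (Single.bijective λ {i} i∈ → decidable-stable (i Fin.≟ c) λ n → only (i , i∈ , n))

  contraction : ∀ {C g} → SiContrVia N′ N C g → (IsUniform 3 N′ × k ≡ n) ⊎ (IsUniform 2 N′ × (k ≤ 2 ⊎ suc k ≡ n))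
  contraction {C} {g} si = decide (nonempty? C)
    where
    decide : Dec (Nonempty C) → (IsUniform 3 N′ × k ≡ n) ⊎ (IsUniform 2 N′ × (k ≤ 2 ⊎ suc k ≡ n))
    decide (no em) = inj₁ (trivial-contraction {N′ = N′} {N} U si (λ i∈ → em (_ , i∈)) (s≤s (s≤s z≤n)))
    decide (yes (c , c∈)) = inj₂ (Contracted.uniform₂ si c∈ , Contracted.size si c∈)

uniform₃-minor : ∀ {k n} {N′ : Matroid k} {N : Matroid n} → IsUniform 3 N → InducedMinor N′ N →
  (IsUniform 3 N′ × k ≡ n) ⊎ (IsUniform 2 N′ × (k ≤ 2 ⊎ suc k ≡ n))
uniform₃-minor {k} {n} {N′} {N} U im = go im
  where
  Result : ℕ → Set
  Result m = (IsUniform 3 N′ × k ≡ m) ⊎ (IsUniform 2 N′ × (k ≤ 2 ⊎ suc k ≡ m))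
  below : ∀ {m} → IsUniform 2 N′ × (k ≤ 1 ⊎ k ≡ m) → m ≤ 2 ⊎ suc m ≡ n → Result n
  below (u , inj₁ le) _ = inj₂ (u , inj₁ (ℕ.m≤n⇒m≤1+n le))
  below (u , inj₂ ≡.refl) s = inj₂ (u , s)
  go : InducedMinor N′ N → Result n
  go (im-iso (g , inj , surj , h)) = inj₁ (image-uniform {N′ = N′} {N} inj U h , bijection-≡ inj λ j → let i , e = surj j in i , e ≡.refl)
  go (im-restr {k = l} {M' = M′} F g fl R rest) = continue (Uniform₃.restriction-size {N′ = M′} {N} U fl R)
    where
    U′ : IsUniform 3 M′
    U′ = image-uniform {N′ = M′} {N} (proj₁ R) U (proj₂ (proj₂ R))
    continue : l ≤ 2 ⊎ l ≡ n → Result n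
    continue (inj₁ le) = below (uniform₂-minor {N′ = N′} {M′} (λ Y → mk⇔ (λ _ → ∣X∣≤size Y le) (λ le → from (U′ Y) (ℕ.m≤n⇒m≤1+n le))) rest) (inj₁ le)
    continue (inj₂ e) = subst Result e (uniform₃-minor {N′ = N′} {M′} U′ rest)
  go (im-contr {k = l} {M' = M′} C g si rest) = continue (Uniform₃.contraction {N′ = M′} {N} U si)
    where
    continue : (IsUniform 3 M′ × l ≡ n) ⊎ (IsUniform 2 M′ × (l ≤ 2 ⊎ suc l ≡ n)) → Result n
    continue (inj₁ (u , e)) = subst Result e (uniform₃-minor {N′ = N′} {M′} u rest)
    continue (inj₂ (u , s)) = below (uniform₂-minor {N′ = N′} {M′} u rest) s

module Backward {q} (2<q : 2 < q) (𝔽 : FiniteField q) where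
  open Field 𝔽
  open Linear 𝔽

  private
    two-more : ∃[ a ] (¬ (enum a ≈ 0#) × ¬ (1# - enum a ≈ 0#))
    two-more = let i₀ , e₀ = enum-surjective 0# ; i₁ , e₁ = enum-surjective 1# ; a , a≢i₀ , a≢i₁ = fresh₂ 2<q i₀ i₁ in
      a , (λ z → a≢i₀ (enum-injective a i₀ (≈-trans z (≈-sym e₀)))) ,
          λ z → a≢i₁ (enum-injective a i₁ (≈-trans (≈-trans (lem (enum a) 1#) (≈-trans (+-congˡ (-‿cong z)) (lem′ 1#))) (≈-sym e₁)))
      where
      lem : ∀ a o → a ≈ o + - (o - a)
      lem = solve 2 (λ a o → a := o :+ :- (o :- a)) ≈-refl
      lem′ : ∀ x → x + - 0# ≈ x
      lem′ = solve 1 (λ x → x :+ :- :0 := x) ≈-refl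

    t = enum (proj₁ two-more)
    t≉0 = proj₁ (proj₂ two-more)
    1-t≉0 = proj₂ (proj₂ two-more)

  noForbidden⇒InMq : ∀ {n} (M : Matroid n) → Simple M → Representable 𝔽 M → ForbiddenFree q M → InMq 𝔽 M
  noForbidden⇒InMq {n} M simple (r , v , rep) none =
    C.Build.build (λ M v rep _ none → C.Excluding.good 2<q M v rep none)
      (suc n) M v rep simple none ℕ.≤-refl
    where module C = Chordal 𝔽 {r} t t≉0 1-t≉0

  module _ where
    open Vectors {2}
    open Chordal 𝔽 {2} t t≉0 1-t≉0

    private
      e₁ e₂ : V
      e₁ = δ zero
      e₂ = δ (suc zero)

      independent : Independent₂ [] e₁ e₂
      independent a b (null z) =
        ≈-trans (≈-sym (≈-trans (+-cong (≈-trans (*-congˡ (δ-≡ {2} zero)) (one a)) (≈-trans (*-congˡ (δ-≢ {2} {suc zero} {zero} (λ ()))) (zeroʳ b))) (+-identityʳ a))) (z zero) ,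
        ≈-trans (≈-sym (≈-trans (+-cong (≈-trans (*-congˡ (δ-≢ {2} {zero} {suc zero} (λ ()))) (zeroʳ a)) (≈-trans (*-congˡ (δ-≡ {2} (suc zero))) (one b))) (+-identityˡ b))) (z (suc zero))
        where
        one : ∀ a → a * 1# ≈ a
        one a = ≈-trans (*-comm a 1#) (*-identityˡ a)

      open Directions independent

    uniform₂-representable : ∀ {m} {N : Matroid m} → m ≤ suc q → IsUniform 2 N → Representable 𝔽 N
    uniform₂-representable {m} le U = 2 , v , λ X → mk⇔
        (λ ind → from (Comb.LinIndep⇔ v X) λ {e} → to (criterion X) (to (U X) ind) {e})
        (λ li → from (U X) (from (criterion X) λ {e} → to (Comb.LinIndep⇔ v X) li {e}))
      where
      ι : Fin m → Fin (suc q)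
      ι a = Fin.inject≤ a le
      v : Fin m → V
      v a = D (ι a)
      ι-apart : ∀ {a b} → a ≢ b → ι a ≢ ι b
      ι-apart a≢b = a≢b ∘ Fin.inject≤-injective le le _ _
      open Comb v
      criterion : ∀ X → ∣ X ∣ ≤ 2 ⇔ Independent (Pregeometry.cl linear) X
      criterion = UniformCriterion.uniform₂ linear
        (λ {a} c → c λ c → D∉ (ι a) (Comb⇒Span v {[]} (λ ()) c))
        (λ {a} {b} a≢b c → c λ c → D-distinct (ι a) (ι b) (ι-apart a≢b) (Comb⇒Span v {v b ∷ []} (λ { (inj₂ ≡.refl) → Span-here [] }) c))
        (λ {a} {b} {c} b≢c _ _ k → k (Span-least (Comb-subspace (∅ ▹ b ▹ c)) (Comb-gen (inj₁ (inj₂ ≡.refl)) ∷ Comb-gen (inj₂ ≡.refl) ∷ [])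
          (span-line (D-in (ι b)) (D-in (ι c)) (D∉ (ι c)) (D-distinct (ι b) (ι c) (ι-apart b≢c)) (D-in (ι a)))))

  uniform₂-InMq : ∀ {m} {N : Matroid m} → IsUniform 2 N → m ≤ 2 ⊎ m ≡ suc q → InMq 𝔽 N
  uniform₂-InMq {m} {N} U size = noForbidden⇒InMq N (λ X → from (U X)) (uniform₂-representable {N = N} (bound size) U) none
    where
    bound : m ≤ 2 ⊎ m ≡ suc q → m ≤ suc q
    bound (inj₁ le) = ℕ.≤-trans le (ℕ.≤-trans (ℕ.<⇒≤ 2<q) (ℕ.n≤1+n q))
    bound (inj₂ e) = ℕ.≤-reflexive e
    q+2 : q ℕ.+ 2 ≡ 2 ℕ.+ q
    q+2 = ℕ.+-comm q 2
    none : ForbiddenFree q N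
    none (k , N′ , forb , im) = refute forb (proj₂ (uniform₂-minor U im)) size
      where
      refute : Forbidden q N′ → k ≤ 1 ⊎ k ≡ m → m ≤ 2 ⊎ m ≡ suc q → Empty
      refute (inj₁ (2<k , _)) (inj₁ k≤1) _ = ℕ.<⇒≱ 2<k (ℕ.m≤n⇒m≤1+n k≤1)
      refute (inj₁ (2<k , _)) (inj₂ ≡.refl) (inj₁ m≤2) = ℕ.<⇒≱ 2<k m≤2
      refute (inj₁ (_ , k≤q , _)) (inj₂ ≡.refl) (inj₂ ≡.refl) = ℕ.<-irrefl ≡.refl k≤q
      refute (inj₂ (≡.refl , _)) (inj₁ k≤1) _ = ℕ.<⇒≱ (s≤s (s≤s z≤n)) (subst (_≤ 1) q+2 k≤1)
      refute (inj₂ (≡.refl , _)) (inj₂ ≡.refl) (inj₁ m≤2) = ℕ.<⇒≱ (s≤s (s≤s (ℕ.≤-trans (s≤s z≤n) 2<q))) (subst (_≤ 2) q+2 m≤2)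
      refute (inj₂ (≡.refl , _)) (inj₂ ≡.refl) (inj₂ e) = ℕ.<-irrefl (≡.sym (≡.trans (≡.sym q+2) e)) ℕ.≤-refl

  proper-minor-InMq : ∀ {k m} {N : Matroid m} → Forbidden q N → (N′ : Matroid k) → InducedMinor N′ N → ¬ Iso N′ N → InMq 𝔽 N′
  proper-minor-InMq {N = N} (inj₁ (_ , _ , U)) N′ im proper with uniform₂-minor U im
  ... | u , inj₁ le = uniform₂-InMq {N = N′} u (inj₁ (ℕ.m≤n⇒m≤1+n le))
  ... | u , inj₂ e = absurd (proper (uniform-iso {N = N′} {N} u U e))
  proper-minor-InMq {N = N} (inj₂ (≡.refl , U)) N′ im proper with uniform₃-minor U im
  ... | inj₁ (u , e) = absurd (proper (uniform-iso {N = N′} {N} u U e))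
  ... | inj₂ (u , inj₁ le) = uniform₂-InMq {N = N′} u (inj₁ le)
  ... | inj₂ (u , inj₂ e) = uniform₂-InMq {N = N′} u (inj₂ (ℕ.suc-injective (≡.trans e (ℕ.+-comm q 2))))

theorem1p4 : (q : ℕ) → IsPrimePower q → 2 < q → (𝔽 : FiniteField q) →
    ((∀ {n} (M : Matroid n) → Simple M → Representable 𝔽 M →
    (InMq 𝔽 M ⇔ (¬ (∃[ m ] Σ (Matroid m) λ N → Forbidden q N × InducedMinor N M))))
    ×
    (∀ {m} (N : Matroid m) → Forbidden q N →
    (¬ InMq 𝔽 N) × (∀ {k} (N' : Matroid k) → InducedMinor N' N → ¬ Iso N' N → InMq 𝔽 N')))
theorem1p4 q _ 2<q 𝔽 =
  (λ M simple rep → mk⇔ (λ inMq (m , N , forbidden , im) → inMq-not-forbidden {N = N} {M} inMq forbidden im) (noForbidden⇒InMq M simple rep)) ,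
  λ N forbidden → (λ inMq → inMq-not-forbidden {N = N} {N} inMq forbidden (im-iso (id , id , (λ y → y , id) , λ Y →
      mk⇔ (subst (Indep N) (≡.sym (image-id Y))) (subst (Indep N) (image-id Y))))) , proper-minor-InMq {N = N} forbidden
  where
  open Forward 𝔽 (ℕ.<⇒≤ 2<q)
  open Backward 2<q 𝔽
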